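{- Let $k$ be an integer and $n$ a positive integer, and let $w_0\in B_n$ be given by $w_0(i)=-i$ for all $i$. Then for every $y\in B_n$, \[ \sum_{C\in\mathrm{Conj}(B_n):\,C^k=\{1\}}\psi^C(y)+\sum_{C\in\mathrm{Conj}(B_n):\,C^k=\{w_0\}}\psi^C(y)=\begin{cases}2\,\mathrm{roots}_k^{D_n}(y),& y\in D_n,\\ 0,&\text{otherwise},\end{cases} \] where $C^k=\{x^k:x\in C\}$.
   Context: $\mathrm{roots}_k^G(g)=|\{h\in G:h^k=g\}|$. $B_n$ is the group of bijections $w$ of $\{\pm1,\dots,\pm n\}$ with $w(-i)=-w(i)$; $D_n$ is the subgroup of $w\in B_n$ with an even number of $1\le i\le n$ such that $w(i)<0$. Cycles: if $c=(a_1,\dots,a_\ell)$ is a cycle of $w$ on $\{\pm1,\dots,\pm n\}$ so is $\bar c=(-a_1,\dots,-a_\ell)$; if $c\ne\bar c$, $c\bar c$ is a cycle of length $\ell$ and $\mathbb Z_2$-class $+1$; if $c=\bar c$, it is a cycle of length $\ell/2$ and class $-1$. Higher Lie characters $\psi^C$: for $x\in B_n$ with $a_{i,\varepsilon}$ cycles of length $i$ and class $\varepsilon$, $Z_{B_n}(x)\cong\prod_{i,\varepsilon}G_{i,\varepsilon}\wr S_{a_{i,\varepsilon}}$, where $G_{i,+}\cong\mathbb Z_2\times\mathbb Z_i$ is the centralizer in $B_i$ of one cycle of length $i$ and class $+1$ ($\mathbb Z_2$ generated by $[-1,\dots,-i]$, $\mathbb Z_i$ by the cycle) and $G_{i,-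 }\cong\mathbb Z_{2i}$ is generated by one cycle of length $i$ and class $-1$. $\omega_{i,+}$ is the linear character of $G_{i,+}\wr S_a$ equal on the base group to the product over factors of (trivial on $\mathbb Z_2$)$\times$(faithful linear character of $\mathbb Z_i$) and trivial on the complement $S_a$; $\omega_{i,- }$ is the product over base factors of a faithful linear character of $\mathbb Z_{2i}$, trivial on $S_a$. $\omega^x=\bigotimes\omega_{i,\varepsilon}$ and $\psi^C=\psi^x=\mathrm{Ind}_{Z_{B_n}(x)}^{B_n}\omega^x$ for $x\in C$. -}

module Defs where

open import Level using (Level; _⊔_) renaming (suc to lsuc)
open import Data.Nat using (ℕ; zero; suc; _≤_; _<_; ⌊_/2⌋) renaming (_*_ to _*ℕ_)
open import Data.Integer using (ℤ; +_; -[1+_])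
open import Data.Bool using (Bool; true; false; not; _∧_; _∨_; _xor_; if_then_else_; T)
open import Data.Bool.Properties using () renaming (_≟_ to _≟ᵇ_)
open import Data.Fin using (Fin) renaming (_≟_ to _≟ᶠ_)
open import Data.Maybe using (Maybe; just; nothing)
open import Data.Product using (Σ; _×_; _,_; proj₁; proj₂)
open import Data.List using (List; []; _∷_; foldr; length; upTo; allFin; cartesianProduct; concatMap)
open import Data.Bool.ListAction using (any; all)
import Data.List as L
open import Data.List.Relation.Unary.All using (All)
open import Data.Vec using (Vec; []; _∷_; lookup; tabulate; toList)
import Data.Vec as V
import Data.Vec.Properties as VP
import Data.Product.Properties as PP
open import Relation.Nullary using (¬_)
open import Relation.Nullary.Decidable using (⌊_⌋)
open import Relation.Binary.PropositionalEquality using (_≡_)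
open import Algebra.Bundles using (CommutativeRing)

-- Signed permutations.
-- A point of {±1,…,±n} is (i , s) with i : Fin n and s = true meaning
-- the negative point -i.  An element w of B_n is determined by its
-- values on the positive points (w(-i) = -w(i)), so we store the
-- vector of images w(1),…,w(n).  Such a vector is in B_n iff the
-- underlying map Fin n → Fin n is a bijection (isBb).

Pt : ℕ → Set
Pt n = Fin n × Bool

SP : ℕ → Set
SP n = Vec (Pt n) n

neg : ∀ {n} → Pt n → Pt n
neg (i , s) = (i , not s)

app : ∀ {n} → SP n → Pt n → Pt n
app w (i , s) = (proj₁ (lookup w i) , s xor proj₂ (lookup w i))

compose : ∀ {n} → SP n → SP n → SP n
compose w v = V.map (app w) v

idB : (n : ℕ) → SP n
idB n = tabulate (λ i → (i , false))

w0 : (n : ℕ) → SP n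
w0 n = tabulate (λ i → (i , true))

eqPt : ∀ {n} → Pt n → Pt n → Bool
eqPt p q = ⌊ PP.≡-dec _≟ᶠ_ _≟ᵇ_ p q ⌋

eqSP : ∀ {n} → SP n → SP n → Bool
eqSP v w = ⌊ VP.≡-dec (PP.≡-dec _≟ᶠ_ _≟ᵇ_) v w ⌋

boolFilter : ∀ {a} {A : Set a} → (A → Bool) → List A → List A
boolFilter f [] = []
boolFilter f (x ∷ xs) = if f x then x ∷ boolFilter f xs else boolFilter f xs

allPt : (n : ℕ) → List (Pt n)
allPt n = cartesianProduct (allFin n) (false ∷ true ∷ [])

allVec : ∀ {a} {A : Set a} → List A → (m : ℕ) → List (Vec A m)
allVec xs zero = [] ∷ []
allVec xs (suc m) = concatMap (λ a → L.map (a ∷_) (allVec xs m)) xs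

-- membership in B_n: underlying map Fin n → Fin n is onto (hence bijective)
isBb : ∀ {n} → SP n → Bool
isBb {n} w = all (λ j → any (λ i → ⌊ proj₁ (lookup w i) ≟ᶠ j ⌋) (allFin n)) (allFin n)

IsB : ∀ {n} → SP n → Set
IsB w = T (isBb w)

Bl : (n : ℕ) → List (SP n)
Bl n = boolFilter isBb (allVec (allPt n) n)

evenb : ℕ → Bool
evenb zero = true
evenb (suc zero) = false
evenb (suc (suc m)) = evenb m

negCount : ∀ {n} → SP n → ℕ
negCount w = length (boolFilter proj₂ (toList w))

isDb : ∀ {n} → SP n → Bool
isDb w = isBb w ∧ evenb (negCount w)

Dl : (n : ℕ) → List (SP n)
Dl n = boolFilter isDb (Bl n)

searchFin : ∀ {n} → (Fin n → Bool) → Maybe (Fin n)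
searchFin {zero} f = nothing
searchFin {suc n} f = if f Fin.zero then just Fin.zero else Data.Maybe.map Fin.suc (searchFin (λ i → f (Fin.suc i)))
  where import Data.Fin as Fin
        import Data.Maybe

inv : ∀ {n} → SP n → SP n
inv {n} w = tabulate f
  where
    f : Fin n → Pt n
    f j with searchFin (λ i → ⌊ proj₁ (lookup w i) ≟ᶠ j ⌋)
    ... | just i = (i , proj₂ (lookup w i))
    ... | nothing = (j , false)

powN : ∀ {n} → SP n → ℕ → SP n
powN {n} x zero = idB n
powN x (suc m) = compose x (powN x m)

powZ : ∀ {n} → SP n → ℤ → SP n
powZ x (+ m) = powN x m
powZ x -[1+ m ] = powN (inv x) (suc m)

iterApp : ∀ {n} → SP n → ℕ → Pt n → Pt n
iterApp x zero p = p
iterApp x (suc j) p = app x (iterApp x j p)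

-- q lies in the orbit of p under x (as a permutation of {±1,…,±n});
-- orbits have size ≤ 2n
inOrb : ∀ {n} → SP n → Pt n → Pt n → Bool
inOrb {n} x p q = any (λ j → eqPt (iterApp x j p) q) (upTo (2 *ℕ n))

-- q lies in the cycle of x (c c̄, resp. c = c̄) containing p
inCyc : ∀ {n} → SP n → Pt n → Pt n → Bool
inCyc x p q = inOrb x p q ∨ inOrb x p (neg q)

-- the cycle of x through p has ℤ₂-class -1 (c = c̄)
isNegCls : ∀ {n} → SP n → Pt n → Bool
isNegCls x p = inOrb x p (neg p)

orbLen : ∀ {n} → SP n → Pt n → ℕ
orbLen {n} x p = length (boolFilter (inOrb x p) (allPt n))

cycLen : ∀ {n} → SP n → Pt n → ℕ
cycLen x p = if isNegCls x p then ⌊ orbLen x p /2⌋ else orbLen x p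

-- the element acting as x on the cycle through p and as the identity
-- elsewhere (the generator of ℤ_i, resp. ℤ_{2i})
restrictCyc : ∀ {n} → SP n → Pt n → SP n
restrictCyc x p = tabulate (λ i → if inCyc x p (i , false) then lookup x i else (i , false))

-- the element negating the cycle through p, identity elsewhere
-- (the generator of ℤ₂ in G_{i,+})
negCyc : ∀ {n} → SP n → Pt n → SP n
negCyc x p = tabulate (λ i → if inCyc x p (i , false) then (i , true) else (i , false))

inCentb : ∀ {n} → SP n → SP n → Bool
inCentb x z = isBb z ∧ eqSP (compose z x) (compose x z)

InCent : ∀ {n} → SP n → SP n → Set
InCent x z = T (inCentb x z)

-- z ∈ Z(x) is an involution interchanging two distinct cycles of x
-- and fixing all other points: these are the transpositions of the
-- complement S_a (up to base-group conjugation)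
SwapInv : ∀ {n} → SP n → SP n → Set
SwapInv {n} x z =
  InCent x z × T (eqSP (compose z z) (idB n)) ×
  Σ (Pt n) (λ p → Σ (Pt n) (λ q →
    ¬ T (inCyc x p q) × T (inCyc x q (app z p)) ×
    ((i : Fin n) → T (not (inCyc x p (i , false) ∨ inCyc x q (i , false))) →
       lookup z i ≡ (i , false))))

conjb : ∀ {n} → SP n → SP n → Bool
conjb {n} g r = any (λ h → eqSP (compose h g) (compose r h)) (Bl n)

ClassReps : (n : ℕ) → List (SP n) → Set
ClassReps n R = All IsB R × ((g : SP n) → IsB g → length (boolFilter (conjb g) R) ≡ 1)

module RingOps {c ℓ} (K : CommutativeRing c ℓ) where
  open CommutativeRing K

  ι : ℕ → Carrier
  ι zero = 0#
  ι (suc m) = 1# + ι m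

  powK : Carrier → ℕ → Carrier
  powK a zero = 1#
  powK a (suc m) = a * powK a m

  Σl : ∀ {a} {A : Set a} → List A → (A → Carrier) → Carrier
  Σl xs f = foldr (λ a acc → f a + acc) 0# xs

record CZField c ℓ : Set (lsuc (c ⊔ ℓ)) where
  field
    cring : CommutativeRing c ℓ
  open CommutativeRing cring public
  open RingOps cring public
  field
    1≉0 : ¬ 1# ≈ 0#
    inverse : ∀ x → ¬ x ≈ 0# → Σ Carrier (λ y → x * y ≈ 1#)
    char0 : ∀ m → ¬ ι (suc m) ≈ 0#

module Chars {c ℓ} (F : CZField c ℓ) where
  open CZField F

  -- 1/m (m ≥ 1; the value at 0 is never used)
  recip : ℕ → Carrier
  recip zero = 0#
  recip (suc m) = proj₁ (inverse (ι (suc m)) (char0 m))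

  -- ζ is a primitive m-th root of unity (so ζ ↦ generator defines a
  -- faithful linear character of ℤ_m)
  PrimRoot : Carrier → ℕ → Set ℓ
  PrimRoot ζ m = (powK ζ m ≈ 1#) × (∀ j → 1 ≤ j → j < m → ¬ powK ζ j ≈ 1#)

  -- ρ⁺ i : value of the faithful character of ℤ_i on the cycle,
  -- ρ⁻ i : value of the faithful character of ℤ_{2i} on the cycle
  FaithfulChoice : ℕ → (ℕ → Carrier) → (ℕ → Carrier) → Set ℓ
  FaithfulChoice n ρ⁺ ρ⁻ = ∀ i → 1 ≤ i → i ≤ n → PrimRoot (ρ⁺ i) i × PrimRoot (ρ⁻ i) (2 *ℕ i)

  -- ω x is the linear character ω^x of Z_{B_n}(x):
  -- a homomorphism on Z(x), equal on each base factor G_{i,ε} to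
  -- (trivial on ℤ₂) × (faithful ρ⁺ i) resp. faithful ρ⁻ i, and trivial on
  -- the complements S_a.
  record OmegaFamily (n : ℕ) (ρ⁺ ρ⁻ : ℕ → Carrier) (ω : SP n → SP n → Carrier) : Set (c ⊔ ℓ) where
    field
      mult : ∀ x → IsB x → ∀ z z′ → InCent x z → InCent x z′ →
               ω x (compose z z′) ≈ ω x z * ω x z′
      onCycle : ∀ x → IsB x → ∀ p →
               ω x (restrictCyc x p) ≈ (if isNegCls x p then ρ⁻ (cycLen x p) else ρ⁺ (cycLen x p))
      onSign : ∀ x → IsB x → ∀ p → T (not (isNegCls x p)) → ω x (negCyc x p) ≈ 1#
      onComplement : ∀ x → IsB x → ∀ z → SwapInv x z → ω x z ≈ 1#

  -- ψ^x(y) = Ind_{Z(x)}^{B_n} ω^x (y)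
  --        = (1/|Z(x)|) Σ_{g ∈ B_n, g⁻¹yg ∈ Z(x)} ω^x(g⁻¹ y g)
  ψ : ∀ {n} → (SP n → SP n → Carrier) → SP n → SP n → Carrier
  ψ {n} ω x y =
    recip (length (boolFilter (inCentb x) (Bl n))) *
    Σl (Bl n) (λ g → let z = compose (compose (inv g) y) g in
                      if inCentb x z then ω x z else 0#)

  rootsD : (n : ℕ) → ℤ → SP n → ℕ
  rootsD n k y = length (boolFilter (λ h → eqSP (powZ h k) y) (Dl n))

module Submission where

-- Conjugating, Σ_{C^k = {ε}} ψ^C(y) becomes the sum of ω^x(y) over the x commuting with y such
-- that x^k = ε, and 2 roots_k^{D_n}(y) [y ∈ D_n] is the sum of 1 + δ(h) over the h ∈ B_n with
-- h^k = y, where δ is the sign character with kernel D_n.  The case ε = 1 accounts for the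
-- summand 1 and the case ε = w₀ for δ(h).
--
-- Both sums are multiplicative over the orbits ("blocks") of ⟨x, y, -1⟩, so x may be traded for
-- h one block at a time, averaging x over its products with the elements ± y^a of one y-cycle of
-- the block.  On that block x^m = ± y^j for the least possible m, and ω^x(y) turns out to be a
-- root of unity of the same order as θ^j, where θ is the value of the faithful character on the
-- y-cycle.  The two need not be equal, since the faithful characters for different cycle lengths
-- are chosen independently; but j ↦ u j permutes the values ω^x(y) like a Galois action, so their
-- sums over j are the same by the theory of Ramanujan sums.  What remains is Fourier inversion
-- on the cyclic group generated by y.

open import Defs
open import Level using (Level)
open import Data.Nat using (ℕ; zero; suc; _≤_; _<_; z≤n; s≤s; _∸_; ⌊_/2⌋; NonZero; _!) renaming (_+_ to _+ℕ_; _*_ to _*ℕ_)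
import Data.Nat as ℕ
import Data.Nat.Properties as ℕP
import Data.Nat.DivMod as ℕD
open import Data.Nat.Divisibility using (_∣_; divides; _∣?_)
import Data.Nat.Divisibility as ℕ∣
open import Data.Nat.GCD using (gcd)
import Data.Nat.GCD as GCD
import Data.Nat.Coprimality as Cop
open import Data.Integer using (ℤ; +_; -[1+_])
open import Data.Bool using (Bool; true; false; not; _∧_; _∨_; _xor_; if_then_else_; T)
import Data.Bool.Properties as BP
open import Data.Fin using (Fin; toℕ; punchOut) renaming (_≟_ to _≟ᶠ_)
import Data.Fin as F
import Data.Fin.Properties as FP
open import Data.Maybe using (just; nothing)
open import Data.Product using (∃; ∃₂; _×_; _,_; proj₁; proj₂)
import Data.Product.Properties as PP
open import Data.Sum using (_⊎_; inj₁; inj₂)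
open import Data.Empty using (⊥; ⊥-elim)
open import Data.Unit using (tt)
open import Data.List using (List; []; _∷_; foldr; length; upTo; applyUpTo; allFin; concatMap; _++_)
import Data.List as L
import Data.List.Properties as LP
open import Data.Bool.ListAction using (any; all; or)
open import Data.List.Relation.Unary.Any using (here; there)
import Data.List.Relation.Unary.Any.Properties as AnyP
open import Data.List.Relation.Unary.All using ([]; _∷_)
import Data.List.Relation.Unary.All as All
import Data.List.Relation.Unary.All.Properties as AllP
open import Data.List.Relation.Unary.AllPairs using ([]; _∷_)
open import Data.List.Relation.Unary.Unique.Propositional using (Unique)
import Data.List.Relation.Unary.Unique.Propositional.Properties as UP
open import Data.List.Membership.Propositional using (_∈_; find; lose)
import Data.List.Membership.Propositional.Properties as ∈P
open import Data.Vec using (Vec; []; _∷_; lookup; tabulate; toList)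
import Data.Vec.Properties as VP
open import Function using (_∘_; id; case_of_; _$_)
open import Function.Bundles using (Equivalence; mk⇔)
open import Relation.Nullary using (¬_; Dec; yes; no)
open import Relation.Nullary.Decidable using (⌊_⌋; toWitness; fromWitness)
open import Relation.Binary.Definitions using (tri<; tri≈; tri>; DecidableEquality)
open import Relation.Binary.PropositionalEquality using (_≡_; _≢_; refl; sym; trans; cong; cong₂; subst; subst₂; module ≡-Reasoning)
open import Data.List.Relation.Binary.BagAndSetEquality using (∼bag⇒↭)
open import Data.List.Membership.Propositional.Properties.WithK using (unique∧set⇒bag)
open import Data.List.Relation.Binary.Permutation.Propositional using (_↭_; prep; swap)
import Data.List.Relation.Binary.Permutation.Propositional as ↭
import Data.List.Relation.Binary.Permutation.Propositional.Properties as ↭P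

-- The exchange passes through hybrid stages: x^k = y is prescribed on the processed blocks and x^k
-- = ε on the others, and x is weighted by ω^x of the unprocessed part of y times the sign of the
-- processed part of x. Consecutive stages differ on one block, yet they do not agree term by term,
-- only after summation over the twists of x. Twisting changes neither the blocks nor the exponent m
-- and realizes every return x^m = ± y^j, so with k = k'm both prescriptions become congruences for
-- j. Inversion against θ^(-j) turns y^(k'j) = ± 1 into k'l = 1, which is the condition x^k = y;
-- what remains is a comparison of signs. Two obstacles shape the rest. First, ω^x is given for each
-- x separately and by its values on generators only. That it is carried along by conjugation, and
-- that it ignores x off the support of its argument, is proved by factoring the argument into
-- swaps, cycle powers and negations. Second, the field has no Galois automorphisms at hand;
-- instead, the sum of ζ^u over the units u modulo L is shown to depend on the order of ζ alone.

T⇒≡ : ∀ {b} → T b → b ≡ true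
T⇒≡ = Equivalence.to BP.T-≡

≡⇒T : ∀ {b} → b ≡ true → T b
≡⇒T = Equivalence.from BP.T-≡

T-ext : ∀ {a b} → (T a → T b) → (T b → T a) → a ≡ b
T-ext {true}  {true}  f g = refl
T-ext {true}  {false} f g = ⊥-elim (f tt)
T-ext {false} {true}  f g = ⊥-elim (g tt)
T-ext {false} {false} f g = refl

¬T⇒≡ : ∀ {b} → ¬ T b → b ≡ false
¬T⇒≡ {true}  h = ⊥-elim (h tt)
¬T⇒≡ {false} h = refl

∧-intro : ∀ {a b} → T a → T b → T (a ∧ b)
∧-intro p q = Equivalence.from BP.T-∧ (p , q)

∧-elim : ∀ {a b} → T (a ∧ b) → T a × T b
∧-elim = Equivalence.to BP.T-∧

xor-cancel : ∀ a b → (a xor b) xor b ≡ a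
xor-cancel a b = trans (BP.xor-assoc a b b) (trans (cong (a xor_) (BP.xor-same b)) (BP.xor-identityʳ a))

xor-cancelˡ : ∀ a b → a xor (a xor b) ≡ b
xor-cancelˡ a b = trans (sym (BP.xor-assoc a a b)) (cong (_xor b) (BP.xor-same a))

-- Signed points and the action of signed permutations

flip : ∀ {n} → Bool → Pt n → Pt n
flip s (i , b) = (i , s xor b)

flip-flip : ∀ {n} s (p : Pt n) → flip s (flip s p) ≡ p
flip-flip s (i , b) = cong (i ,_) (xor-cancelˡ s b)

flip-xor : ∀ {n} s s' (p : Pt n) → flip s (flip s' p) ≡ flip (s xor s') p
flip-xor s s' (i , b) = cong (i ,_) (sym (BP.xor-assoc s s' b))

flip-inj : ∀ {n} s {p q : Pt n} → flip s p ≡ flip s q → p ≡ q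
flip-inj s {p} {q} e = trans (sym (flip-flip s p)) (trans (cong (flip s) e) (flip-flip s q))

flip-comm : ∀ {n} s s' (p : Pt n) → flip s (flip s' p) ≡ flip s' (flip s p)
flip-comm s s' p = trans (flip-xor s s' p) (trans (cong (λ t → flip t p) (BP.xor-comm s s')) (sym (flip-xor s' s p)))

flip≢ : ∀ {n} {p : Pt n} → neg p ≢ p
flip≢ {p = i , true}  ()
flip≢ {p = i , false} ()

app-flip : ∀ {n} (w : SP n) s p → app w (flip s p) ≡ flip s (app w p)
app-flip w s (i , b) = cong (proj₁ (lookup w i) ,_) (BP.xor-assoc s b _)

app-neg : ∀ {n} (w : SP n) p → app w (neg p) ≡ neg (app w p)
app-neg w p = app-flip w true p

_≟ₚ_ : ∀ {n} → DecidableEquality (Pt n)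
_≟ₚ_ = PP.≡-dec _≟ᶠ_ BP._≟_

eqPt⇒≡ : ∀ {n} {p q : Pt n} → T (eqPt p q) → p ≡ q
eqPt⇒≡ {p = p} {q} = toWitness {a? = p ≟ₚ q}

≡⇒eqPt : ∀ {n} {p q : Pt n} → p ≡ q → T (eqPt p q)
≡⇒eqPt {p = p} {q} = fromWitness {a? = p ≟ₚ q}

eqPt-⇔ : ∀ {n} (p q p' q' : Pt n) → (p ≡ q → p' ≡ q') → (p' ≡ q' → p ≡ q) → eqPt p q ≡ eqPt p' q'
eqPt-⇔ p q p' q' f g = T-ext (λ t → ≡⇒eqPt (f (eqPt⇒≡ {p = p} {q} t))) (λ t → ≡⇒eqPt (g (eqPt⇒≡ {p = p'} {q'} t)))

eqSP⇒≡ : ∀ {n} {v w : SP n} → T (eqSP v w) → v ≡ w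
eqSP⇒≡ {v = v} {w} = toWitness {a? = VP.≡-dec _≟ₚ_ v w}

≡⇒eqSP : ∀ {n} {v w : SP n} → v ≡ w → T (eqSP v w)
≡⇒eqSP {v = v} {w} = fromWitness {a? = VP.≡-dec _≟ₚ_ v w}

app-compose : ∀ {n} (w v : SP n) p → app (compose w v) p ≡ app w (app v p)
app-compose w v (i , s) rewrite VP.lookup-map i (app w) v =
  sym (app-flip w s (lookup v i))

app-id : ∀ {n} (p : Pt n) → app (idB n) p ≡ p
app-id (i , s) rewrite VP.lookup∘tabulate (λ i → (i , false)) i = cong (i ,_) (BP.xor-identityʳ s)

app-w0 : ∀ {n} (p : Pt n) → app (w0 n) p ≡ neg p
app-w0 (i , s) rewrite VP.lookup∘tabulate (λ i → (i , true)) i = cong (i ,_) (BP.xor-comm s true)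

app-ext : ∀ {n} {v w : SP n} → (∀ p → app v p ≡ app w p) → v ≡ w
app-ext {v = v} {w} h = trans (sym (VP.tabulate∘lookup v))
  (trans (VP.tabulate-cong (λ i → h (i , false))) (VP.tabulate∘lookup w))

app-iter-flip : ∀ {n} (x : SP n) a s p → iterApp x a (flip s p) ≡ flip s (iterApp x a p)
app-iter-flip x zero    s p = refl
app-iter-flip x (suc a) s p = trans (cong (app x) (app-iter-flip x a s p)) (app-flip x s _)

iter-+ : ∀ {n} (x : SP n) a b p → iterApp x (a +ℕ b) p ≡ iterApp x a (iterApp x b p)
iter-+ x zero    b p = refl
iter-+ x (suc a) b p = cong (app x) (iter-+ x a b p)

iter-comm : ∀ {n} (x : SP n) a b p → iterApp x a (iterApp x b p) ≡ iterApp x b (iterApp x a p)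
iter-comm x a b p = trans (sym (iter-+ x a b p)) (trans (cong (λ e → iterApp x e p) (ℕP.+-comm a b)) (iter-+ x b a p))

app-powN : ∀ {n} (x : SP n) a p → app (powN x a) p ≡ iterApp x a p
app-powN x zero    p = app-id p
app-powN x (suc a) p = trans (app-compose x (powN x a) p) (cong (app x) (app-powN x a p))

-- Bijectivity, inverses and elements given by functions

record Bij {n} (x : SP n) : Set where
  constructor bij
  field isB : IsB x
open Bij public

Inj : ∀ {n} → SP n → Set
Inj {n} x = ∀ {p q : Pt n} → app x p ≡ app x q → p ≡ q

-- A missed value could be punched out, which would leave an injection of `Fin (suc m)` into
-- `Fin m`.
injective⇒surjective : ∀ {n} (f : Fin n → Fin n) → (∀ {i j} → f i ≡ f j → i ≡ j) → ∀ j → ∃ λ i → f i ≡ j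
injective⇒surjective {suc m} f inj j with FP.any? (λ i → f i ≟ᶠ j)
... | yes r = r
... | no ¬r = ⊥-elim (ℕP.1+n≰n (FP.injective⇒≤ {f = λ i → punchOut {i = j} {j = f i} (λ e → ¬r (i , sym e))}
                (λ e → inj (FP.punchOut-injective {i = j} _ _ e))))

-- A section of `f` is injective, hence onto by the previous lemma, and so a two-sided inverse.
surjective⇒injective : ∀ {n} (f : Fin n → Fin n) → (∀ j → ∃ λ i → f i ≡ j) → ∀ {i j} → f i ≡ f j → i ≡ j
surjective⇒injective f sur {i} {j} e =
  trans (sym (proj₂ (onto i))) (trans (cong g (trans (sym (fg i)) (trans e (fg j)))) (proj₂ (onto j)))
  where
  g : Fin _ → Fin _
  g k = proj₁ (sur k)
  onto : ∀ i → ∃ λ k → g k ≡ i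
  onto = injective⇒surjective g (λ {a} {b} e → trans (sym (proj₂ (sur a))) (trans (cong f e) (proj₂ (sur b))))
  fg : ∀ i → f i ≡ proj₁ (onto i)
  fg i = trans (cong f (sym (proj₂ (onto i)))) (proj₂ (sur (proj₁ (onto i))))

any-intro : ∀ {A : Set} (f : A → Bool) {xs x} → x ∈ xs → T (f x) → T (any f xs)
any-intro f x∈ fx = AnyP.any⁺ f (lose x∈ fx)

any-elim : ∀ {A : Set} (f : A → Bool) xs → T (any f xs) → ∃ λ x → x ∈ xs × T (f x)
any-elim f xs h = find (AnyP.any⁻ f xs h)

all-intro : ∀ {A : Set} (f : A → Bool) xs → (∀ x → x ∈ xs → T (f x)) → T (all f xs)
all-intro f xs h = AllP.all⁻ f (All.tabulate (λ {x} → h x))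

all-elim : ∀ {A : Set} (f : A → Bool) xs → T (all f xs) → ∀ {x} → x ∈ xs → T (f x)
all-elim f xs h = All.lookup (AllP.all⁺ f xs h)

module _ {n : ℕ} where

  index : SP n → Fin n → Fin n
  index x i = proj₁ (lookup x i)

  Bij⇒onto : (x : SP n) → Bij x → ∀ j → ∃ λ i → index x i ≡ j
  Bij⇒onto x B j with any-elim _ (allFin n) (all-elim _ (allFin n) (isB B) (∈P.∈-allFin j))
  ... | i , _ , h = i , toWitness h

  onto⇒Bij : (x : SP n) → (∀ j → ∃ λ i → index x i ≡ j) → Bij x
  onto⇒Bij x o = bij (all-intro _ (allFin n) (λ j _ → any-intro _ (∈P.∈-allFin (proj₁ (o j))) (fromWitness (proj₂ (o j)))))

  Bij⇒Inj : {x : SP n} → Bij x → Inj x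
  Bij⇒Inj {x} B {i , s} {j , s'} e =
    go (surjective⇒injective (index x) (Bij⇒onto x B) {i} {j} (cong proj₁ e)) (cong proj₂ e)
    where
    go : ∀ {j} → i ≡ j → s xor proj₂ (lookup x i) ≡ s' xor proj₂ (lookup x j) → (i , s) ≡ (j , s')
    go refl e' = cong (i ,_) (trans (sym (xor-cancel s t)) (trans (cong (_xor t) e') (xor-cancel s' t)))
      where
      t : Bool
      t = proj₂ (lookup x i)

  Inj⇒Bij : {x : SP n} → Inj x → Bij x
  Inj⇒Bij {x} inj = onto⇒Bij x (injective⇒surjective (index x) λ {i} {j} e →
    -- The sign of the second point is chosen so that equal indices of the images become equal
    -- signed points.
    cong proj₁ (inj {i , false} {j , proj₂ (lookup x i) xor proj₂ (lookup x j)}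
      (cong₂ _,_ e (sym (xor-cancel (proj₂ (lookup x i)) _)))))

  Bij-compose : {x z : SP n} → Bij x → Bij z → Bij (compose x z)
  Bij-compose {x} {z} Bx Bz = Inj⇒Bij {compose x z} λ {p} {q} e →
    Bij⇒Inj Bz (Bij⇒Inj Bx (trans (sym (app-compose x z p)) (trans e (app-compose x z q))))

  Bij-id : Bij (idB n)
  Bij-id = Inj⇒Bij {idB n} λ {p} {q} e → trans (sym (app-id p)) (trans e (app-id q))

  Bij-powN : {x : SP n} → Bij x → ∀ a → Bij (powN x a)
  Bij-powN B zero    = Bij-id
  Bij-powN {x} B (suc a) = Bij-compose {x} {powN x a} B (Bij-powN B a)

  iter-inj : {x : SP n} → Bij x → ∀ a {p q} → iterApp x a p ≡ iterApp x a q → p ≡ q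
  iter-inj B zero    e = e
  iter-inj {x} B (suc a) e = iter-inj B a (Bij⇒Inj B e)

search-sound : ∀ {n} (f : Fin n → Bool) {i} → searchFin f ≡ just i → T (f i)
search-sound {suc n} f e with f F.zero in eq
search-sound {suc n} f refl | true = ≡⇒T eq
... | false with searchFin (λ i → f (F.suc i)) in eq'
search-sound {suc n} f refl | false | just j = search-sound (λ i → f (F.suc i)) eq'

search-complete : ∀ {n} (f : Fin n → Bool) i → T (f i) → searchFin f ≢ nothing
search-complete {suc n} f i Ti e with f F.zero in eq
search-complete {suc n} f i Ti () | true
search-complete {suc n} f F.zero Ti e | false = subst T eq Ti
search-complete {suc n} f (F.suc i) Ti e | false with searchFin (λ i → f (F.suc i)) in eq'
search-complete {suc n} f (F.suc i) Ti () | false | just j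
... | nothing = search-complete (λ i → f (F.suc i)) i Ti eq'

module _ {n : ℕ} where

  private
    -- The right-hand side is a local function of `inv` without a name; stated this way, its search
    -- can be abstracted in `lookup-inv`.
    inv-entry : (w : SP n) (j : Fin n) → lookup (inv w) j ≡ _
    inv-entry w j = VP.lookup∘tabulate _ j

  lookup-inv : (w : SP n) → Bij w → ∀ j → ∃ λ i → lookup (inv w) j ≡ (i , proj₂ (lookup w i)) × index w i ≡ j
  lookup-inv w B j with searchFin (λ i → ⌊ proj₁ (lookup w i) ≟ᶠ j ⌋) in eq | inv-entry w j
  ... | just i  | e = i , e , toWitness (search-sound (λ i → ⌊ proj₁ (lookup w i) ≟ᶠ j ⌋) eq)
  ... | nothing | e = let (i , ei) = Bij⇒onto w B j in
    ⊥-elim (search-complete (λ i → ⌊ proj₁ (lookup w i) ≟ᶠ j ⌋) i (fromWitness ei) eq)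

  app-invʳ : (w : SP n) → Bij w → ∀ q → app w (app (inv w) q) ≡ q
  app-invʳ w B (j , s) with lookup-inv w B j
  ... | i , e , refl rewrite e = cong (_ ,_) (xor-cancel s _)

  app-invˡ : (w : SP n) → Bij w → ∀ q → app (inv w) (app w q) ≡ q
  app-invˡ w B q = Bij⇒Inj B (app-invʳ w B (app w q))

  Bij-inv : (w : SP n) → Bij w → Bij (inv w)
  Bij-inv w B = Inj⇒Bij {x = inv w} λ {p} {q} e → trans (sym (app-invʳ w B p)) (trans (cong (app w) e) (app-invʳ w B q))

  mk : (Pt n → Pt n) → SP n
  mk f = tabulate (λ i → f (i , false))

  Equivariant : (Pt n → Pt n) → Set
  Equivariant f = ∀ p → f (neg p) ≡ neg (f p)

  app-mk : ∀ {f} → Equivariant f → ∀ p → app (mk f) p ≡ f p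
  app-mk {f} eqv (i , false) rewrite VP.lookup∘tabulate (λ i → f (i , false)) i = refl
  app-mk {f} eqv (i , true)  rewrite VP.lookup∘tabulate (λ i → f (i , false)) i = sym (eqv (i , false))

  mk-Bij : ∀ {f} → Equivariant f → (∀ {p q} → f p ≡ f q → p ≡ q) → Bij (mk f)
  mk-Bij {f} eqv inj = Inj⇒Bij {x = mk f} λ {p} {q} e → inj (trans (sym (app-mk eqv p)) (trans e (app-mk eqv q)))

  -- A record, as `Bij` is, so that the elements concerned can be inferred from a proof.
  record Comm (x z : SP n) : Set where
    constructor mkComm
    field comm : ∀ p → app x (app z p) ≡ app z (app x p)
  open Comm public

  InCent⇒ : ∀ {x z} → InCent x z → Bij z × Comm x z
  InCent⇒ {x} {z} h with ∧-elim {isBb z} h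
  ... | B , e = bij B , mkComm λ p → trans (sym (app-compose x z p))
                      (trans (cong (λ w → app w p) (sym (eqSP⇒≡ e))) (app-compose z x p))

  ⇒InCent : ∀ {x z} → Bij z → Comm x z → InCent x z
  ⇒InCent {x} {z} B c = ∧-intro (isB B) (≡⇒eqSP (app-ext λ p →
    trans (app-compose z x p) (trans (sym (comm c p)) (sym (app-compose x z p)))))

  iter-Comm : ∀ {x z} → Comm x z → ∀ a b p → iterApp x a (iterApp z b p) ≡ iterApp z b (iterApp x a p)
  iter-Comm {x} {z} c zero    b p = refl
  iter-Comm {x} {z} c (suc a) b p = trans (cong (app x) (iter-Comm c a b p)) (one b _)
    where
    one : ∀ b p → app x (iterApp z b p) ≡ iterApp z b (app x p)
    one zero    p = refl
    one (suc b) p = trans (comm c (iterApp z b p)) (cong (app z) (one b p))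

  patch : (Pt n → Bool) → (Pt n → Pt n) → Pt n → Pt n
  patch Q f p = if Q p then f p else p

  patch-in : ∀ {Q f p} → T (Q p) → patch Q f p ≡ f p
  patch-in {Q} {f} {p} t with Q p
  ... | true = refl

  patch-out : ∀ {Q f p} → ¬ T (Q p) → patch Q f p ≡ p
  patch-out {Q} {f} {p} t with Q p
  ... | true  = ⊥-elim (t tt)
  ... | false = refl

  patch-equivariant : ∀ {Q f} → (∀ p → Q (neg p) ≡ Q p) → Equivariant f → Equivariant (patch Q f)
  patch-equivariant {Q} {f} Qn fe p rewrite Qn p with Q p
  ... | true  = fe p
  ... | false = refl

  patch-injective : ∀ {Q f} → (∀ p → T (Q p) → T (Q (f p))) → (∀ {p q} → f p ≡ f q → p ≡ q) →
                    ∀ {p q} → patch Q f p ≡ patch Q f q → p ≡ q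
  patch-injective {Q} {f} cl inj {p} {q} e with Q p in ep | Q q in eq
  ... | true  | true  = inj e
  ... | false | false = e
  -- One point in the region and one off it cannot have the same image, since `f` does not leave the
  -- region.
  ... | true  | false = case trans (sym (T⇒≡ (cl p (≡⇒T ep)))) (trans (cong Q e) eq) of λ ()
  ... | false | true  = case trans (sym (T⇒≡ (cl q (≡⇒T eq)))) (trans (cong Q (sym e)) ep) of λ ()

-- Finite enumerations

module _ {A : Set} where

  ∈-boolFilter⁺ : ∀ (f : A → Bool) {xs x} → x ∈ xs → T (f x) → x ∈ boolFilter f xs
  ∈-boolFilter⁺ f {y ∷ xs} (here refl) t with f y
  ... | true = here refl
  ∈-boolFilter⁺ f {y ∷ xs} (there m) t with f y
  ... | true  = there (∈-boolFilter⁺ f m t)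
  ... | false = ∈-boolFilter⁺ f m t

  ∈-boolFilter⁻ : ∀ (f : A → Bool) xs {x} → x ∈ boolFilter f xs → x ∈ xs × T (f x)
  ∈-boolFilter⁻ f (y ∷ xs) m with f y in eq
  ∈-boolFilter⁻ f (y ∷ xs) (here refl) | true = here refl , ≡⇒T eq
  ∈-boolFilter⁻ f (y ∷ xs) (there m)   | true = let (a , b) = ∈-boolFilter⁻ f xs m in there a , b
  ... | false = let (a , b) = ∈-boolFilter⁻ f xs m in there a , b

  boolFilter-unique : ∀ (f : A → Bool) {xs} → Unique xs → Unique (boolFilter f xs)
  boolFilter-unique f [] = []
  boolFilter-unique f {x ∷ xs} (p ∷ u) with f x
  ... | true  = All.tabulate (λ m → All.lookup p (proj₁ (∈-boolFilter⁻ f xs m))) ∷ boolFilter-unique f u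
  ... | false = boolFilter-unique f u

  unique⇒↭ : {xs ys : List A} → Unique xs → Unique ys → (∀ {x} → x ∈ xs → x ∈ ys) → (∀ {x} → x ∈ ys → x ∈ xs) → xs ↭ ys
  unique⇒↭ u v f g = ∼bag⇒↭ (unique∧set⇒bag u v (mk⇔ f g))

  allVec≡product : ∀ (xs : List A) m → allVec xs (suc m) ≡ L.cartesianProductWith _∷_ xs (allVec xs m)
  allVec≡product xs m = go xs
    where
    go : ∀ ys → concatMap (λ a → L.map (a ∷_) (allVec xs m)) ys ≡ L.cartesianProductWith _∷_ ys (allVec xs m)
    go []       = refl
    go (y ∷ ys) = cong (L.map (y ∷_) (allVec xs m) ++_) (go ys)

  allVec-unique : ∀ {xs : List A} m → Unique xs → Unique (allVec xs m)
  allVec-unique zero    u = [] ∷ []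
  allVec-unique {xs} (suc m) u = subst Unique (sym (allVec≡product xs m))
    (UP.cartesianProductWith⁺ _∷_ (λ { refl → refl , refl }) u (allVec-unique m u))

  ∈-allVec : ∀ {xs : List A} → (∀ a → a ∈ xs) → ∀ {m} (v : Vec A m) → v ∈ allVec xs m
  ∈-allVec h [] = here refl
  ∈-allVec {xs} h (a ∷ v) = subst (_ ∈_) (sym (allVec≡product xs _)) (∈P.∈-cartesianProductWith⁺ _∷_ (h a) (∈-allVec h v))

map-unique : ∀ {A B : Set} (h : A → B) {xs} → Unique xs → (∀ {x y} → x ∈ xs → y ∈ xs → h x ≡ h y → x ≡ y) → Unique (L.map h xs)
map-unique h [] inj = []
map-unique h {x ∷ xs} (p ∷ u) inj =
  AllP.map⁺ (All.tabulate λ m e → All.lookup p m (inj (here refl) (there m) e))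
  ∷ map-unique h u (λ m m' → inj (there m) (there m'))

allPt-unique : ∀ n → Unique (allPt n)
allPt-unique n = UP.cartesianProduct⁺ (UP.allFin⁺ n) (((λ ()) ∷ []) ∷ [] ∷ [])

∈-allPt : ∀ {n} (p : Pt n) → p ∈ allPt n
∈-allPt (i , false) = ∈P.∈-cartesianProduct⁺ (∈P.∈-allFin i) (here refl)
∈-allPt (i , true)  = ∈P.∈-cartesianProduct⁺ (∈P.∈-allFin i) (there (here refl))

Bl-unique : ∀ n → Unique (Bl n)
Bl-unique n = boolFilter-unique isBb (allVec-unique n (allPt-unique n))

∈-Bl : ∀ {n} {x : SP n} → Bij x → x ∈ Bl n
∈-Bl {x = x} B = ∈-boolFilter⁺ isBb (∈-allVec ∈-allPt x) (isB B)

Bl⇒Bij : ∀ {n} {x : SP n} → x ∈ Bl n → Bij x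
Bl⇒Bij {n} m = bij $ proj₂ (∈-boolFilter⁻ isBb (allVec (allPt n) n) m)

-- Least exponents and periods

least : ∀ {P : ℕ → Set} → (∀ a → Dec (P a)) → ∀ a → P a → ∃ λ d → P d × (∀ e → e < d → ¬ P e)
least P? zero pa = 0 , pa , λ _ ()
least {P} P? (suc a) pa with P? 0
... | yes p0 = 0 , p0 , λ _ ()
... | no ¬p0 with least {P ∘ suc} (P? ∘ suc) a pa
...   | d , pd , m = suc d , pd , λ { zero _ → ¬p0 ; (suc e) (s≤s l) → m e l }

IsLeast : (ℕ → Set) → ℕ → Set
IsLeast P d = 1 ≤ d × P d × (∀ e → 1 ≤ e → e < d → ¬ P e)

leastPositive : ∀ {P : ℕ → Set} → (∀ a → Dec (P a)) → ∀ a → 1 ≤ a → P a → ∃ (IsLeast P)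
leastPositive {P} P? (suc a) _ pa with least {P ∘ suc} (P? ∘ suc) a pa
... | d , pd , m = suc d , s≤s z≤n , pd , λ { (suc e) _ (s≤s l) → m e l }

-- Subtracting d as often as possible leaves the remainder modulo d, which satisfies P and lies
-- below the least positive solution, so it is zero.
least-divides : ∀ {P : ℕ → Set} {d} → IsLeast P d → (∀ a → P (d +ℕ a) → P a) → ∀ a → P a → d ∣ a
least-divides {P} {suc d} (_ , _ , mn) sub a pa = rem (a ℕD.% suc d) (ℕD.m%n<n a (suc d)) refl
    (down (a ℕD./ suc d) (subst P (trans (ℕD.m≡m%n+[m/n]*n a (suc d)) (ℕP.+-comm (a ℕD.% suc d) _)) pa))
  where
  down : ∀ q {r} → P (q *ℕ suc d +ℕ r) → P r
  down zero    h = h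
  down (suc q) {r} h = down q (sub _ (subst P (ℕP.+-assoc (suc d) (q *ℕ suc d) r) h))
  rem : ∀ r → r < suc d → a ℕD.% suc d ≡ r → P r → suc d ∣ a
  rem zero    _ e _ = ℕ∣.m%n≡0⇒n∣m a (suc d) e
  rem (suc r) l e p = ⊥-elim (mn (suc r) (s≤s z≤n) l p)

-- a common period of all elements of B_n; the factor 2 makes it even
opaque
  M : ℕ → ℕ
  M n = 2 *ℕ (2 *ℕ n) !

  M≥1 : ∀ n → 1 ≤ M n
  M≥1 n = ℕP.*-mono-≤ {1} {2} (s≤s z≤n) (ℕP.1≤n! (2 *ℕ n))

  M-even : ∀ n → ∃ λ h → M n ≡ h +ℕ h
  M-even n = (2 *ℕ n) ! , cong ((2 *ℕ n) ! +ℕ_) (ℕP.+-identityʳ ((2 *ℕ n) !))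

  ∣M : ∀ n L → 1 ≤ L → L ≤ 2 *ℕ n → L ∣ M n
  ∣M n (suc L) _ le = ℕ∣.∣n⇒∣m*n 2 (ℕ∣.∣-trans (ℕ∣.m∣m*n (L !)) (ℕ∣.m≤n⇒m!∣n! le))

M-nonZero : ∀ n → NonZero (M n)
M-nonZero n = ℕ.>-nonZero (M≥1 n)

module _ {n : ℕ} where

  private
    code : Pt n → Fin (n *ℕ 2)
    code (i , b) = F.combine i (if b then F.suc F.zero else F.zero)

    code-inj : ∀ p q → code p ≡ code q → p ≡ q
    code-inj (i , b) (j , b') e with FP.combine-injective i _ j _ e
    code-inj (i , true)  (.i , true)  e | refl , _ = refl
    code-inj (i , false) (.i , false) e | refl , _ = refl

  iter-multiple : ∀ (x : SP n) {L p} → iterApp x L p ≡ p → ∀ {a} → L ∣ a → iterApp x a p ≡ p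
  iter-multiple x {L} {p} e (divides q refl) = go q
    where
    go : ∀ q → iterApp x (q *ℕ L) p ≡ p
    go zero    = refl
    go (suc q) = trans (iter-+ x L (q *ℕ L) p) (trans (cong (iterApp x L) (go q)) e)

  IsPeriod : SP n → Pt n → ℕ → Set
  IsPeriod x p = IsLeast (λ a → iterApp x a p ≡ p)

  -- Two of the first 2n + 1 iterates coincide by pigeonhole, and the smaller exponent cancels. The
  -- bound 2n is what `∣M` and the search range of `inOrb` ask for.
  period : {x : SP n} → Bij x → ∀ p → ∃ λ L → IsPeriod x p L × L ≤ 2 *ℕ n
  period {x} B p with FP.pigeonhole (ℕP.n<1+n (n *ℕ 2)) (λ i → code (iterApp x (toℕ i) p))
  ... | i , j , i<j , e = L , isL , ℕP.≤-trans L≤ (ℕP.≤-trans (ℕP.m∸n≤m (toℕ j) (toℕ i))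
                           (subst (toℕ j ≤_) (ℕP.*-comm n 2) (ℕP.≤-pred (FP.toℕ<n j))))
    where
    k : ℕ
    k = toℕ j ∸ toℕ i
    back : iterApp x k p ≡ p
    back = iter-inj B (toℕ i) (trans (sym (iter-+ x (toℕ i) k p))
      (trans (cong (λ a → iterApp x a p) (ℕP.m+[n∸m]≡n (ℕP.<⇒≤ i<j))) (sym (code-inj _ _ e))))
    found : ∃ (IsPeriod x p)
    found = leastPositive (λ a → iterApp x a p ≟ₚ p) k (ℕP.m<n⇒0<n∸m i<j) back
    L : ℕ
    L = proj₁ found
    isL : IsPeriod x p L
    isL = proj₂ found
    L≤ : L ≤ k
    L≤ = ℕP.≮⇒≥ (λ k<L → proj₂ (proj₂ isL) k (ℕP.m<n⇒0<n∸m i<j) k<L back)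

  period-divides : {x : SP n} → Bij x → ∀ {p L} → IsPeriod x p L → ∀ a → iterApp x a p ≡ p → L ∣ a
  period-divides {x} B {p} {L} isL = least-divides isL
    (λ a e → iter-inj B L (trans (sym (iter-+ x L a p)) (trans e (sym (proj₁ (proj₂ isL))))))

  iter-M : {x : SP n} → Bij x → ∀ p → iterApp x (M n) p ≡ p
  iter-M {x} B p with period B p
  ... | L , isL , L≤ = iter-multiple x {L} (proj₁ (proj₂ isL)) (∣M n L (proj₁ isL) L≤)

  -- The exponent `a *ℕ (M n ∸ 1)` plays the part of -a; all inverses of powers are written in this
  -- way.
  iter-back : {x : SP n} → Bij x → ∀ a p → iterApp x (a *ℕ (M n ∸ 1)) (iterApp x a p) ≡ p
  iter-back {x} B a p = trans (sym (iter-+ x (a *ℕ (M n ∸ 1)) a p))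
    (iter-multiple x (iter-M B p) (divides a eq))
    where
    eq : a *ℕ (M n ∸ 1) +ℕ a ≡ a *ℕ M n
    eq = trans (ℕP.+-comm (a *ℕ (M n ∸ 1)) a) (trans (sym (ℕP.*-suc a (M n ∸ 1))) (cong (a *ℕ_) (ℕP.m+[n∸m]≡n (M≥1 n))))

  iter-% : {x : SP n} → ∀ {p} L .{{_ : NonZero L}} → iterApp x L p ≡ p → ∀ a → iterApp x (a ℕD.% L) p ≡ iterApp x a p
  iter-% {x} {p} L e a = sym (trans (cong (λ t → iterApp x t p) (ℕD.m≡m%n+[m/n]*n a L))
    (trans (iter-+ x (a ℕD.% L) _ p) (cong (iterApp x (a ℕD.% L)) (iter-multiple x {L} e (divides (a ℕD./ L) refl)))))

  -- `inOrb` tries exponents below 2n only; reduction modulo the period brings every exponent into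
  -- that range.
  inOrb⁺ : {x : SP n} → Bij x → ∀ a {p q} → iterApp x a p ≡ q → T (inOrb x p q)
  inOrb⁺ {x} B a {p} e with period B p
  ... | suc L , isL , L≤ = any-intro _ (∈P.∈-upTo⁺ (ℕP.<-≤-trans (ℕD.m%n<n a (suc L)) L≤))
      (≡⇒eqPt (trans (iter-% {x} (suc L) (proj₁ (proj₂ isL)) a) e))

  inOrb⁻ : (x : SP n) → ∀ {p q} → T (inOrb x p q) → ∃ λ a → iterApp x a p ≡ q
  inOrb⁻ x h with any-elim _ (upTo (2 *ℕ n)) h
  ... | a , _ , e = a , eqPt⇒≡ e

  inCyc⁺ : {x : SP n} → Bij x → ∀ a s {p q} → iterApp x a p ≡ flip s q → T (inCyc x p q)
  inCyc⁺ {x} B a false {p} {i , b} e = Equivalence.from BP.T-∨ (inj₁ (inOrb⁺ B a e))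
  inCyc⁺ B a true  e = Equivalence.from BP.T-∨ (inj₂ (inOrb⁺ B a e))

  inCyc⁻ : (x : SP n) → ∀ {p q} → T (inCyc x p q) → ∃₂ λ a s → iterApp x a p ≡ flip s q
  inCyc⁻ x h with Equivalence.to BP.T-∨ h
  ... | inj₁ h' = proj₁ (inOrb⁻ x h') , false , proj₂ (inOrb⁻ x h')
  ... | inj₂ h' = proj₁ (inOrb⁻ x h') , true , proj₂ (inOrb⁻ x h')

  orbit : SP n → Pt n → ℕ → List (Pt n)
  orbit x p = applyUpTo (λ a → iterApp x a p)

  iter-distinct : {x : SP n} → Bij x → ∀ {p L} → IsPeriod x p L → ∀ {i j} → i < j → j < L → iterApp x i p ≢ iterApp x j p
  iter-distinct {x} B {p} (_ , _ , mn) {i} {j} i<j j<L e =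
    mn (j ∸ i) (ℕP.m<n⇒0<n∸m i<j) (ℕP.≤-<-trans (ℕP.m∸n≤m j i) j<L)
      (iter-inj B i (trans (sym (iter-+ x i (j ∸ i) p)) (trans (cong (λ a → iterApp x a p) (ℕP.m+[n∸m]≡n (ℕP.<⇒≤ i<j))) (sym e))))

  orbLen-period : {x : SP n} → Bij x → ∀ {p L} → IsPeriod x p L → orbLen x p ≡ L
  orbLen-period {x} B {p} {suc L} isL = trans (↭P.↭-length (unique⇒↭
      (boolFilter-unique _ (allPt-unique n))
      (UP.applyUpTo⁺₁ (λ a → iterApp x a p) (suc L) (iter-distinct B isL))
      (λ m → to (inOrb⁻ x (proj₂ (∈-boolFilter⁻ _ (allPt n) m))))
      (λ m → from (∈P.∈-applyUpTo⁻ (λ a → iterApp x a p) m))))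
    (LP.length-applyUpTo (λ a → iterApp x a p) (suc L))
    where
    to : ∀ {q} → (∃ λ a → iterApp x a p ≡ q) → q ∈ orbit x p (suc L)
    to (a , refl) = subst (_∈ orbit x p (suc L)) (iter-% {x} (suc L) (proj₁ (proj₂ isL)) a) (∈P.∈-applyUpTo⁺ (λ a → iterApp x a p) (ℕD.m%n<n a (suc L)))
    from : ∀ {q} → (∃ λ a → a < suc L × q ≡ iterApp x a p) → q ∈ boolFilter (inOrb x p) (allPt n)
    from (a , _ , refl) = ∈-boolFilter⁺ _ (∈-allPt _) (inOrb⁺ B a refl)

  orbLen≥1 : {x : SP n} → Bij x → ∀ p → 1 ≤ orbLen x p
  orbLen≥1 B p with period B p
  ... | L , isL , _ = subst (1 ≤_) (sym (orbLen-period B isL)) (proj₁ isL)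

  iter-orbLen : {x : SP n} → Bij x → ∀ p → iterApp x (orbLen x p) p ≡ p
  iter-orbLen {x} B p with period B p
  ... | L , isL , _ = subst (λ a → iterApp x a p ≡ p) (sym (orbLen-period B isL)) (proj₁ (proj₂ isL))

  orbLen-divides : {x : SP n} → Bij x → ∀ {p} a → iterApp x a p ≡ p → orbLen x p ∣ a
  orbLen-divides {x} B {p} a e with period B p
  ... | L , isL , _ = subst (_∣ a) (sym (orbLen-period B isL)) (period-divides B isL a e)

  orbLen≤ : {x : SP n} → Bij x → ∀ p → orbLen x p ≤ 2 *ℕ n
  orbLen≤ B p with period B p
  ... | L , isL , le = subst (_≤ 2 *ℕ n) (sym (orbLen-period B isL)) le

-- Cycles, regions and elements supported on a region

module _ {n : ℕ} where

  Stable : SP n → (Pt n → Bool) → Set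
  Stable x Q = ∀ p → Q (app x p) ≡ Q p

  NegInvariant : (Pt n → Bool) → Set
  NegInvariant Q = ∀ p → Q (neg p) ≡ Q p

  flip-invariant : ∀ {Q} → NegInvariant Q → ∀ s p → Q (flip s p) ≡ Q p
  flip-invariant Qn true  p = Qn p
  flip-invariant Qn false p = refl

  stable-iter : ∀ {x Q} → Stable x Q → ∀ a p → Q (iterApp x a p) ≡ Q p
  stable-iter st zero    p = refl
  stable-iter {x} st (suc a) p = trans (st (iterApp x a p)) (stable-iter st a p)

  inCyc-refl : ∀ {x : SP n} → Bij x → ∀ p → T (inCyc x p p)
  inCyc-refl B p = inCyc⁺ B 0 false refl

  inCyc-sym : ∀ {x : SP n} → Bij x → ∀ {p q} → T (inCyc x p q) → T (inCyc x q p)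
  inCyc-sym {x} B {p} {q} h with inCyc⁻ x h
  ... | a , s , e = inCyc⁺ B (a *ℕ (M n ∸ 1)) s (flip-inj s
        (trans (sym (app-iter-flip x (a *ℕ (M n ∸ 1)) s q)) (trans (cong (iterApp x (a *ℕ (M n ∸ 1))) (sym e)) (trans (iter-back B a p) (sym (flip-flip s p))))))

  inCyc-trans : ∀ {x : SP n} → Bij x → ∀ {p q r} → T (inCyc x p q) → T (inCyc x q r) → T (inCyc x p r)
  inCyc-trans {x} B {p} {q} {r} h k with inCyc⁻ x h | inCyc⁻ x k
  ... | a , s , e | b , t , f = inCyc⁺ B (b +ℕ a) (s xor t)
    (trans (iter-+ x b a p) (trans (cong (iterApp x b) e) (trans (app-iter-flip x b s q) (trans (cong (flip s) f) (flip-xor s t r)))))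

  inCyc-iter : ∀ {x : SP n} → Bij x → ∀ a s p → T (inCyc x p (flip s (iterApp x a p)))
  inCyc-iter B a s p = inCyc⁺ B a s (sym (flip-flip s _))

  inCyc-≡ : ∀ {x : SP n} → Bij x → ∀ {c c'} → T (inCyc x c c') → ∀ p → inCyc x c p ≡ inCyc x c' p
  inCyc-≡ B h p = T-ext (inCyc-trans B (inCyc-sym B h)) (inCyc-trans B h)

  inCyc-neg : ∀ {x : SP n} → Bij x → ∀ c → NegInvariant (inCyc x c)
  inCyc-neg B c p = T-ext (λ h → inCyc-trans B h (inCyc⁺ B 0 true refl)) (λ h → inCyc-trans B h (inCyc⁺ B 0 true (sym (flip-flip true p))))

  inCyc-stable : ∀ {x : SP n} → Bij x → ∀ c → Stable x (inCyc x c)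
  inCyc-stable {x} B c p = T-ext (λ h → inCyc-trans B h (inCyc-sym B st)) (λ h → inCyc-trans B h st)
    where
    st : T (inCyc x p (app x p))
    st = inCyc⁺ B 1 false refl

  -- Intertwining is required along the orbit of `p` only, so that this covers both conjugate
  -- elements and elements that merely agree on a region.
  module _ {x x' g : SP n} (Bx : Bij x) (Bx' : Bij x') (Bg : Bij g) {p : Pt n}
           (tr : ∀ a → iterApp x' a (app g p) ≡ app g (iterApp x a p)) where

    inOrb-transport : ∀ q → inOrb x p q ≡ inOrb x' (app g p) (app g q)
    inOrb-transport q = T-ext
      (λ h → let (a , e) = inOrb⁻ x h in inOrb⁺ Bx' a (trans (tr a) (cong (app g) e)))
      (λ h → let (a , e) = inOrb⁻ x' h in inOrb⁺ Bx a (Bij⇒Inj Bg (trans (sym (tr a)) e)))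

    inCyc-transport : ∀ q → inCyc x p q ≡ inCyc x' (app g p) (app g q)
    inCyc-transport q = cong₂ _∨_ (inOrb-transport q)
      (trans (inOrb-transport (neg q)) (cong (inOrb x' (app g p)) (app-neg g q)))

    isNegCls-transport : isNegCls x p ≡ isNegCls x' (app g p)
    isNegCls-transport = trans (inOrb-transport (neg p)) (cong (inOrb x' (app g p)) (app-neg g p))

    orbLen-transport : orbLen x p ≡ orbLen x' (app g p)
    orbLen-transport with period Bx p
    ... | L , isL@(l , e , mn) , _ = trans (orbLen-period Bx isL) (sym (orbLen-period Bx'
      (l , trans (tr L) (cong (app g) e) , λ a a≥ a< e' → mn a a≥ a< (Bij⇒Inj Bg (trans (sym (tr a)) e')))))

    cycLen-transport : cycLen x p ≡ cycLen x' (app g p)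
    cycLen-transport = cong₂ (λ b l → if b then ⌊ l /2⌋ else l) isNegCls-transport orbLen-transport

  iter-Comm₁ : ∀ {x z : SP n} → Comm x z → ∀ a p → iterApp x a (app z p) ≡ app z (iterApp x a p)
  iter-Comm₁ c a p = iter-Comm c a 1 p

  Comm-sym : ∀ {x z : SP n} → Comm x z → Comm z x
  Comm-sym c = mkComm λ p → sym (comm c p)

  Comm-inv : ∀ {x z : SP n} → Bij z → Comm x z → Comm x (inv z)
  Comm-inv {x} {z} Bz c = mkComm λ p → Bij⇒Inj Bz (trans (sym (comm c (app (inv z) p)))
    (trans (cong (app x) (app-invʳ z Bz p)) (sym (app-invʳ z Bz (app x p)))))

  Comm-self : ∀ {x : SP n} → Comm x x
  Comm-self = mkComm λ p → refl

  Comm-compose : ∀ {x z w : SP n} → Comm x z → Comm x w → Comm x (compose z w)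
  Comm-compose {x} {z} {w} c d = mkComm λ p → trans (cong (app x) (app-compose z w p))
    (trans (comm c (app w p)) (trans (cong (app z) (comm d p)) (sym (app-compose z w (app x p)))))

  Comm-powN : ∀ {x z : SP n} → Comm x z → ∀ a → Comm x (powN z a)
  Comm-powN {x} {z} c a = mkComm λ p → trans (cong (app x) (app-powN z a p)) (trans (iter-Comm c 1 a p) (sym (app-powN z a (app x p))))

  inCyc-Comm : ∀ {x z : SP n} → Bij x → Bij z → Comm x z → ∀ p q → inCyc x (app z p) (app z q) ≡ inCyc x p q
  inCyc-Comm {x} {z} Bx Bz c p q = sym (inCyc-transport {g = z} Bx Bx Bz (λ a → iter-Comm₁ c a p) q)

  restrict : SP n → (Pt n → Bool) → SP n
  restrict z Q = mk (patch Q (app z))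

  app-restrict : ∀ {z Q} → NegInvariant Q → ∀ p → app (restrict z Q) p ≡ patch Q (app z) p
  app-restrict {z} Qn = app-mk (patch-equivariant Qn (app-neg z))

  restrict-in : ∀ {z Q} → NegInvariant Q → ∀ {p} → T (Q p) → app (restrict z Q) p ≡ app z p
  restrict-in {z} {Q} Qn {p} t = trans (app-restrict {z} Qn p) (patch-in {Q = Q} {f = app z} t)

  restrict-out : ∀ {z Q} → NegInvariant Q → ∀ {p} → ¬ T (Q p) → app (restrict z Q) p ≡ p
  restrict-out {z} {Q} Qn {p} t = trans (app-restrict {z} Qn p) (patch-out {Q = Q} {f = app z} t)

  restrict-Bij : ∀ {z Q} → Bij z → NegInvariant Q → Stable z Q → Bij (restrict z Q)
  restrict-Bij {z} {Q} Bz Qn st = mk-Bij (patch-equivariant Qn (app-neg z))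
    (λ {p} {q} → patch-injective {Q = Q} {f = app z} (λ p t → subst T (sym (st p)) t) (Bij⇒Inj Bz) {p} {q})

  patch-Comm : ∀ {x : SP n} {Q f} → Stable x Q → (∀ p → app x (f p) ≡ f (app x p)) →
               ∀ p → app x (patch Q f p) ≡ patch Q f (app x p)
  patch-Comm {x} {Q} st c p rewrite st p with Q p
  ... | true  = c p
  ... | false = refl

  restrict-Comm : ∀ {x z : SP n} {Q} → NegInvariant Q → Stable x Q → Comm x z → Comm x (restrict z Q)
  restrict-Comm {x} {z} {Q} Qn st c = mkComm λ p → trans (cong (app x) (app-restrict {z} Qn p))
    (trans (patch-Comm {x} {Q} {app z} st (comm c) p) (sym (app-restrict {z} Qn (app x p))))

  iter-restrict-in : ∀ {z Q} → NegInvariant Q → Stable z Q → ∀ a {p} → T (Q p) →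
                     iterApp (restrict z Q) a p ≡ iterApp z a p
  iter-restrict-in Qn st zero    t = refl
  iter-restrict-in {z} {Q} Qn st (suc a) {p} t rewrite iter-restrict-in {z} {Q} Qn st a t =
    restrict-in {z} {Q} Qn {iterApp z a p} (subst T (sym (stable-iter {z} {Q} st a p)) t)

  iter-restrict-out : ∀ {z Q} → NegInvariant Q → ∀ a {p} → ¬ T (Q p) → iterApp (restrict z Q) a p ≡ p
  iter-restrict-out Qn zero    t = refl
  iter-restrict-out {z} {Q} Qn (suc a) {p} t rewrite iter-restrict-out {z} {Q} Qn a t = restrict-out {z} {Q} Qn t

  app-negCyc : ∀ {x : SP n} → Bij x → ∀ c p → app (negCyc x c) p ≡ patch (inCyc x c) neg p
  app-negCyc {x} B c = app-mk (patch-equivariant (inCyc-neg B c) (λ _ → refl))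

  negCyc-Bij : ∀ {x : SP n} → Bij x → ∀ c → Bij (negCyc x c)
  negCyc-Bij {x} B c = mk-Bij (patch-equivariant (inCyc-neg B c) (λ _ → refl))
    (λ {p} {q} → patch-injective {Q = inCyc x c} {f = neg} (λ p t → subst T (sym (inCyc-neg B c p)) t) (flip-inj true) {p} {q})

  negCyc-Comm : ∀ {x : SP n} → Bij x → ∀ c → Comm x (negCyc x c)
  negCyc-Comm {x} B c = mkComm λ p → trans (cong (app x) (app-negCyc B c p))
    (trans (patch-Comm {x} {inCyc x c} {neg} (inCyc-stable B c) (app-neg x) p) (sym (app-negCyc B c (app x p))))

  isNegCls⁻ : ∀ {x : SP n} {c} → T (isNegCls x c) → ∃ λ a → iterApp x a c ≡ neg c
  isNegCls⁻ {x} = inOrb⁻ x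

  -- the sign s is redundant when -1 already is a power of the cycle
  Reduced : SP n → Pt n → Bool → Set
  Reduced x c s = T (isNegCls x c) → s ≡ false

  -- If -1 is the power x^a on the cycle, a sign is absorbed by adding a to the exponent.
  inCyc-reduced : ∀ {x : SP n} → Bij x → ∀ {c q} → T (inCyc x c q) → ∃₂ λ t s → q ≡ flip s (iterApp x t c) × Reduced x c s
  inCyc-reduced {x} B {c} {q} h with inCyc⁻ x h
  ... | t , false , e = t , false , sym e , λ _ → refl
  ... | t , true  , e with BP.T? (isNegCls x c)
  ...   | no ¬k = t , true , flip-inj true (trans (sym e) (sym (flip-flip true (iterApp x t c)))) , λ k → ⊥-elim (¬k k)
  ...   | yes k = let (a , ea) = isNegCls⁻ k in t +ℕ a , false ,
          flip-inj true (trans (sym e) (sym (trans (cong neg (trans (iter-+ x t a c) (trans (cong (iterApp x t) ea) (app-iter-flip x t true c)))) (flip-flip true (iterApp x t c))))) , λ _ → refl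

  -- From x^a c = -c the orbit length divides 2a. Were it odd, it would divide a and give c = -c;
  -- hence the halving in `cycLen` is exact.
  cycLen-neg : ∀ {x : SP n} → Bij x → ∀ {c} → T (isNegCls x c) → 2 *ℕ cycLen x c ≡ orbLen x c
  cycLen-neg {x} B {c} t rewrite T⇒≡ t = doubled (orbLen x c) even
    where
    half : ∀ q → ⌊ 2 *ℕ q /2⌋ ≡ q
    half q = trans (cong ⌊_/2⌋ (cong (q +ℕ_) (ℕP.+-identityʳ q))) (sym (ℕP.n≡⌊n+n/2⌋ q))
    doubled : ∀ L → 2 ∣ L → 2 *ℕ ⌊ L /2⌋ ≡ L
    doubled _ (divides q refl) = trans (cong (2 *ℕ_) (trans (cong ⌊_/2⌋ (ℕP.*-comm q 2)) (half q))) (ℕP.*-comm 2 q)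
    a : ℕ
    a = proj₁ (isNegCls⁻ t)
    ea : iterApp x a c ≡ neg c
    ea = proj₂ (isNegCls⁻ t)
    dvd : orbLen x c ∣ a +ℕ a
    dvd = orbLen-divides B (a +ℕ a) (trans (iter-+ x a a c) (trans (cong (iterApp x a) ea)
      (trans (app-iter-flip x a true c) (trans (cong neg ea) (flip-flip true c)))))
    odd∣ : ∀ L → L ℕD.% 2 ≡ 1 → L ∣ a +ℕ a → L ∣ a
    odd∣ L o d = Cop.coprime-divisor {L} {2} (Cop.gcd≡1⇒coprime (g2 L o)) (subst (L ∣_) (cong (a +ℕ_) (sym (ℕP.+-identityʳ a))) d)
      where
      g2 : ∀ L → L ℕD.% 2 ≡ 1 → gcd L 2 ≡ 1
      g2 L o with gcd L 2 | GCD.gcd[m,n]∣m L 2 | GCD.gcd[m,n]∣n L 2 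
      ... | 0 | d | d' = case ℕ∣.0∣⇒≡0 d' of λ ()
      ... | 1 | d | d' = refl
      ... | 2 | d | d' = case trans (sym o) (ℕ∣.n∣m⇒m%n≡0 L 2 d) of λ ()
      ... | suc (suc (suc k)) | d | d' = case ℕ∣.∣⇒≤ d' of λ { (s≤s (s≤s ())) }
    even : 2 ∣ orbLen x c
    even with orbLen x c ℕD.% 2 in eq | ℕD.m%n<n (orbLen x c) 2
    ... | 0 | _ = ℕ∣.m%n≡0⇒n∣m _ 2 eq
    ... | 1 | _ = ⊥-elim (flip≢ (trans (sym ea) (iter-multiple x (iter-orbLen B c) (odd∣ _ eq dvd))))
    ... | suc (suc _) | s≤s (s≤s ())

  cycLen-pos : ∀ (x : SP n) {c} → ¬ T (isNegCls x c) → cycLen x c ≡ orbLen x c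
  cycLen-pos x t rewrite ¬T⇒≡ t = refl

  -- Faithful characters are prescribed for lengths up to n only. In class +1 the iterates of `c`
  -- have distinct indices, as opposite iterates would put -c in the orbit; in class -1 twice the
  -- length is an orbit length, hence at most 2n.
  cycLen≤ : ∀ {x : SP n} → Bij x → ∀ c → cycLen x c ≤ n
  cycLen≤ {x} B c with isNegCls x c in eq
  ... | true  = subst (_≤ n) (sym (⌊/2⌋-≡)) (ℕP.*-cancelˡ-≤ 2 (ℕP.≤-trans (ℕP.≤-reflexive (cycLen-neg B {c} (≡⇒T eq))) (orbLen≤ B c)))
    where
    ⌊/2⌋-≡ : ⌊ orbLen x c /2⌋ ≡ cycLen x c
    ⌊/2⌋-≡ rewrite eq = refl
  ... | false = FP.injective⇒≤ {f = λ i → proj₁ (iterApp x (toℕ i) c)} λ {i} {j} e → FP.toℕ-injective (inj (FP.toℕ<n i) (FP.toℕ<n j) e)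
    where
    isL : IsPeriod x c (orbLen x c)
    isL with period B c
    ... | L , isL , _ = subst (IsPeriod x c) (sym (orbLen-period B isL)) isL
    same : ∀ (p q : Pt n) → proj₁ p ≡ proj₁ q → p ≡ q ⊎ p ≡ neg q
    same (i , true)  (.i , true)  refl = inj₁ refl
    same (i , true)  (.i , false) refl = inj₂ refl
    same (i , false) (.i , true)  refl = inj₂ refl
    same (i , false) (.i , false) refl = inj₁ refl
    lt : ∀ {i j} → i < j → j < orbLen x c → proj₁ (iterApp x i c) ≢ proj₁ (iterApp x j c)
    lt {i} {j} i<j j< e with same (iterApp x i c) (iterApp x j c) e
    ... | inj₁ e' = iter-distinct B isL i<j j< e'
    ... | inj₂ e' = subst T eq (inOrb⁺ B (j ∸ i) (flip-inj true (trans (sym (app-iter-flip x (j ∸ i) true c)) (trans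
            (iter-inj B i (trans (sym (iter-+ x i (j ∸ i) (neg c))) (trans (cong (λ a → iterApp x a (neg c)) (ℕP.m+[n∸m]≡n (ℕP.<⇒≤ i<j)))
              (trans (app-iter-flip x j true c) (sym e'))))) (sym (flip-flip true c))))))
    inj : ∀ {i j} → i < orbLen x c → j < orbLen x c → proj₁ (iterApp x i c) ≡ proj₁ (iterApp x j c) → i ≡ j
    inj {i} {j} i< j< e with ℕP.<-cmp i j
    ... | tri< l _ _ = ⊥-elim (lt l j< e)
    ... | tri≈ _ e' _ = e'
    ... | tri> _ _ l = ⊥-elim (lt l i< (sym e))

  cycLen≥1 : ∀ {x : SP n} → Bij x → ∀ c → 1 ≤ cycLen x c
  cycLen≥1 {x} B c with BP.T? (isNegCls x c)
  ... | yes t = pos (cycLen-neg B t) (orbLen≥1 B c)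
    where
    pos : ∀ {a b} → 2 *ℕ a ≡ b → 1 ≤ b → 1 ≤ a
    pos {zero} refl ()
    pos {suc a} _ _ = s≤s z≤n
  ... | no ¬t = subst (1 ≤_) (sym (cycLen-pos x ¬t)) (orbLen≥1 B c)

-- The involution exchanging the cycles of `c` and `z c`

if-equivariant : ∀ {n} (Q : Pt n → Bool) (f g : Pt n → Pt n) → NegInvariant Q → Equivariant f → Equivariant g →
                 Equivariant (λ p → if Q p then f p else g p)
if-equivariant Q f g Qn fe ge p rewrite Qn p with Q p
... | true  = fe p
... | false = ge p

module Swap {n : ℕ} {x z : SP n} (Bx : Bij x) (Bz : Bij z) (xz : Comm x z) (c : Pt n)
            (away : ¬ T (inCyc x c (app z c))) where

  X Y : Pt n → Bool
  X = inCyc x c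
  Y = inCyc x (app z c)

  -- The way back uses the inverse of z, since z itself may carry the second cycle on to a third
  -- one; this makes the element an involution, as `SwapInv` demands.
  swapFun : Pt n → Pt n
  swapFun p = if X p then app z p else patch Y (app (inv z)) p

  swapEl : SP n
  swapEl = mk swapFun

  X⇒Yz : ∀ p → Y (app z p) ≡ X p
  X⇒Yz p = inCyc-Comm Bx Bz xz c p

  Y⇒Xz⁻¹ : ∀ p → X (app (inv z) p) ≡ Y p
  Y⇒Xz⁻¹ p = trans (sym (X⇒Yz (app (inv z) p))) (cong Y (app-invʳ z Bz p))

  disjoint : ∀ {p} → T (X p) → ¬ T (Y p)
  disjoint hx hy = away (inCyc-trans Bx hx (inCyc-sym Bx hy))

  private
    equivariant : Equivariant swapFun
    equivariant = if-equivariant X (app z) (patch Y (app (inv z))) (inCyc-neg Bx c) (app-neg z)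
      (patch-equivariant {Q = Y} {f = app (inv z)} (inCyc-neg Bx (app z c)) (app-neg (inv z)))

  swap-X : ∀ {p} → T (X p) → app swapEl p ≡ app z p
  swap-X {p} t = trans (app-mk equivariant p) (cong (λ b → if b then app z p else patch Y (app (inv z)) p) (T⇒≡ t))

  private
    not-X : ∀ {p} → ¬ T (X p) → app swapEl p ≡ patch Y (app (inv z)) p
    not-X {p} t = trans (app-mk equivariant p) (cong (λ b → if b then app z p else patch Y (app (inv z)) p) (¬T⇒≡ t))

  swap-Y : ∀ {p} → T (Y p) → app swapEl p ≡ app (inv z) p
  swap-Y {p} t = trans (not-X (λ h → disjoint h t)) (patch-in {Q = Y} {f = app (inv z)} t)

  swap-out : ∀ {p} → ¬ T (X p) → ¬ T (Y p) → app swapEl p ≡ p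
  swap-out {p} t u = trans (not-X t) (patch-out {Q = Y} {f = app (inv z)} u)

  swap-involutive : ∀ p → app swapEl (app swapEl p) ≡ p
  swap-involutive p with BP.T? (X p) | BP.T? (Y p)
  ... | yes t | _ = trans (cong (app swapEl) (swap-X t)) (trans (swap-Y (subst T (sym (X⇒Yz p)) t)) (app-invˡ z Bz p))
  ... | no t | yes u = trans (cong (app swapEl) (swap-Y u)) (trans (swap-X (subst T (sym (Y⇒Xz⁻¹ p)) u)) (app-invʳ z Bz p))
  ... | no t | no u = trans (cong (app swapEl) (swap-out t u)) (swap-out t u)

  swap-Bij : Bij swapEl
  swap-Bij = Inj⇒Bij λ {p} {q} e → trans (sym (swap-involutive p)) (trans (cong (app swapEl) e) (swap-involutive q))

  swap-Comm : Comm x swapEl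
  swap-Comm = mkComm go
    where
    sX : ∀ p → X (app x p) ≡ X p
    sX = inCyc-stable Bx c
    sY : ∀ p → Y (app x p) ≡ Y p
    sY = inCyc-stable Bx (app z c)
    go : ∀ p → app x (app swapEl p) ≡ app swapEl (app x p)
    go p with BP.T? (X p) | BP.T? (Y p)
    ... | yes t | _ = trans (cong (app x) (swap-X t)) (trans (comm xz p) (sym (swap-X (subst T (sym (sX p)) t))))
    ... | no t | yes u = trans (cong (app x) (swap-Y u)) (trans (comm (Comm-inv Bz xz) p) (sym (swap-Y (subst T (sym (sY p)) u))))
    ... | no t | no u = trans (cong (app x) (swap-out t u)) (sym (swap-out (t ∘ subst T (sX p)) (u ∘ subst T (sY p))))

  swap-SwapInv : SwapInv x swapEl
  swap-SwapInv = ⇒InCent swap-Bij swap-Comm ,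
    ≡⇒eqSP (app-ext λ p → trans (app-compose swapEl swapEl p) (trans (swap-involutive p) (sym (app-id p)))) ,
    c , app z c , away ,
    subst (T ∘ Y) (sym (swap-X (inCyc-refl Bx c))) (inCyc-refl Bx (app z c)) ,
    λ i t → trans (sym (lookup-app i)) (swap-out
      (λ h → nor (X (i , false)) (Y (i , false)) t (inj₁ h)) (λ h → nor (X (i , false)) (Y (i , false)) t (inj₂ h)))
    where
    nor : ∀ a b → T (not (a ∨ b)) → T a ⊎ T b → ⊥
    nor false false _ (inj₁ ())
    nor false false _ (inj₂ ())
    lookup-app : ∀ i → app swapEl (i , false) ≡ lookup swapEl i
    lookup-app i = refl

-- Conjugation g z g⁻¹ = z′, and how the generators of a centralizer are carried along

module _ {n : ℕ} where

  record Conj (g z z' : SP n) : Set where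
    constructor mkConj
    field conj : ∀ p → app z' (app g p) ≡ app g (app z p)
  open Conj public

  Conj-unique : ∀ {g z z' z''} → Bij g → Conj g z z' → Conj g z z'' → z' ≡ z''
  Conj-unique {g} {z} {z'} {z''} Bg h k = app-ext λ p →
    subst (λ q → app z' q ≡ app z'' q) (app-invʳ g Bg p) (trans (conj h (app (inv g) p)) (sym (conj k (app (inv g) p))))

  conjugate : SP n → SP n → SP n
  conjugate g z = compose (compose g z) (inv g)

  conjugate-Conj : ∀ {g} z → Bij g → Conj g z (conjugate g z)
  conjugate-Conj {g} z Bg = mkConj λ p → trans (app-compose (compose g z) (inv g) (app g p))
    (trans (app-compose g z (app (inv g) (app g p))) (cong (λ q → app g (app z q)) (app-invˡ g Bg p)))

  Conj-Bij : ∀ {g z z'} → Bij g → Bij z → Conj g z z' → Bij z'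
  Conj-Bij {g} {z} Bg Bz h = subst Bij (Conj-unique Bg (conjugate-Conj z Bg) h)
    (Bij-compose (Bij-compose Bg Bz) (Bij-inv g Bg))

  Conj-compose : ∀ {g z w z' w'} → Conj g z z' → Conj g w w' → Conj g (compose z w) (compose z' w')
  Conj-compose {g} {z} {w} {z'} {w'} h k = mkConj λ p → trans (app-compose z' w' (app g p))
    (trans (cong (app z') (conj k p)) (trans (conj h (app w p)) (cong (app g) (sym (app-compose z w p)))))

  Conj-inv : ∀ {g z z'} → Bij z → Bij z' → Conj g z z' → Conj g (inv z) (inv z')
  Conj-inv {g} {z} {z'} Bz Bz' h = mkConj λ p → Bij⇒Inj Bz' (trans (app-invʳ z' Bz' (app g p))
    (trans (cong (app g) (sym (app-invʳ z Bz p))) (sym (conj h (app (inv z) p)))))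

  module _ {g : SP n} {Q Q' : Pt n → Bool} (Qn : NegInvariant Q) (Qn' : NegInvariant Q') (h : ∀ p → Q p ≡ Q' (app g p)) where

    patch-Conj : ∀ {f f'} → Equivariant f → Equivariant f' → (∀ p → T (Q p) → f' (app g p) ≡ app g (f p)) → Conj g (mk (patch Q f)) (mk (patch Q' f'))
    patch-Conj {f} {f'} fe fe' k = mkConj λ p → trans (app-mk (patch-equivariant Qn' fe') (app g p))
      (trans (go p) (cong (app g) (sym (app-mk (patch-equivariant Qn fe) p))))
      where
      go : ∀ p → patch Q' f' (app g p) ≡ app g (patch Q f p)
      go p with BP.T? (Q p)
      ... | yes t = trans (patch-in {Q = Q'} {f = f'} (subst T (h p) t)) (trans (k p t) (cong (app g) (sym (patch-in {Q = Q} {f = f} t))))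
      ... | no t  = trans (patch-out {Q = Q'} {f = f'} (t ∘ subst T (sym (h p)))) (cong (app g) (sym (patch-out {Q = Q} {f = f} t)))

-- Commuting pairs: blocks, twists and orders

-- The multiple q g in Z/2, that is, the q-th power of the sign g.
bmul : ℕ → Bool → Bool
bmul zero    g = false
bmul (suc q) g = g xor bmul q g

bmul-false : ∀ q → bmul q false ≡ false
bmul-false zero    = refl
bmul-false (suc q) = bmul-false q

bmul-+ : ∀ a b g → bmul (a +ℕ b) g ≡ bmul a g xor bmul b g
bmul-+ zero    b g = refl
bmul-+ (suc a) b g = trans (cong (g xor_) (bmul-+ a b g)) (sym (BP.xor-assoc g (bmul a g) (bmul b g)))

bmul-* : ∀ a b g → bmul (a *ℕ b) g ≡ bmul a (bmul b g)
bmul-* zero    b g = refl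
bmul-* (suc a) b g = trans (bmul-+ b (a *ℕ b) g) (cong (bmul b g xor_) (bmul-* a b g))

bmul-M : ∀ n g → bmul (M n) g ≡ false
bmul-M n g = let (h , e) = M-even n in
  trans (cong (λ k → bmul k g) e) (trans (bmul-+ h h g) (BP.xor-same (bmul h g)))

M*-suc : ∀ n a → a +ℕ (M n ∸ 1) *ℕ a ≡ a *ℕ M n
M*-suc n a = trans (cong (a +ℕ_) (ℕP.*-comm (M n ∸ 1) a)) (trans (sym (ℕP.*-suc a (M n ∸ 1))) (cong (a *ℕ_) (ℕP.m+[n∸m]≡n (M≥1 n))))

-- u is invertible modulo the even number M, hence odd
bmul-unit : ∀ {n} {{_ : NonZero (M n)}} {u' u} → (u' *ℕ u) ℕD.% M n ≡ 1 → ∀ g → bmul u g ≡ g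
bmul-unit {n} {u'} {u} e false = bmul-false u
bmul-unit {n} {u'} {u} e true with bmul u true in eq
... | true  = refl
... | false = case trans (sym (trans (bmul-* u' u true) (trans (cong (bmul u') eq) (bmul-false u')))) odd of λ ()
  where
  odd : bmul (u' *ℕ u) true ≡ true
  odd = trans (cong (λ k → bmul k true) (trans (ℕD.m≡m%n+[m/n]*n (u' *ℕ u) (M n)) (cong (_+ℕ (u' *ℕ u) ℕD./ M n *ℕ M n) e)))
    (trans (bmul-+ 1 ((u' *ℕ u) ℕD./ M n *ℕ M n) true) (cong (true xor_) (trans (bmul-* ((u' *ℕ u) ℕD./ M n) (M n) true)
      (trans (cong (bmul ((u' *ℕ u) ℕD./ M n)) (bmul-M n true)) (bmul-false ((u' *ℕ u) ℕD./ M n))))))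

module _ {n : ℕ} where

  iter-power : ∀ {x y : SP n} → Comm x y → ∀ {d t s c} → iterApp y d c ≡ flip s (iterApp x t c) →
               ∀ q → iterApp y (q *ℕ d) c ≡ flip (bmul q s) (iterApp x (q *ℕ t) c)
  iter-power xy e zero = refl
  iter-power {x} {y} xy {d} {t} {s} {c} e (suc q) =
    trans (iter-+ y d (q *ℕ d) c) (trans (cong (iterApp y d) (iter-power xy e q))
    (trans (app-iter-flip y d (bmul q s) (iterApp x (q *ℕ t) c)) (trans (cong (flip (bmul q s)) (trans (sym (iter-Comm xy (q *ℕ t) d c))
      (trans (cong (iterApp x (q *ℕ t)) e) (trans (app-iter-flip x (q *ℕ t) s (iterApp x t c)) (cong (flip s) (trans (sym (iter-+ x (q *ℕ t) t c)) (cong (λ a → iterApp x a c) (ℕP.+-comm (q *ℕ t) t))))))))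
    (trans (flip-comm (bmul q s) s (iterApp x (t +ℕ q *ℕ t) c)) (flip-xor s (bmul q s) (iterApp x (t +ℕ q *ℕ t) c))))))

  iter-flip-power : ∀ {y : SP n} {i s c} → iterApp y i c ≡ flip s c → ∀ q → iterApp y (q *ℕ i) c ≡ flip (bmul q s) c
  iter-flip-power {y} {i} {s} {c} e q = trans (iter-power {x = idB n} {y} (mkComm λ p → trans (app-id (app y p)) (cong (app y) (sym (app-id p)))) {i} {0} {s} {c} e q)
    (cong (λ a → flip (bmul q s) (iterApp (idB n) a c)) (ℕP.*-zeroʳ q))

  iter-M-cancel : ∀ {x : SP n} → Bij x → ∀ a b p → iterApp x (a +ℕ b *ℕ M n) p ≡ iterApp x a p
  iter-M-cancel {x} B a b p = trans (iter-+ x a (b *ℕ M n) p) (cong (iterApp x a) (iter-multiple x (iter-M B p) (divides b refl)))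

  flip-cancel : ∀ s s' {p q : Pt n} → flip s p ≡ flip s' q → p ≡ flip (s xor s') q
  flip-cancel s s' {p} {q} e = trans (sym (flip-flip s p)) (trans (cong (flip s) e) (flip-xor s s' q))

  -- The exponent stands for a - b.
  ratio : ∀ {x : SP n} → Bij x → ∀ a b s {c} → iterApp x a c ≡ flip s (iterApp x b c) → iterApp x (a +ℕ (M n ∸ 1) *ℕ b) c ≡ flip s c
  ratio {x} B a b s {c} e = trans (cong (λ k → iterApp x k c) (ℕP.+-comm a ((M n ∸ 1) *ℕ b))) (trans (iter-+ x ((M n ∸ 1) *ℕ b) a c) (trans (cong (iterApp x ((M n ∸ 1) *ℕ b)) e)
    (trans (app-iter-flip x ((M n ∸ 1) *ℕ b) s (iterApp x b c)) (cong (flip s) (trans (cong (λ k → iterApp x k (iterApp x b c)) (ℕP.*-comm (M n ∸ 1) b)) (iter-back B b c))))))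

  -- Different signs would make -1 a power of x at c; but then both signs, being reduced, are
  -- trivial.
  same-sign : ∀ {x : SP n} → Bij x → ∀ {a b s s' c} → Reduced x c s → Reduced x c s' →
              flip s (iterApp x a c) ≡ flip s' (iterApp x b c) → iterApp x a c ≡ iterApp x b c
  same-sign {x} B {a} {b} {s} {s'} {c} r r' e with s xor s' in eq | flip-cancel s s' e
  ... | false | e' = e'
  ... | true  | e' = case trans (sym eq) (cong₂ _xor_ (r neg!) (r' neg!)) of λ ()
    where
    neg! : T (isNegCls x c)
    neg! = inOrb⁺ B (a +ℕ (M n ∸ 1) *ℕ b) (ratio B a b true {c} e')

  -- `y` permutes the cycles of `x`, and y^d fixes the cycle of `c`, so d may be dropped from an
  -- exponent. This closure is what makes the first return divide every return.
  cyc-sub : ∀ {x y : SP n} → Bij x → Comm x y → ∀ {d} {c} → T (inCyc x c (iterApp y d c)) → ∀ a → T (inCyc x c (iterApp y (d +ℕ a) c)) → T (inCyc x c (iterApp y a c))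
  cyc-sub {x} {y} Bx xy {d} {c} h a k with inCyc⁻ x h
  ... | l , s , e = inCyc-trans Bx k (inCyc⁺ Bx (l *ℕ (M n ∸ 1)) s (trans (cong (iterApp x (l *ℕ (M n ∸ 1))) (trans (trans (cong (λ t → iterApp y t c) (ℕP.+-comm d a)) (iter-+ y a d c))
      (trans (cong (iterApp y a) (trans (sym (flip-flip s (iterApp y d c))) (cong (flip s) (sym e)))) (trans (app-iter-flip y a s (iterApp x l c)) (cong (flip s) (sym (iter-Comm xy l a c)))))))
      (trans (app-iter-flip x (l *ℕ (M n ∸ 1)) s (iterApp x l (iterApp y a c))) (cong (flip s) (iter-back Bx l (iterApp y a c))))))

  FirstReturn : SP n → SP n → Pt n → ℕ → Set
  FirstReturn x y c = IsLeast (λ d → T (inCyc x c (iterApp y d c)))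

  firstReturn : ∀ {x y : SP n} → Bij x → Bij y → ∀ c → ∃ (FirstReturn x y c)
  firstReturn {x} {y} Bx By c = leastPositive (λ a → BP.T? (inCyc x c (iterApp y a c))) (M n) (M≥1 n)
    (subst (T ∘ inCyc x c) (sym (iter-M By c)) (inCyc-refl Bx c))

  firstReturn-divides : ∀ {x y : SP n} → Bij x → Comm x y → ∀ {c d} → FirstReturn x y c d → ∀ a → T (inCyc x c (iterApp y a c)) → d ∣ a
  firstReturn-divides Bx xy fr = least-divides fr (cyc-sub Bx xy (proj₁ (proj₂ fr)))

  -- The sublattice {(a,b) : x^a y^b c = ± c} is symmetric in x and y; this is the half of the
  -- resulting duality that compares the order of y^d modulo ± with that of x^m.
  order-transfer : ∀ {x y : SP n} → Bij x → Bij y → Comm x y → ∀ {c d t s m j g} →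
    FirstReturn x y c d → iterApp y d c ≡ flip s (iterApp x t c) → Reduced x c s →
    iterApp x m c ≡ flip g (iterApp y j c) → Reduced y c g →
    ∀ σ → iterApp x (σ *ℕ t) c ≡ c → iterApp y (σ *ℕ j) c ≡ c
  order-transfer {x} {y} Bx By xy {c} {d} {t} {s} {m} {j} {g} fr ed rs em rg σ fix = go u refl
    where
    -- y^j c = ± x^m c lies in the x-cycle of c. Hence y^(σj) c is, up to sign, a power of x^(σt)
    -- applied to c, and only the sign is in question.
    d∣j : d ∣ j
    d∣j = firstReturn-divides Bx xy fr j (inCyc⁺ Bx m g em)
    j' : ℕ
    j' = ℕ∣._∣_.quotient d∣j
    u : Bool
    u = bmul (σ *ℕ j') s
    eu : iterApp y (σ *ℕ j) c ≡ flip u c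
    eu = trans (cong (λ a → iterApp y a c) (trans (cong (σ *ℕ_) (ℕ∣._∣_.equality d∣j)) (sym (ℕP.*-assoc σ j' d))))
      (trans (iter-power xy {d} {t} {s} {c} ed (σ *ℕ j')) (cong (flip u) (iter-multiple x fix (divides j' (trans (cong (_*ℕ t) (ℕP.*-comm σ j')) (ℕP.*-assoc j' σ t))))))
    -- The sign -1 would make -1 a power of y at c, so g is trivial. If -1 is a power of x as well,
    -- s is trivial and with it u; if not, x^(σm) c = -c is impossible.
    absurd-sign : u ≡ true → Dec (T (isNegCls y c)) → Dec (T (isNegCls x c)) → ⊥
    absurd-sign e (no ¬ny) _ = ¬ny (inOrb⁺ By (σ *ℕ j) (trans eu (cong (λ w → flip w c) e)))
    absurd-sign e (yes ny) (yes nx) = case trans (sym e) (trans (cong (bmul (σ *ℕ j')) (rs nx)) (bmul-false (σ *ℕ j'))) of λ ()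
    absurd-sign e (yes ny) (no ¬nx) = ¬nx (inOrb⁺ Bx (σ *ℕ m) (trans (iter-power (Comm-sym xy) {m} {j} {g} {c} em σ)
            (trans (cong (λ w → flip w (iterApp y (σ *ℕ j) c)) (trans (cong (bmul σ) (rg ny)) (bmul-false σ))) (trans eu (cong (λ w → flip w c) e)))))
    go : ∀ w → u ≡ w → iterApp y (σ *ℕ j) c ≡ c
    go false e = trans eu (cong (λ w → flip w c) e)
    go true  e = ⊥-elim (absurd-sign e (BP.T? (isNegCls y c)) (BP.T? (isNegCls x c)))

  -- As x and y commute, each point of the orbit is some ± x^a y^b c; so the x-cycles of the y^b c,
  -- with b below the common period, exhaust it.
  block : SP n → SP n → Pt n → Pt n → Bool
  block x y c p = any (λ b → inCyc x (iterApp y b c) p) (upTo (M n))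

  module _ {x y : SP n} (Bx : Bij x) (By : Bij y) where

    block⁺ : ∀ {c p} a b s → iterApp x a (iterApp y b c) ≡ flip s p → T (block x y c p)
    block⁺ {c} {p} a b s e = any-intro (λ b → inCyc x (iterApp y b c) p) {x = b ℕD.% M n} (∈P.∈-upTo⁺ (ℕD.m%n<n b (M n)))
      (inCyc⁺ Bx a s (trans (cong (iterApp x a) (iter-% {x = y} (M n) (iter-M By c) b)) e))
      where
      instance
        nz : NonZero (M n)
        nz = M-nonZero n

    block⁻ : ∀ {c p} → T (block x y c p) → ∃ λ b → T (inCyc x (iterApp y b c) p)
    block⁻ {c} {p} h = let (b , _ , k) = any-elim (λ b → inCyc x (iterApp y b c) p) (upTo (M n)) h in b , k

    cyc⇒block : ∀ {c p} b → T (inCyc x (iterApp y b c) p) → T (block x y c p)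
    cyc⇒block b h = let (a , s , e) = inCyc⁻ x h in block⁺ a b s e

    block-refl : ∀ c → T (block x y c c)
    block-refl c = block⁺ 0 0 false refl

    block-neg : ∀ c → NegInvariant (block x y c)
    block-neg c p = T-ext (λ h → let (b , k) = block⁻ h in cyc⇒block b (subst T (inCyc-neg Bx (iterApp y b c) p) k))
                          (λ h → let (b , k) = block⁻ h in cyc⇒block b (subst T (sym (inCyc-neg Bx (iterApp y b c) p)) k))

    block-stableˣ : ∀ c → Stable x (block x y c)
    block-stableˣ c p = T-ext (λ h → let (b , k) = block⁻ h in cyc⇒block b (subst T (inCyc-stable Bx (iterApp y b c) p) k))
                              (λ h → let (b , k) = block⁻ h in cyc⇒block b (subst T (sym (inCyc-stable Bx (iterApp y b c) p)) k))

    block-least : ∀ {Q} → NegInvariant Q → Stable x Q → Stable y Q → ∀ {c p} → T (block x y c p) → Q c ≡ Q p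
    block-least {Q} Qn Qx Qy {c} {p} h = let (b , k) = block⁻ {c} {p} h ; (a , s , e) = inCyc⁻ x k in
      trans (sym (stable-iter {x = y} {Q} Qy b c)) (trans (sym (stable-iter {x = x} {Q} Qx a (iterApp y b c))) (trans (cong Q e) (flip-invariant {Q = Q} Qn s p)))

    module _ (xy : Comm x y) where

      block-stableʸ : ∀ c → Stable y (block x y c)
      block-stableʸ c p = T-ext back forth
        where
        forth : ∀ {p} → T (block x y c p) → T (block x y c (app y p))
        forth {p} h = let (b , k) = block⁻ {c} {p} h in cyc⇒block (suc b) (subst T (sym (inCyc-Comm Bx By xy (iterApp y b c) p)) k)
        forth* : ∀ a {p} → T (block x y c p) → T (block x y c (iterApp y a p))
        forth* zero    h = h
        forth* (suc a) h = forth (forth* a h)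
        back : T (block x y c (app y p)) → T (block x y c p)
        back h = subst (T ∘ block x y c) (iter-back By 1 p) (forth* (1 *ℕ (M n ∸ 1)) h)

      block-sym : ∀ {c p} → T (block x y c p) → T (block x y p c)
      block-sym {c} {p} h = subst T (sym (block-least {block x y p} (block-neg p) (block-stableˣ p) (block-stableʸ p) h)) (block-refl p)

  twist : SP n → Pt n → ℕ → Bool → SP n
  twist y c a e = mk (patch (inCyc y c) (λ p → flip e (iterApp y a p)))

  module _ {y : SP n} (By : Bij y) (c : Pt n) where

    private
      Q : Pt n → Bool
      Q = inCyc y c
      f : ℕ → Bool → Pt n → Pt n
      f a e p = flip e (iterApp y a p)
      f-equivariant : ∀ a e → Equivariant (f a e)
      f-equivariant a e p = trans (cong (flip e) (app-iter-flip y a true p)) (flip-comm e true (iterApp y a p))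

    inCyc-flip-iter : ∀ a e p → inCyc y c (flip e (iterApp y a p)) ≡ inCyc y c p
    inCyc-flip-iter a e p = trans (flip-invariant {Q = inCyc y c} (inCyc-neg By c) e (iterApp y a p)) (stable-iter {x = y} {inCyc y c} (inCyc-stable By c) a p)

    app-twist : ∀ a e p → app (twist y c a e) p ≡ patch Q (f a e) p
    app-twist a e = app-mk (patch-equivariant {Q = Q} {f = f a e} (inCyc-neg By c) (f-equivariant a e))

    twist-in : ∀ a e {p} → T (inCyc y c p) → app (twist y c a e) p ≡ flip e (iterApp y a p)
    twist-in a e {p} h = trans (app-twist a e p) (patch-in {Q = Q} {f = f a e} h)

    twist-out : ∀ a e {p} → ¬ T (inCyc y c p) → app (twist y c a e) p ≡ p
    twist-out a e {p} h = trans (app-twist a e p) (patch-out {Q = Q} {f = f a e} h)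

    twist-Bij : ∀ a e → Bij (twist y c a e)
    twist-Bij a e = mk-Bij (patch-equivariant {Q = Q} {f = f a e} (inCyc-neg By c) (f-equivariant a e))
      (λ {p} {q} → patch-injective {Q = Q} {f = f a e} (λ p h → subst T (sym (inCyc-flip-iter a e p)) h) (λ h → iter-inj By a (flip-inj e h)) {p} {q})

    twist-Comm : ∀ a e → Comm y (twist y c a e)
    twist-Comm a e = mkComm λ p → trans (cong (app y) (app-twist a e p)) (trans
      (patch-Comm {x = y} {Q = Q} {f = f a e} (inCyc-stable By c) (λ p → trans (app-flip y e (iterApp y a p)) (cong (flip e) (iter-comm y 1 a p))) p)
      (sym (app-twist a e (app y p))))

    twist-periodic : ∀ a e → twist y c (M n +ℕ a) e ≡ twist y c a e
    twist-periodic a e = app-ext λ p → trans (app-twist (M n +ℕ a) e p) (trans (go p) (sym (app-twist a e p)))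
      where
      go : ∀ p → patch Q (f (M n +ℕ a) e) p ≡ patch Q (f a e) p
      go p = cong (λ q → if inCyc y c p then flip e q else p) (trans (iter-+ y (M n) a p) (iter-M By (iterApp y a p)))

    twist-stable : ∀ {Q} → NegInvariant Q → Stable y Q → ∀ a e → Stable (twist y c a e) Q
    twist-stable {Q} Qn Qy a e p with BP.T? (inCyc y c p)
    ... | yes h = trans (cong Q (twist-in a e h)) (trans (flip-invariant {Q = Q} Qn e (iterApp y a p)) (stable-iter {x = y} {Q} Qy a p))
    ... | no h  = cong Q (twist-out a e h)

    module _ {x : SP n} (Bx : Bij x) where

      twisted-Bij : ∀ a e → Bij (compose x (twist y c a e))
      twisted-Bij a e = Bij-compose Bx (twist-Bij a e)

      twisted-Comm : Comm y x → ∀ a e → Comm y (compose x (twist y c a e))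
      twisted-Comm yx a e = Comm-compose yx (twist-Comm a e)

      untwisted-Comm : ∀ a e → Comm y (compose x (twist y c a e)) → Comm y x
      untwisted-Comm a e yx = mkComm λ p → subst (λ q → app y (app x q) ≡ app x (app y q)) (app-invʳ t (twist-Bij a e) p) (go (app (inv t) p))
        where
        t : SP n
        t = twist y c a e
        go : ∀ p → app y (app x (app t p)) ≡ app x (app y (app t p))
        go p = trans (cong (app y) (sym (app-compose x t p))) (trans (comm yx p) (trans (app-compose x t (app y p)) (cong (app x) (sym (comm (twist-Comm a e) p)))))

      -- A twist preserves every region stable under y and -1. So the blocks of x and of the twisted
      -- element are stable under both, and minimality yields the two inclusions.
      block-twist : Comm x y → ∀ a e c' p → block (compose x (twist y c a e)) y c' p ≡ block x y c' p
      block-twist xy a e c' p = T-ext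
          (λ h → subst T (block-least Bx' By {block x y c'} (block-neg Bx By c') (λ q → trans (cong (block x y c') (app-compose x t q)) (trans (block-stableˣ Bx By c' (app t q)) (twist-stable {block x y c'} (block-neg Bx By c') (block-stableʸ Bx By xy c') a e q))) (block-stableʸ Bx By xy c') h) (block-refl Bx By c'))
          (λ h → subst T (block-least Bx By {block x' y c'} Qn Qx Qy h) (block-refl Bx' By c'))
        where
        t x' : SP n
        t  = twist y c a e
        x' = compose x t
        Bx' : Bij x'
        Bx' = twisted-Bij a e
        x'y : Comm x' y
        x'y = Comm-sym (twisted-Comm (Comm-sym xy) a e)
        Qn : NegInvariant (block x' y c')
        Qn = block-neg Bx' By c'
        Qy : Stable y (block x' y c')
        Qy = block-stableʸ Bx' By x'y c'
        Qx : Stable x (block x' y c')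
        Qx q = subst (λ q → block x' y c' (app x q) ≡ block x' y c' q) (app-invʳ t (twist-Bij a e) q)
          (trans (cong (block x' y c') (sym (app-compose x t (app (inv t) q)))) (trans (block-stableˣ Bx' By c' (app (inv t) q)) (sym (twist-stable {block x' y c'} Qn Qy a e (app (inv t) q)))))

boolFilter-cong : ∀ {A : Set} {f g : A → Bool} → (∀ x → f x ≡ g x) → ∀ xs → boolFilter f xs ≡ boolFilter g xs
boolFilter-cong h []       = refl
boolFilter-cong {f = f} {g} h (x ∷ xs) = trans (cong (λ b → if b then x ∷ boolFilter f xs else boolFilter f xs) (h x))
  (cong (λ ys → if g x then x ∷ ys else ys) (boolFilter-cong h xs))

-- The twists of x at c, indexed so that x^m c = (-1)^g y^j c for the twist with index (j, g)

module Twists {n : ℕ} {x y : SP n} (Bx : Bij x) (By : Bij y) (xy : Comm x y) (c : Pt n)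
              {m : ℕ} (fr : FirstReturn y x c m) {j₀ : ℕ} {f₀ : Bool} (em₀ : iterApp x m c ≡ flip f₀ (iterApp y j₀ c)) where

  C : Pt n → Bool
  C = inCyc y c

  -- Stands for -j₀. It cancels the return exponent of x itself, so that the index j of a twist
  -- becomes the exponent of its own return.
  J : ℕ
  J = j₀ *ℕ (M n ∸ 1)

  opaque
    X : ℕ → Bool → SP n
    X j g = compose x (twist y c (J +ℕ j) (g xor f₀))

    X-Bij : ∀ j g → Bij (X j g)
    X-Bij j g = twisted-Bij By c Bx (J +ℕ j) (g xor f₀)

    X-Comm : ∀ j g → Comm (X j g) y
    X-Comm j g = Comm-sym (twisted-Comm By c Bx (Comm-sym xy) (J +ℕ j) (g xor f₀))

    X-twist : ∀ j g → X j g ≡ compose x (twist y c (J +ℕ j) (g xor f₀))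
    X-twist j g = refl

    app-X : ∀ j g p → app (X j g) p ≡ app x (app (twist y c (J +ℕ j) (g xor f₀)) p)
    app-X j g = app-compose x (twist y c (J +ℕ j) (g xor f₀))

  private
    -- x permutes the cycles of y, so all points of `C` come back to it at the same times.
    C-iter : ∀ l {q} → T (C q) → C (iterApp x l q) ≡ C (iterApp x l c)
    C-iter l {q} h = let (b , s , e) = inCyc⁻ y h in
      trans (sym (flip-invariant {Q = C} (inCyc-neg By c) s (iterApp x l q)))
      (trans (cong C (trans (sym (app-iter-flip x l s q)) (trans (cong (iterApp x l) (sym e)) (iter-Comm xy l b c))))
      (stable-iter {x = y} {C} (inCyc-stable By c) b (iterApp x l c)))

    moved : ℕ → Bool → Pt n → Pt n
    moved j g p = flip (g xor f₀) (iterApp y (J +ℕ j) p)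

    C-moved : ∀ j g {p} → T (C p) → T (C (moved j g p))
    C-moved j g {p} h = subst T (sym (inCyc-flip-iter By c (J +ℕ j) (g xor f₀) p)) h

  -- Before the return at time m the iterates stay off `C`, so the twist acts once only, at the
  -- start.
  X-iter : ∀ j g l → suc l ≤ m → ∀ {p} → T (C p) → iterApp (X j g) (suc l) p ≡ iterApp x (suc l) (flip (g xor f₀) (iterApp y (J +ℕ j) p))
  X-iter j g zero    _  {p} h = trans (app-X j g p) (cong (app x) (twist-in By c (J +ℕ j) (g xor f₀) h))
  X-iter j g (suc l) l< {p} h = trans (cong (app (X j g)) (X-iter j g l (ℕP.<⇒≤ l<) h))
    (trans (app-X j g (iterApp x (suc l) (moved j g p)))
      (cong (app x) (twist-out By c (J +ℕ j) (g xor f₀) (λ k → proj₂ (proj₂ fr) (suc l) (s≤s z≤n) l< (subst T (C-iter (suc l) (C-moved j g h)) k)))))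

  private
    c∈C : T (C c)
    c∈C = inCyc-refl By c

    m≥1 : 1 ≤ m
    m≥1 = proj₁ fr

    m-iter : ∀ j g {p} → T (C p) → iterApp (X j g) m p ≡ iterApp x m (moved j g p)
    m-iter j g {p} h = subst (λ l → l ≤ m → iterApp (X j g) l p ≡ iterApp x l (moved j g p)) (ℕP.m+[n∸m]≡n m≥1)
      (λ le → X-iter j g (m ∸ 1) le h) ℕP.≤-refl

  X-return : ∀ j g → iterApp (X j g) m c ≡ flip g (iterApp y j c)
  X-return j g = trans (m-iter j g c∈C) (trans (app-iter-flip x m (g xor f₀) (iterApp y (J +ℕ j) c))
    (trans (cong (flip (g xor f₀)) (trans (iter-Comm xy m (J +ℕ j) c) (trans (cong (iterApp y (J +ℕ j)) em₀) (trans (app-iter-flip y (J +ℕ j) f₀ (iterApp y j₀ c))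
      (cong (flip f₀) (trans (iter-+ y J j (iterApp y j₀ c)) (trans (cong (iterApp y J) (iter-comm y j j₀ c)) (iter-back By j₀ (iterApp y j c)))))))))
    (trans (flip-xor (g xor f₀) f₀ (iterApp y j c)) (cong (λ s → flip s (iterApp y j c)) (xor-cancel g f₀)))))

  X-first : ∀ j g → FirstReturn y (X j g) c m
  X-first j g = m≥1 , inCyc-trans By (inCyc-iter By j g c) (subst (λ q → T (inCyc y (flip g (iterApp y j c)) q)) (sym (X-return j g)) (inCyc-refl By (flip g (iterApp y j c)))) ,
    λ { (suc l) l≥ l< k → proj₂ (proj₂ fr) (suc l) l≥ l<
      (subst T (trans (cong C (X-iter j g l (ℕP.<⇒≤ l<) c∈C)) (C-iter (suc l) (C-moved j g c∈C))) k) }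

  X-power : ∀ j g q → iterApp (X j g) (q *ℕ m) c ≡ flip (bmul q g) (iterApp y (q *ℕ j) c)
  X-power j g q = iter-power (Comm-sym (X-Comm j g)) {m} {j} {g} {c} (X-return j g) q

  module _ {j j' u : ℕ} {g : Bool} (e : iterApp y j' c ≡ iterApp y (u *ℕ j) c) (eg : bmul u g ≡ g) where

    private
      multiple : ∀ q → iterApp y (q *ℕ j') c ≡ iterApp y (q *ℕ u *ℕ j) c
      multiple q = trans (iter-power Comm-self {j'} {u *ℕ j} {false} {c} e q)
        (trans (cong (λ s → flip s (iterApp y (q *ℕ (u *ℕ j)) c)) (bmul-false q)) (cong (λ a → iterApp y a c) (sym (ℕP.*-assoc q u j))))

      sign : ∀ q → bmul (q *ℕ u) g ≡ bmul q g
      sign q = trans (bmul-* q u g) (cong (bmul q) eg)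

    X-power-scaled : ∀ q → iterApp (X j' g) (q *ℕ m) c ≡ iterApp (X j g) (q *ℕ u *ℕ m) c
    X-power-scaled q = trans (X-power j' g q) (trans (cong₂ flip (sym (sign q)) (multiple q)) (sym (X-power j g (q *ℕ u))))

    -- q̂ + 1 ≡ (q + 1) u modulo M, shifted by M to stay in ℕ
    orbit-scaled : ∀ {p} → T (inOrb (X j' g) c p) → T (inOrb (X j g) c p)
    orbit-scaled {p} h = let (a , ea) = inOrb⁻ (X j' g) h in go (a ℕD./ m) (a ℕD.% m) (ℕD.m%n<n a m)
        (trans (cong (λ t → iterApp (X j' g) t c) (sym (ℕD.m≡m%n+[m/n]*n a m))) ea)
      where
      instance
        nz : NonZero m
        nz = ℕ.>-nonZero m≥1
      go : ∀ q r → r < m → iterApp (X j' g) (r +ℕ q *ℕ m) c ≡ p → T (inOrb (X j g) c p)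
      go q zero    _  ep = inOrb⁺ (X-Bij j g) (q *ℕ u *ℕ m) (trans (sym (X-power-scaled q)) ep)
      -- r + 1 steps after the q-th return the twist has acted q + 1 times, whereas at the return
      -- itself it has acted q times. This is why q + 1 is matched here, and q in the case above.
      go q (suc r) r< ep = inOrb⁺ (X-Bij j g) (suc r +ℕ q̂ *ℕ m) (trans eq ep)
        where
        q̂ : ℕ
        q̂ = suc q *ℕ u +ℕ (M n ∸ 1)
        suc-q̂ : suc q̂ ≡ suc q *ℕ u +ℕ 1 *ℕ M n
        suc-q̂ = trans (sym (ℕP.+-suc (suc q *ℕ u) (M n ∸ 1))) (cong (suc q *ℕ u +ℕ_) (trans (ℕP.m+[n∸m]≡n (M≥1 n)) (sym (ℕP.*-identityˡ (M n)))))
        base : ∀ i s → T (C (flip s (iterApp y i c)))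
        base i s = inCyc-iter By i s c
        step : ∀ i s → iterApp y i (flip (bmul s g) (iterApp y (s *ℕ i) c)) ≡ flip (bmul s g) (iterApp y (suc s *ℕ i) c)
        step i s = trans (app-iter-flip y i (bmul s g) (iterApp y (s *ℕ i) c)) (cong (flip (bmul s g)) (sym (iter-+ y i (s *ℕ i) c)))
        same-sgn : bmul q̂ g ≡ bmul q g
        same-sgn = trans (sym (xor-cancelˡ g (bmul q̂ g))) (trans (cong (g xor_) (trans (cong (λ a → bmul a g) suc-q̂)
          (trans (bmul-+ (suc q *ℕ u) (1 *ℕ M n) g) (trans (cong₂ _xor_ (sign (suc q)) (trans (cong (λ a → bmul a g) (ℕP.*-identityˡ (M n))) (bmul-M n g))) (BP.xor-identityʳ (bmul (suc q) g))))))
          (xor-cancelˡ g (bmul q g)))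
        same-pt : iterApp y (suc q̂ *ℕ j) c ≡ iterApp y (suc q *ℕ j') c
        same-pt = trans (cong (λ a → iterApp y a c) (trans (cong (_*ℕ j) suc-q̂) (trans (ℕP.*-distribʳ-+ j (suc q *ℕ u) (1 *ℕ M n)) (cong (suc q *ℕ u *ℕ j +ℕ_) (trans (ℕP.*-assoc 1 (M n) j) (trans (ℕP.*-identityˡ (M n *ℕ j)) (ℕP.*-comm (M n) j)))))))
          (trans (iter-M-cancel By (suc q *ℕ u *ℕ j) j c) (sym (multiple (suc q))))
        eq : iterApp (X j g) (suc r +ℕ q̂ *ℕ m) c ≡ iterApp (X j' g) (suc r +ℕ q *ℕ m) c
        eq = trans (iter-+ (X j g) (suc r) (q̂ *ℕ m) c) (trans (cong (iterApp (X j g) (suc r)) (X-power j g q̂))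
          (trans (X-iter j g r (ℕP.<⇒≤ r<) (base (q̂ *ℕ j) (bmul q̂ g)))
          (trans (cong (λ p → iterApp x (suc r) (flip (g xor f₀) p)) mid)
          (sym (trans (iter-+ (X j' g) (suc r) (q *ℕ m) c) (trans (cong (iterApp (X j' g) (suc r)) (X-power j' g q)) (X-iter j' g r (ℕP.<⇒≤ r<) (base (q *ℕ j') (bmul q g)))))))))
          where
          mid : iterApp y (J +ℕ j) (flip (bmul q̂ g) (iterApp y (q̂ *ℕ j) c)) ≡ iterApp y (J +ℕ j') (flip (bmul q g) (iterApp y (q *ℕ j') c))
          mid = trans (iter-+ y J j (flip (bmul q̂ g) (iterApp y (q̂ *ℕ j) c))) (trans (cong (iterApp y J) (trans (step j q̂) (trans (cong₂ flip same-sgn same-pt) (sym (step j' q)))))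
            (sym (iter-+ y J j' (flip (bmul q g) (iterApp y (q *ℕ j') c)))))

-- Parity of the number of negative values

⊕ : ∀ {A : Set} → List A → (A → Bool) → Bool
⊕ xs f = foldr (λ a r → f a xor r) false xs

module _ {A : Set} where

  xor-interchange : ∀ a b c d → (a xor b) xor (c xor d) ≡ (a xor c) xor (b xor d)
  xor-interchange a b c d = trans (BP.xor-assoc a b (c xor d)) (trans (cong (a xor_) (trans (sym (BP.xor-assoc b c d))
    (trans (cong (_xor d) (BP.xor-comm b c)) (BP.xor-assoc c b d)))) (sym (BP.xor-assoc a c (b xor d))))

  ⊕-cong : ∀ (xs : List A) {f g} → (∀ x → f x ≡ g x) → ⊕ xs f ≡ ⊕ xs g
  ⊕-cong []       h = refl
  ⊕-cong (x ∷ xs) h = cong₂ _xor_ (h x) (⊕-cong xs h)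

  ⊕-xor : ∀ (xs : List A) f g → ⊕ xs (λ x → f x xor g x) ≡ ⊕ xs f xor ⊕ xs g
  ⊕-xor []       f g = refl
  ⊕-xor (x ∷ xs) f g = trans (cong ((f x xor g x) xor_) (⊕-xor xs f g)) (xor-interchange (f x) (g x) (⊕ xs f) (⊕ xs g))

  ⊕-↭ : ∀ {xs ys : List A} f → xs ↭ ys → ⊕ xs f ≡ ⊕ ys f
  ⊕-↭ f ↭.refl = refl
  ⊕-↭ f (prep x p) = cong (f x xor_) (⊕-↭ f p)
  ⊕-↭ {_ ∷ _ ∷ xs} {_ ∷ _ ∷ ys} f (swap x y p) = trans (sym (BP.xor-assoc (f x) (f y) (⊕ xs f)))
    (trans (cong₂ _xor_ (BP.xor-comm (f x) (f y)) (⊕-↭ f p)) (BP.xor-assoc (f y) (f x) (⊕ ys f)))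
  ⊕-↭ f (↭.trans p q) = trans (⊕-↭ f p) (⊕-↭ f q)

  ⊕-filter : ∀ (b : A → Bool) xs f → ⊕ (boolFilter b xs) f ≡ ⊕ xs (λ x → if b x then f x else false)
  ⊕-filter b []       f = refl
  ⊕-filter b (x ∷ xs) f with b x
  ... | true  = cong (f x xor_) (⊕-filter b xs f)
  ... | false = ⊕-filter b xs f

  ⊕-false : ∀ (xs : List A) → ⊕ xs (λ _ → false) ≡ false
  ⊕-false []       = refl
  ⊕-false (x ∷ xs) = ⊕-false xs

  evenb-suc : ∀ m → evenb (suc m) ≡ not (evenb m)
  evenb-suc zero          = refl
  evenb-suc (suc zero)    = refl
  evenb-suc (suc (suc m)) = evenb-suc m

  evenb-filter : ∀ (f : A → Bool) xs → evenb (length (boolFilter f xs)) ≡ not (⊕ xs f)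
  evenb-filter f []       = refl
  evenb-filter f (x ∷ xs) with f x
  ... | true  = trans (evenb-suc (length (boolFilter f xs))) (cong not (evenb-filter f xs))
  ... | false = evenb-filter f xs

  ⊕-toList : ∀ {B : Set} {n} (v : Vec A n) (h : A → Bool) (f : Fin n → B) (g : B → Bool) →
    (∀ i → g (f i) ≡ h (lookup v i)) → ⊕ (toList v) h ≡ ⊕ (L.tabulate f) g
  ⊕-toList []      h f g e = refl
  ⊕-toList (a ∷ v) h f g e = cong₂ _xor_ (sym (e F.zero)) (⊕-toList v h (f ∘ F.suc) g (e ∘ F.suc))

⊕-map : ∀ {A B : Set} (k : A → B) xs f → ⊕ (L.map k xs) f ≡ ⊕ xs (f ∘ k)
⊕-map k []       f = refl
⊕-map k (x ∷ xs) f = cong (f (k x) xor_) (⊕-map k xs f)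

module _ {n : ℕ} where

  -- The sign character δ, written additively.
  parity : SP n → Bool
  parity x = ⊕ (allFin n) (λ i → proj₂ (lookup x i))

  evenb-negCount : ∀ (x : SP n) → evenb (negCount x) ≡ not (parity x)
  evenb-negCount x = trans (evenb-filter proj₂ (toList x)) (cong not (⊕-toList x proj₂ id (λ i → proj₂ (lookup x i)) (λ _ → refl)))

  parity-id : parity (idB n) ≡ false
  parity-id = trans (⊕-cong (allFin n) (λ i → cong proj₂ (VP.lookup∘tabulate (λ i → (i , false)) i))) (⊕-false (allFin n))

  -- The sign of the product at i is that of z at i plus that of x at `index z i`, and `index z`
  -- permutes the indices.
  parity-compose : ∀ {x z : SP n} → Bij z → parity (compose x z) ≡ parity z xor parity x
  parity-compose {x} {z} Bz = trans (⊕-cong (allFin n) (λ i → cong proj₂ (VP.lookup-map i (app x) z)))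
    (trans (⊕-xor (allFin n) (λ i → proj₂ (lookup z i)) (λ i → proj₂ (lookup x (index z i)))) (cong (parity z xor_)
      (trans (sym (⊕-map (index z) (allFin n) (λ i → proj₂ (lookup x i)))) (⊕-↭ (λ i → proj₂ (lookup x i)) perm))))
    where
    perm : L.map (index z) (allFin n) ↭ allFin n
    perm = unique⇒↭ (map-unique (index z) (UP.allFin⁺ n) (λ _ _ → surjective⇒injective (index z) (Bij⇒onto z Bz))) (UP.allFin⁺ n)
      (λ {i} _ → ∈P.∈-allFin i)
      (λ {i} _ → let (j , e) = Bij⇒onto z Bz i in subst (_∈ L.map (index z) (allFin n)) e (∈P.∈-map⁺ (index z) (∈P.∈-allFin j)))

  parity-powN : ∀ {x : SP n} → Bij x → ∀ a → parity (powN x a) ≡ bmul a (parity x)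
  parity-powN B zero    = parity-id
  parity-powN {x} B (suc a) = trans (parity-compose {x} {powN x a} (Bij-powN B a)) (trans (BP.xor-comm (parity (powN x a)) (parity x)) (cong (parity x xor_) (parity-powN B a)))

  lookup-restrict : ∀ (x : SP n) Q i → lookup (restrict x Q) i ≡ patch Q (app x) (i , false)
  lookup-restrict x Q i = VP.lookup∘tabulate (λ i → patch Q (app x) (i , false)) i

  parity-restrict : ∀ (x : SP n) Q → parity (restrict x Q) ≡ ⊕ (allFin n) (λ i → if Q (i , false) then proj₂ (lookup x i) else false)
  parity-restrict x Q = ⊕-cong (allFin n) (λ i → trans (cong proj₂ (lookup-restrict x Q i)) (go i (Q (i , false))))
    where
    go : ∀ i b → proj₂ (if b then app x (i , false) else (i , false)) ≡ (if b then proj₂ (lookup x i) else false)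
    go i true  = refl
    go i false = refl

  parity-disjoint : ∀ (x : SP n) Q R → (∀ p → T (Q p) → ¬ T (R p)) →
    parity (restrict x (λ p → Q p ∨ R p)) ≡ parity (restrict x Q) xor parity (restrict x R)
  parity-disjoint x Q R dis = trans (parity-restrict x (λ p → Q p ∨ R p)) (trans
      (⊕-cong (allFin n) (λ i → go (Q (i , false)) (R (i , false)) (proj₂ (lookup x i)) (dis (i , false))))
      (trans (⊕-xor (allFin n) (λ i → if Q (i , false) then proj₂ (lookup x i) else false) (λ i → if R (i , false) then proj₂ (lookup x i) else false))
        (cong₂ _xor_ (sym (parity-restrict x Q)) (sym (parity-restrict x R)))))
    where
    go : ∀ q r s → (T q → ¬ T r) → (if q ∨ r then s else false) ≡ (if q then s else false) xor (if r then s else false)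
    go true  true  s d = ⊥-elim (d tt tt)
    go true  false s d = sym (BP.xor-identityʳ s)
    go false r     s d = refl

  -- The signs along a cycle telescope.
  parity-cycle : ∀ {x : SP n} → Bij x → ∀ c → parity (restrict x (inCyc x c)) ≡ isNegCls x c
  parity-cycle {x} Bx c = trans (parity-restrict x (inCyc x c)) (trans (sym (⊕-filter (λ i → inCyc x c (i , false)) (allFin n) (λ i → proj₂ (lookup x i))))
      (trans (⊕-↭ (λ i → proj₂ (lookup x i)) perm) (trans (telescope ℓ) (trans (cong (_xor proj₂ c) (cong proj₂ xℓ)) (trans (xor-cancel s (proj₂ c)) s≡)))))
    where
    idx : ℕ → Fin n
    idx a = proj₁ (iterApp x a c)
    Return : ℕ → Set
    Return a = idx a ≡ proj₁ c
    same⇒flip : ∀ (p q : Pt n) → proj₁ p ≡ proj₁ q → p ≡ flip (proj₂ p xor proj₂ q) q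
    same⇒flip (i , a) (.i , b) refl = cong (i ,_) (sym (xor-cancel a b))
    -- ℓ is the first return to the index of c with either sign; the iterates before it list the
    -- indices of the cycle once each, and the sign s at time ℓ is the class.
    found : ∃ (IsLeast Return)
    found = leastPositive (λ a → idx a ≟ᶠ proj₁ c) (M n) (M≥1 n) (cong proj₁ (iter-M Bx c))
    ℓ : ℕ
    ℓ = proj₁ found
    isℓ : IsLeast Return ℓ
    isℓ = proj₂ found
    s : Bool
    s = proj₂ (iterApp x ℓ c) xor proj₂ c
    xℓ : iterApp x ℓ c ≡ flip s c
    xℓ = same⇒flip (iterApp x ℓ c) c (proj₁ (proj₂ isℓ))
    instance
      nz : NonZero ℓ
      nz = ℕ.>-nonZero (proj₁ isℓ)
    reduce : ∀ a → iterApp x a c ≡ flip (bmul (a ℕD./ ℓ) s) (iterApp x (a ℕD.% ℓ) c)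
    reduce a = trans (cong (λ b → iterApp x b c) (ℕD.m≡m%n+[m/n]*n a ℓ)) (trans (iter-+ x (a ℕD.% ℓ) (a ℕD./ ℓ *ℕ ℓ) c)
      (trans (cong (iterApp x (a ℕD.% ℓ)) (iter-flip-power {y = x} {ℓ} {s} {c} xℓ (a ℕD./ ℓ))) (app-iter-flip x (a ℕD.% ℓ) (bmul (a ℕD./ ℓ) s) c)))
    s≡ : s ≡ isNegCls x c
    s≡ = T-ext (λ t → inOrb⁺ Bx ℓ (trans xℓ (cong (λ b → flip b c) (T⇒≡ t)))) (λ t → from (isNegCls⁻ {x = x} {c} t))
      where
      from : (∃ λ a → iterApp x a c ≡ neg c) → T s
      from (a , e) = zero-rem (a ℕD.% ℓ) (ℕD.m%n<n a ℓ) refl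
        where
        red : flip (bmul (a ℕD./ ℓ) s) (iterApp x (a ℕD.% ℓ) c) ≡ neg c
        red = trans (sym (reduce a)) e
        zero-rem : ∀ r → r < ℓ → a ℕD.% ℓ ≡ r → T s
        zero-rem zero    _ er = nonzero s (λ es → flip≢ (sym (trans (sym (cong (λ r → flip false (iterApp x r c)) er)) (trans (cong (λ b → flip b (iterApp x (a ℕD.% ℓ) c)) (sym (trans (cong (bmul (a ℕD./ ℓ)) es) (bmul-false (a ℕD./ ℓ))))) red))))
          where
          nonzero : ∀ s → s ≢ false → T s
          nonzero true  _ = tt
          nonzero false h = h refl
        zero-rem (suc r) r< er = ⊥-elim (proj₂ (proj₂ isℓ) (suc r) (s≤s z≤n) r< (trans (cong idx (sym er)) (cong proj₁ red)))
    distinct : ∀ {a b} → a < b → b < ℓ → idx a ≢ idx b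
    distinct {a} {b} a<b b<ℓ e = proj₂ (proj₂ isℓ) (b ∸ a) (ℕP.m<n⇒0<n∸m a<b) (ℕP.≤-<-trans (ℕP.m∸n≤m b a) b<ℓ)
        (cong proj₁ (iter-inj Bx a (trans (sym (iter-+ x a (b ∸ a) c)) (trans (cong (λ k → iterApp x k c) (ℕP.m+[n∸m]≡n (ℕP.<⇒≤ a<b)))
          (trans (same⇒flip (iterApp x b c) (iterApp x a c) (sym e)) (sym (app-iter-flip x a (proj₂ (iterApp x b c) xor proj₂ (iterApp x a c)) c)))))))
    perm : boolFilter (λ i → inCyc x c (i , false)) (allFin n) ↭ applyUpTo idx ℓ
    perm = unique⇒↭ (boolFilter-unique _ (UP.allFin⁺ n)) (UP.applyUpTo⁺₁ idx ℓ distinct) to from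
      where
      to : ∀ {i} → i ∈ boolFilter (λ i → inCyc x c (i , false)) (allFin n) → i ∈ applyUpTo idx ℓ
      to {i} h with inCyc⁻ x (proj₂ (∈-boolFilter⁻ (λ i → inCyc x c (i , false)) (allFin n) h))
      ... | a , t , e = subst (_∈ applyUpTo idx ℓ) (trans (sym (cong proj₁ (reduce a))) (cong proj₁ e)) (∈P.∈-applyUpTo⁺ idx (ℕD.m%n<n a ℓ))
      from : ∀ {i} → i ∈ applyUpTo idx ℓ → i ∈ boolFilter (λ i → inCyc x c (i , false)) (allFin n)
      from {i} h with ∈P.∈-applyUpTo⁻ idx h
      ... | a , _ , e = ∈-boolFilter⁺ (λ i → inCyc x c (i , false)) (∈P.∈-allFin i)
        (inCyc⁺ Bx a (proj₂ (iterApp x a c) xor false) (same⇒flip (iterApp x a c) (i , false) (sym e)))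
    snoc : ∀ (xs : List (Fin n)) a (f : Fin n → Bool) → ⊕ (xs ++ a ∷ []) f ≡ ⊕ xs f xor f a
    snoc []       a f = BP.xor-identityʳ (f a)
    snoc (x ∷ xs) a f = trans (cong (f x xor_) (snoc xs a f)) (sym (BP.xor-assoc (f x) (⊕ xs f) (f a)))
    telescope : ∀ l → ⊕ (applyUpTo idx l) (λ i → proj₂ (lookup x i)) ≡ proj₂ (iterApp x l c) xor proj₂ c
    telescope zero    = sym (BP.xor-same (proj₂ c))
    telescope (suc l) = trans (cong (λ xs → ⊕ xs (λ i → proj₂ (lookup x i))) (sym (LP.applyUpTo-∷ʳ idx l)))
      (trans (snoc (applyUpTo idx l) (idx l) (λ i → proj₂ (lookup x i))) (trans (cong (_xor v) (telescope l))
      (trans (BP.xor-assoc u (proj₂ c) v) (trans (cong (u xor_) (BP.xor-comm (proj₂ c) v)) (sym (BP.xor-assoc u v (proj₂ c)))))))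
      where
      u v : Bool
      u = proj₂ (iterApp x l c)
      v = proj₂ (lookup x (idx l))

-- Exponents may be taken in ℕ, as all elements of B_n have order dividing M n.

module _ {n : ℕ} where

  natural : ℤ → ℕ
  natural (+ m)    = m
  natural -[1+ m ] = suc m *ℕ (M n ∸ 1)

  powZ≡powN : ∀ {x : SP n} → Bij x → ∀ k → powZ x k ≡ powN x (natural k)
  powZ≡powN Bx (+ m) = refl
  powZ≡powN {x} Bx -[1+ m ] = app-ext λ p → trans (app-powN (inv x) (suc m) p) (trans (go (suc m) p) (sym (app-powN x (suc m *ℕ (M n ∸ 1)) p)))
    where
    inv-power : ∀ q → app (inv x) q ≡ iterApp x (M n ∸ 1) q
    inv-power q = Bij⇒Inj Bx (trans (app-invʳ x Bx q) (sym (trans (cong (λ a → iterApp x a q) (ℕP.m+[n∸m]≡n (M≥1 n))) (iter-M Bx q))))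
    go : ∀ a p → iterApp (inv x) a p ≡ iterApp x (a *ℕ (M n ∸ 1)) p
    go zero    p = refl
    go (suc a) p = trans (inv-power (iterApp (inv x) a p)) (trans (cong (iterApp x (M n ∸ 1)) (go a p)) (sym (iter-+ x (M n ∸ 1) (a *ℕ (M n ∸ 1)) p)))

-- Sums over lists

module Sums {c ℓ} (K : CZField c ℓ) where
  open CZField K renaming (refl to ≈-refl; sym to ≈-sym; trans to ≈-trans; zero to *-zero)
  open Chars K
  open import Relation.Binary.Reasoning.Setoid setoid

  ≡⇒≈ : ∀ {a b} → a ≡ b → a ≈ b
  ≡⇒≈ refl = ≈-refl

  +-interchange : ∀ a b c d → (a + b) + (c + d) ≈ (a + c) + (b + d)
  +-interchange a b c d = begin
    (a + b) + (c + d) ≈⟨ +-assoc a b (c + d) ⟩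
    a + (b + (c + d)) ≈⟨ +-congˡ (+-assoc b c d) ⟨
    a + ((b + c) + d) ≈⟨ +-congˡ (+-congʳ (+-comm b c)) ⟩
    a + ((c + b) + d) ≈⟨ +-congˡ (+-assoc c b d) ⟩
    a + (c + (b + d)) ≈⟨ +-assoc a c (b + d) ⟨
    (a + c) + (b + d) ∎

  +-cancelˡ : ∀ a {b c} → a + b ≈ a + c → b ≈ c
  +-cancelˡ a {b} {c} e = begin
    b               ≈⟨ +-identityˡ b ⟨
    0# + b          ≈⟨ +-congʳ (-‿inverseˡ a) ⟨
    (- a + a) + b   ≈⟨ +-assoc (- a) a b ⟩
    - a + (a + b)   ≈⟨ +-congˡ e ⟩
    - a + (a + c)   ≈⟨ +-assoc (- a) a c ⟨
    (- a + a) + c   ≈⟨ +-congʳ (-‿inverseˡ a) ⟩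
    0# + c          ≈⟨ +-identityˡ c ⟩
    c               ∎

  +-cancelʳ : ∀ a {b c} → b + a ≈ c + a → b ≈ c
  +-cancelʳ a {b} {c} e = +-cancelˡ a (≈-trans (+-comm a b) (≈-trans e (+-comm c a)))

  unit-cancel : ∀ {a a⁻¹} → a * a⁻¹ ≈ 1# → ∀ {b c} → a * b ≈ a * c → b ≈ c
  unit-cancel {a} {a⁻¹} h {b} {c} e = ≈-trans (≈-sym (go b)) (≈-trans (*-congˡ e) (go c))
    where
    go : ∀ b → a⁻¹ * (a * b) ≈ b
    go b = ≈-trans (≈-sym (*-assoc a⁻¹ a b)) (≈-trans (*-congʳ (≈-trans (*-comm a⁻¹ a) h)) (*-identityˡ b))

  -- (w - 1) s = 0 with w - 1 invertible. It serves for sums that a shift of the index multiplies by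
  -- a root of unity other than 1.
  fixed⇒zero : ∀ {w s} → ¬ w ≈ 1# → w * s ≈ s → s ≈ 0#
  fixed⇒zero {w} {s} w≉1 e = unit-cancel (proj₂ (inverse (w + - 1#) nz)) (begin
    (w + - 1#) * s         ≈⟨ distribʳ s w (- 1#) ⟩
    w * s + - 1# * s       ≈⟨ +-congʳ (≈-trans e (≈-sym (*-identityˡ s))) ⟩
    1# * s + - 1# * s      ≈⟨ distribʳ s 1# (- 1#) ⟨
    (1# + - 1#) * s        ≈⟨ *-congʳ (-‿inverseʳ 1#) ⟩
    0# * s                 ≈⟨ zeroˡ s ⟩
    0#                     ≈⟨ zeroʳ (w + - 1#) ⟨
    (w + - 1#) * 0#        ∎)
    where
    nz : ¬ w + - 1# ≈ 0#
    nz h = w≉1 (+-cancelʳ (- 1#) (≈-trans h (≈-sym (-‿inverseʳ 1#))))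

  ι-+ : ∀ a b → ι (a +ℕ b) ≈ ι a + ι b
  ι-+ zero    b = ≈-sym (+-identityˡ _)
  ι-+ (suc a) b = ≈-trans (+-congˡ (ι-+ a b)) (≈-sym (+-assoc _ _ _))

  ι-* : ∀ a b → ι (a *ℕ b) ≈ ι a * ι b
  ι-* zero    b = ≈-sym (zeroˡ _)
  ι-* (suc a) b = begin
    ι (b +ℕ a *ℕ b)     ≈⟨ ι-+ b (a *ℕ b) ⟩
    ι b + ι (a *ℕ b)    ≈⟨ +-cong (≈-sym (*-identityˡ _)) (ι-* a b) ⟩
    1# * ι b + ι a * ι b ≈⟨ distribʳ (ι b) 1# (ι a) ⟨
    (1# + ι a) * ι b     ∎

  recip-inverse : ∀ {m} → 1 ≤ m → recip m * ι m ≈ 1#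
  recip-inverse {suc m} _ = ≈-trans (*-comm _ _) (proj₂ (inverse (ι (suc m)) (char0 m)))

  ι-cancel : ∀ {m} → 1 ≤ m → ∀ {a b} → ι m * a ≈ ι m * b → a ≈ b
  ι-cancel {m} l = unit-cancel (≈-trans (*-comm _ _) (recip-inverse l))

  ifK : Bool → Carrier → Carrier
  ifK b a = if b then a else 0#

  ifK-true : ∀ {b a} → T b → ifK b a ≈ a
  ifK-true {true} _ = ≈-refl

  ifK-false : ∀ {b a} → ¬ T b → ifK b a ≈ 0#
  ifK-false {false} _ = ≈-refl
  ifK-false {true}  h = ⊥-elim (h tt)

  ifK-cong : ∀ {b b' a a'} → b ≡ b' → (T b → a ≈ a') → ifK b a ≈ ifK b' a'
  ifK-cong {true}  refl h = h tt
  ifK-cong {false} refl h = ≈-refl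

  ifK-*ˡ : ∀ b k a → k * ifK b a ≈ ifK b (k * a)
  ifK-*ˡ true  k a = ≈-refl
  ifK-*ˡ false k a = zeroʳ k

  ifK-≢ : ∀ {n} (p q : Pt n) a → p ≢ q → ifK (eqPt p q) a ≈ 0#
  ifK-≢ p q a ne = ifK-false {eqPt p q} {a} (λ t → ne (eqPt⇒≡ {p = p} {q} t))

  -- `sgn b` is the trivial character for ε = 1 and the sign character for ε = w₀.
  sgn : Bool → Bool → Carrier
  sgn b s = if b ∧ s then - 1# else 1#

  ifK-swap : ∀ b b' a → ifK b (ifK b' a) ≈ ifK b' (ifK b a)
  ifK-swap true  b'    a = ≈-refl
  ifK-swap false true  a = ≈-refl
  ifK-swap false false a = ≈-refl

  ifK-∧ : ∀ r e a b → ifK (r ∧ e) (a * b) ≈ ifK r a * ifK e b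
  ifK-∧ true  true  a b = ≈-refl
  ifK-∧ true  false a b = ≈-sym (zeroʳ a)
  ifK-∧ false e     a b = ≈-sym (zeroˡ _)

  module _ {A : Set} where

    Σl-cong : ∀ (xs : List A) {f g} → (∀ {x} → x ∈ xs → f x ≈ g x) → Σl xs f ≈ Σl xs g
    Σl-cong []       h = ≈-refl
    Σl-cong (x ∷ xs) h = +-cong (h (here refl)) (Σl-cong xs (h ∘ there))

    Σl-+ : ∀ (xs : List A) f g → Σl xs (λ x → f x + g x) ≈ Σl xs f + Σl xs g
    Σl-+ []       f g = ≈-sym (+-identityˡ 0#)
    Σl-+ (x ∷ xs) f g = ≈-trans (+-congˡ (Σl-+ xs f g)) (+-interchange _ _ _ _)

    Σl-*ˡ : ∀ (xs : List A) k f → Σl xs (λ x → k * f x) ≈ k * Σl xs f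
    Σl-*ˡ []       k f = ≈-sym (zeroʳ k)
    Σl-*ˡ (x ∷ xs) k f = ≈-trans (+-congˡ (Σl-*ˡ xs k f)) (≈-sym (distribˡ k _ _))

    Σl-0 : ∀ (xs : List A) {f} → (∀ {x} → x ∈ xs → f x ≈ 0#) → Σl xs f ≈ 0#
    Σl-0 []       h = ≈-refl
    Σl-0 (x ∷ xs) h = ≈-trans (+-cong (h (here refl)) (Σl-0 xs (h ∘ there))) (+-identityˡ 0#)

    ifK-Σl : ∀ b (xs : List A) f → ifK b (Σl xs f) ≈ Σl xs (λ x → ifK b (f x))
    ifK-Σl true  xs f = ≈-refl
    ifK-Σl false xs f = ≈-sym (Σl-0 xs (λ _ → ≈-refl))

    Σl-const : ∀ (xs : List A) k → Σl xs (λ _ → k) ≈ ι (length xs) * k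
    Σl-const []       k = ≈-sym (zeroˡ k)
    Σl-const (x ∷ xs) k = ≈-trans (+-cong (≈-sym (*-identityˡ k)) (Σl-const xs k)) (≈-sym (distribʳ k 1# _))

    Σl-filter : ∀ (b : A → Bool) xs f → Σl (boolFilter b xs) f ≈ Σl xs (λ x → if b x then f x else 0#)
    Σl-filter b []       f = ≈-refl
    Σl-filter b (x ∷ xs) f with b x
    ... | true  = +-congˡ (Σl-filter b xs f)
    ... | false = ≈-trans (Σl-filter b xs f) (≈-sym (+-identityˡ _))

    Σl-count : ∀ (b : A → Bool) xs → Σl xs (λ x → if b x then 1# else 0#) ≈ ι (length (boolFilter b xs))
    Σl-count b xs = ≈-trans (≈-sym (Σl-filter b xs (λ _ → 1#))) (≈-trans (Σl-const (boolFilter b xs) 1#) (*-identityʳ _))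

    Σl-↭ : ∀ {xs ys : List A} f → xs ↭ ys → Σl xs f ≈ Σl ys f
    Σl-↭ f ↭.refl = ≈-refl
    Σl-↭ f (prep x p) = +-congˡ (Σl-↭ f p)
    Σl-↭ f (swap x y p) = ≈-trans (≈-sym (+-assoc _ _ _)) (≈-trans (+-cong (+-comm (f x) (f y)) (Σl-↭ f p)) (+-assoc _ _ _))
    Σl-↭ f (↭.trans p q) = ≈-trans (Σl-↭ f p) (Σl-↭ f q)

    Σl-single : ∀ {xs : List A} → Unique xs → ∀ {a f} → a ∈ xs → (∀ {x} → x ∈ xs → x ≢ a → f x ≈ 0#) → Σl xs f ≈ f a
    Σl-single {x ∷ xs} (p ∷ u) (here refl) h = ≈-trans (+-congˡ (Σl-0 xs λ m → h (there m) (λ e → All.lookup p m (sym e)))) (+-identityʳ _)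
    Σl-single {x ∷ xs} (p ∷ u) (there m) h = ≈-trans (+-cong (h (here refl) (All.lookup p m)) (Σl-single u m (h ∘ there))) (+-identityˡ _)

    -- All other summands cancel. This is the inversion step in `stratum-unique`.
    Σl-isolate : ∀ {xs : List A} → Unique xs → ∀ {a f g} → a ∈ xs → (∀ {x} → x ∈ xs → x ≢ a → f x ≈ g x) → Σl xs f ≈ Σl xs g → f a ≈ g a
    Σl-isolate {x ∷ xs} (p ∷ u) {a} {f} {g} (here refl) h e =
      +-cancelʳ (Σl xs f) (≈-trans e (+-congˡ (Σl-cong xs λ m → ≈-sym (h (there m) (λ e → All.lookup p m (sym e))))))
    Σl-isolate {x ∷ xs} (p ∷ u) {a} {f} {g} (there m) h e =
      Σl-isolate u m (h ∘ there) (+-cancelˡ (f x) (≈-trans e (+-congʳ (≈-sym (h (here refl) (All.lookup p m))))))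

  Σl-swap : ∀ {A B : Set} (xs : List A) (ys : List B) (f : A → B → Carrier) → Σl xs (λ x → Σl ys (f x)) ≈ Σl ys (λ y → Σl xs (λ x → f x y))
  Σl-swap []       ys f = ≈-sym (Σl-0 ys (λ _ → ≈-refl))
  Σl-swap (x ∷ xs) ys f = ≈-trans (+-congˡ (Σl-swap xs ys f)) (≈-sym (Σl-+ ys (f x) (λ y → Σl xs (λ x → f x y))))

  Σl-map : ∀ {A B : Set} (h : A → B) xs f → Σl (L.map h xs) f ≈ Σl xs (f ∘ h)
  Σl-map h []       f = ≈-refl
  Σl-map h (x ∷ xs) f = +-congˡ (Σl-map h xs f)

  Σl-bijection : ∀ {A B : Set} {xs : List A} {ys : List B} → Unique xs → Unique ys → (h : A → B) (k : B → A) →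
    (∀ {x} → x ∈ xs → h x ∈ ys) → (∀ {y} → y ∈ ys → k y ∈ xs) →
    (∀ {x} → x ∈ xs → k (h x) ≡ x) → (∀ {y} → y ∈ ys → h (k y) ≡ y) → ∀ f → Σl xs (f ∘ h) ≈ Σl ys f
  Σl-bijection {xs = xs} {ys} u v h k hm km kh hk f = ≈-trans (≈-sym (Σl-map h xs f)) (Σl-↭ f (unique⇒↭
    (map-unique h u λ m m' e → trans (sym (kh m)) (trans (cong k e) (kh m'))) v
    (λ m → let (x , m' , e) = ∈P.∈-map⁻ h m in subst (_∈ ys) (sym e) (hm m'))
    (λ m → subst (_∈ L.map h xs) (hk m) (∈P.∈-map⁺ h (km m)))))

  Σ< : ℕ → (ℕ → Carrier) → Carrier
  Σ< N = Σl (upTo N)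

  Σ<-cong : ∀ N {f g} → (∀ j → f j ≈ g j) → Σ< N f ≈ Σ< N g
  Σ<-cong N h = Σl-cong (upTo N) (λ {j} _ → h j)

  Σ<-first : ∀ N f → Σ< (suc N) f ≈ f 0 + Σ< N (f ∘ suc)
  Σ<-first N f = +-congˡ (≈-trans (≡⇒≈ (cong (λ xs → Σl xs f) (sym (LP.map-upTo suc N)))) (Σl-map suc (upTo N) f))

  Σ<-last : ∀ N f → Σ< (suc N) f ≈ Σ< N f + f N
  Σ<-last N f = ≈-trans (≡⇒≈ (cong (λ xs → Σl xs f) (sym (LP.upTo-∷ʳ N)))) (snoc (upTo N))
    where
    snoc : ∀ xs → Σl (xs ++ N ∷ []) f ≈ Σl xs f + f N
    snoc []       = +-comm _ _
    snoc (x ∷ xs) = ≈-trans (+-congˡ (snoc xs)) (≈-sym (+-assoc _ _ _))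

  Periodic : ℕ → (ℕ → Carrier) → Set ℓ
  Periodic N f = ∀ j → f (N +ℕ j) ≈ f j

  -- A sum of N + 1 consecutive terms may lose its first or its last term, and by periodicity these
  -- are equal.
  Σ<-shift : ∀ N f → Periodic N f → ∀ a → Σ< N (λ j → f (a +ℕ j)) ≈ Σ< N f
  Σ<-shift N f per zero    = ≈-refl
  Σ<-shift N f per (suc a) = ≈-trans step (Σ<-shift N f per a)
    where
    rot : ∀ j → a +ℕ (N +ℕ j) ≡ N +ℕ (a +ℕ j)
    rot j = trans (sym (ℕP.+-assoc a N j)) (trans (cong (_+ℕ j) (ℕP.+-comm a N)) (ℕP.+-assoc N a j))
    step : Σ< N (λ j → f (suc a +ℕ j)) ≈ Σ< N (λ j → f (a +ℕ j))
    step = +-cancelˡ (f (a +ℕ 0)) (begin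
      f (a +ℕ 0) + Σ< N (λ j → f (suc a +ℕ j))          ≈⟨ +-congˡ (Σ<-cong N (λ j → ≡⇒≈ (cong f (sym (ℕP.+-suc a j))))) ⟩
      f (a +ℕ 0) + Σ< N (λ j → f (a +ℕ suc j))          ≈⟨ Σ<-first N (λ j → f (a +ℕ j)) ⟨
      Σ< (suc N) (λ j → f (a +ℕ j))                     ≈⟨ Σ<-last N (λ j → f (a +ℕ j)) ⟩
      Σ< N (λ j → f (a +ℕ j)) + f (a +ℕ N)              ≈⟨ +-congˡ (≈-trans (≡⇒≈ (cong (λ t → f (a +ℕ t)) (sym (ℕP.+-identityʳ N)))) (≈-trans (≡⇒≈ (cong f (rot 0))) (per (a +ℕ 0)))) ⟩
      Σ< N (λ j → f (a +ℕ j)) + f (a +ℕ 0)              ≈⟨ +-comm _ _ ⟩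
      f (a +ℕ 0) + Σ< N (λ j → f (a +ℕ j))              ∎)

  powK-cong : ∀ {a b} → a ≈ b → ∀ s → powK a s ≈ powK b s
  powK-cong e zero    = ≈-refl
  powK-cong e (suc s) = *-cong e (powK-cong e s)

  powK-+ : ∀ a s t → powK a (s +ℕ t) ≈ powK a s * powK a t
  powK-+ a zero    t = ≈-sym (*-identityˡ _)
  powK-+ a (suc s) t = ≈-trans (*-congˡ (powK-+ a s t)) (≈-sym (*-assoc _ _ _))

  powK-* : ∀ a s t → powK a (s *ℕ t) ≈ powK (powK a t) s
  powK-* a zero    t = ≈-refl
  powK-* a (suc s) t = ≈-trans (powK-+ a t (s *ℕ t)) (*-congˡ (powK-* a s t))

  powK-1 : ∀ s → powK 1# s ≈ 1#
  powK-1 zero    = ≈-refl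
  powK-1 (suc s) = ≈-trans (*-identityˡ _) (powK-1 s)

-- Roots of unity

coprime-inverse : ∀ {N} → 2 ≤ N → .{{_ : NonZero N}} → ∀ {u} → gcd u N ≡ 1 → ∃ λ u' → (u' *ℕ u) ℕD.% N ≡ 1
coprime-inverse {suc N} l {u} g with Cop.coprime-Bézout (Cop.gcd≡1⇒coprime {u} {suc N} g)
... | GCD.Bézout.+- a b e = a , trans (cong (ℕD._% suc N) (sym e)) (trans (ℕD.[m+kn]%n≡m%n 1 b (suc N)) (ℕD.m<n⇒m%n≡m l))
-- Here a u is -1 modulo `suc N`, and so is `N`.
... | GCD.Bézout.-+ a b e = a *ℕ N , trans (sym (ℕD.[m+kn]%n≡m%n (a *ℕ N *ℕ u) 1 (suc N)))
    (trans (cong (ℕD._% suc N) eq) (trans (ℕD.[m+kn]%n≡m%n 1 (N *ℕ b) (suc N)) (ℕD.m<n⇒m%n≡m l)))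
  where
  open ≡-Reasoning
  eq : a *ℕ N *ℕ u +ℕ 1 *ℕ suc N ≡ 1 +ℕ N *ℕ b *ℕ suc N
  eq = begin
    a *ℕ N *ℕ u +ℕ 1 *ℕ suc N    ≡⟨ cong₂ _+ℕ_ (trans (cong (_*ℕ u) (ℕP.*-comm a N)) (ℕP.*-assoc N a u)) (ℕP.*-identityˡ (suc N)) ⟩
    N *ℕ (a *ℕ u) +ℕ suc N       ≡⟨ ℕP.+-suc _ N ⟩
    suc (N *ℕ (a *ℕ u) +ℕ N)     ≡⟨ cong suc (ℕP.+-comm _ N) ⟩
    suc (N +ℕ N *ℕ (a *ℕ u))     ≡⟨ cong suc (ℕP.*-suc N (a *ℕ u)) ⟨
    suc (N *ℕ suc (a *ℕ u))      ≡⟨ cong (λ t → suc (N *ℕ t)) e ⟩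
    suc (N *ℕ (b *ℕ suc N))      ≡⟨ cong suc (ℕP.*-assoc N b (suc N)) ⟨
    1 +ℕ N *ℕ b *ℕ suc N         ∎

%-*ˡ : ∀ a b N .{{_ : NonZero N}} → (a *ℕ (b ℕD.% N)) ℕD.% N ≡ (a *ℕ b) ℕD.% N
%-*ˡ a b N = trans (ℕD.%-distribˡ-* a (b ℕD.% N) N) (trans (cong (λ t → ((a ℕD.% N) *ℕ t) ℕD.% N) (ℕD.m%n%n≡m%n b N)) (sym (ℕD.%-distribˡ-* a b N)))

inverse-mod : ∀ {N} u' u j .{{_ : NonZero N}} → 2 ≤ N → (u' *ℕ u) ℕD.% N ≡ 1 → (u' *ℕ ((u *ℕ j) ℕD.% N)) ℕD.% N ≡ j ℕD.% N
inverse-mod {N} u' u j l e = trans (%-*ˡ u' (u *ℕ j) N) (trans (cong (ℕD._% N) (sym (ℕP.*-assoc u' u j)))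
  (trans (ℕD.%-distribˡ-* (u' *ℕ u) j N) (trans (cong (λ t → (t *ℕ (j ℕD.% N)) ℕD.% N) e)
    (trans (cong (ℕD._% N) (ℕP.*-identityˡ (j ℕD.% N))) (ℕD.m%n%n≡m%n j N)))))

module Roots {c ℓ} (K : CZField c ℓ) where
  open CZField K renaming (refl to ≈-refl; sym to ≈-sym; trans to ≈-trans; zero to *-zero)
  open Chars K
  open Sums K
  open import Relation.Binary.Reasoning.Setoid setoid

  record Order (ζ : Carrier) (N : ℕ) : Set ℓ where
    constructor order
    field
      pow≈1⇒∣ : ∀ s → powK ζ s ≈ 1# → N ∣ s
      ∣⇒pow≈1 : ∀ s → N ∣ s → powK ζ s ≈ 1#
  open Order public

  pow-multiple : ∀ {ζ N} → powK ζ N ≈ 1# → ∀ {s} → N ∣ s → powK ζ s ≈ 1#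
  pow-multiple {ζ} {N} e (divides q refl) = ≈-trans (powK-* ζ q N) (≈-trans (powK-cong e q) (powK-1 q))

  PrimRoot⇒Order : ∀ {ζ N} → 1 ≤ N → PrimRoot ζ N → Order ζ N
  PrimRoot⇒Order {ζ} {suc N} _ (e , mn) = order to (λ s → pow-multiple e)
    where
    to : ∀ s → powK ζ s ≈ 1# → suc N ∣ s
    to s h = go (s ℕD.% suc N) (ℕD.m%n<n s (suc N)) refl
      where
      h' : powK ζ (s ℕD.% suc N) ≈ 1#
      h' = begin
        powK ζ (s ℕD.% suc N)         ≈⟨ *-identityʳ _ ⟨
        powK ζ (s ℕD.% suc N) * 1#    ≈⟨ *-congˡ (pow-multiple {ζ} e (divides (s ℕD./ suc N) refl)) ⟨
        powK ζ (s ℕD.% suc N) * powK ζ (s ℕD./ suc N *ℕ suc N) ≈⟨ powK-+ ζ (s ℕD.% suc N) _ ⟨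
        powK ζ (s ℕD.% suc N +ℕ s ℕD./ suc N *ℕ suc N) ≈⟨ ≡⇒≈ (cong (powK ζ) (ℕD.m≡m%n+[m/n]*n s (suc N))) ⟨
        powK ζ s                      ≈⟨ h ⟩
        1#                            ∎
      go : ∀ r → r < suc N → s ℕD.% suc N ≡ r → suc N ∣ s
      go zero    _ eq = ℕ∣.m%n≡0⇒n∣m s (suc N) eq
      go (suc r) l eq = ⊥-elim (mn (suc r) (s≤s z≤n) l (≈-trans (≡⇒≈ (cong (powK ζ) (sym eq))) h'))

  pow-periodic : ∀ {ζ N L} → Order ζ N → N ∣ L → ∀ j → powK ζ (L +ℕ j) ≈ powK ζ j
  pow-periodic {ζ} {N} {L} o d j = ≈-trans (powK-+ ζ L j) (≈-trans (*-congʳ (∣⇒pow≈1 o L d)) (*-identityˡ _))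

  orthogonality : ∀ {ζ N L} → Order ζ N → N ∣ L → ∀ a → Σ< L (λ j → powK ζ (j *ℕ a)) ≈ (if ⌊ N ∣? a ⌋ then ι L else 0#)
  orthogonality {ζ} {N} {L} o d a with N ∣? a
  ... | yes N∣a = begin
    Σ< L (λ j → powK ζ (j *ℕ a)) ≈⟨ Σ<-cong L (λ j → ∣⇒pow≈1 o _ (ℕ∣.∣n⇒∣m*n j N∣a)) ⟩
    Σ< L (λ j → 1#)              ≈⟨ Σl-const (upTo L) 1# ⟩
    ι (length (upTo L)) * 1#     ≈⟨ *-identityʳ _ ⟩
    ι (length (upTo L))          ≈⟨ ≡⇒≈ (cong ι (LP.length-upTo L)) ⟩
    ι L                          ∎
  -- Shifting j by one multiplies the sum by ζ^a, which is not 1.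
  ... | no N∤a = fixed⇒zero {powK ζ a} (λ h → N∤a (pow≈1⇒∣ o a h)) (begin
    powK ζ a * Σ< L (λ j → powK ζ (j *ℕ a))     ≈⟨ Σl-*ˡ (upTo L) _ _ ⟨
    Σ< L (λ j → powK ζ a * powK ζ (j *ℕ a))     ≈⟨ Σ<-cong L (λ j → ≈-sym (powK-+ ζ a (j *ℕ a))) ⟩
    Σ< L (λ j → powK ζ (suc j *ℕ a))            ≈⟨ Σ<-shift L (λ j → powK ζ (j *ℕ a)) per 1 ⟩
    Σ< L (λ j → powK ζ (j *ℕ a))                ∎)
    where
    per : Periodic L (λ j → powK ζ (j *ℕ a))
    per j = ≈-trans (≡⇒≈ (cong (powK ζ) (ℕP.*-distribʳ-+ a L j))) (pow-periodic o (ℕ∣.∣m⇒∣m*n a d) (j *ℕ a))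

  module _ {L : ℕ} (L≥1 : 1 ≤ L) where

    private
      -- A character sum over the subgroup of multiples of e: its size or 0, according to whether N
      -- divides e, so that ζ enters through its order only.
      multiples : ∀ {ζ N} → Order ζ N → N ∣ L → ∀ e → e ∣ L →
        Σ< L (λ u → if ⌊ e ∣? u ⌋ then powK ζ u else 0#) ≈ (if ⌊ N ∣? e ⌋ then Σ< L (λ u → if ⌊ e ∣? u ⌋ then 1# else 0#) else 0#)
      multiples {ζ} {N} o d e e∣L with N ∣? e
      ... | yes N∣e = Σ<-cong L pt
        where
        pt : ∀ u → (if ⌊ e ∣? u ⌋ then powK ζ u else 0#) ≈ (if ⌊ e ∣? u ⌋ then 1# else 0#)
        pt u with e ∣? u
        ... | yes e∣u = ∣⇒pow≈1 o u (ℕ∣.∣-trans N∣e e∣u)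
        ... | no _    = ≈-refl
      ... | no N∤e = fixed⇒zero {powK ζ e} (λ h → N∤e (pow≈1⇒∣ o e h)) (begin
          powK ζ e * Σ< L f             ≈⟨ Σl-*ˡ (upTo L) _ _ ⟨
          Σ< L (λ u → powK ζ e * f u)   ≈⟨ Σ<-cong L shift ⟩
          Σ< L (λ u → f (e +ℕ u))       ≈⟨ Σ<-shift L f per e ⟩
          Σ< L f                        ∎)
        where
        f : ℕ → Carrier
        f u = if ⌊ e ∣? u ⌋ then powK ζ u else 0#
        shift : ∀ u → powK ζ e * f u ≈ f (e +ℕ u)
        shift u with e ∣? u | e ∣? (e +ℕ u)
        ... | yes _ | yes _ = ≈-sym (powK-+ ζ e u)
        ... | yes a | no b  = ⊥-elim (b (ℕ∣.∣m∣n⇒∣m+n ℕ∣.∣-refl a))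
        ... | no a  | yes b = ⊥-elim (a (ℕ∣.∣m+n∣m⇒∣n b ℕ∣.∣-refl))
        ... | no _  | no _  = zeroʳ _
        per : Periodic L f
        per u with e ∣? u | e ∣? (L +ℕ u)
        ... | yes _ | yes _ = pow-periodic o d u
        ... | yes a | no b  = ⊥-elim (b (ℕ∣.∣m∣n⇒∣m+n e∣L a))
        ... | no a  | yes b = ⊥-elim (a (ℕ∣.∣m+n∣m⇒∣n b e∣L))
        ... | no _  | no _  = ≈-refl

      -- For e = 1 this is the Ramanujan sum.
      stratum : Carrier → ℕ → Carrier
      stratum ζ e = Σ< L (λ u → if ⌊ gcd u L ℕP.≟ e ⌋ then powK ζ u else 0#)

      -- Since e divides L, it divides u exactly if it divides gcd(u, L). The range includes L
      -- because gcd(0, L) = L.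
      strata : ∀ ζ e → e ∣ L → Σ< (suc L) (λ e' → if ⌊ e ∣? e' ⌋ then stratum ζ e' else 0#) ≈ Σ< L (λ u → if ⌊ e ∣? u ⌋ then powK ζ u else 0#)
      strata ζ e e∣L = begin
        Σ< (suc L) (λ e' → if ⌊ e ∣? e' ⌋ then stratum ζ e' else 0#)                    ≈⟨ Σ<-cong (suc L) inside ⟩
        Σ< (suc L) (λ e' → Σ< L (λ u → if ⌊ e ∣? e' ⌋ then t u e' else 0#))             ≈⟨ Σl-swap (upTo (suc L)) (upTo L) (λ e' u → if ⌊ e ∣? e' ⌋ then t u e' else 0#) ⟩
        Σ< L (λ u → Σ< (suc L) (λ e' → if ⌊ e ∣? e' ⌋ then t u e' else 0#))             ≈⟨ Σ<-cong L pick ⟩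
        Σ< L (λ u → if ⌊ e ∣? u ⌋ then powK ζ u else 0#)                                ∎
        where
        t : ℕ → ℕ → Carrier
        t u e' = if ⌊ gcd u L ℕP.≟ e' ⌋ then powK ζ u else 0#
        inside : ∀ e' → (if ⌊ e ∣? e' ⌋ then stratum ζ e' else 0#) ≈ Σ< L (λ u → if ⌊ e ∣? e' ⌋ then t u e' else 0#)
        inside e' with e ∣? e'
        ... | yes _ = ≈-refl
        ... | no _  = ≈-sym (Σl-0 (upTo L) (λ _ → ≈-refl))
        pick : ∀ u → Σ< (suc L) (λ e' → if ⌊ e ∣? e' ⌋ then t u e' else 0#) ≈ (if ⌊ e ∣? u ⌋ then powK ζ u else 0#)
        pick u = ≈-trans (Σl-single (UP.upTo⁺ (suc L)) {gcd u L} (∈P.∈-upTo⁺ (s≤s (ℕ∣.∣⇒≤ {{ℕ.>-nonZero L≥1}} (GCD.gcd[m,n]∣n u L)))) other) at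
          where
          other : ∀ {e'} → e' ∈ upTo (suc L) → e' ≢ gcd u L → (if ⌊ e ∣? e' ⌋ then t u e' else 0#) ≈ 0#
          other {e'} _ ne with e ∣? e' | gcd u L ℕP.≟ e'
          ... | _     | yes eq = ⊥-elim (ne (sym eq))
          ... | yes _ | no _   = ≈-refl
          ... | no _  | no _   = ≈-refl
          at : (if ⌊ e ∣? gcd u L ⌋ then t u (gcd u L) else 0#) ≈ (if ⌊ e ∣? u ⌋ then powK ζ u else 0#)
          at with e ∣? gcd u L | e ∣? u | gcd u L ℕP.≟ gcd u L
          ... | yes a | yes b | yes _ = ≈-refl
          ... | yes a | no b  | _     = ⊥-elim (b (ℕ∣.∣-trans a (GCD.gcd[m,n]∣m u L)))
          ... | no a  | yes b | _     = ⊥-elim (a (GCD.gcd-greatest b e∣L))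
          ... | no _  | no _  | _     = ≈-refl
          ... | _     | _     | no ne = ⊥-elim (ne refl)

      empty-stratum : ∀ ζ {e} → ¬ (e ∣ L) → stratum ζ e ≈ 0#
      empty-stratum ζ {e} ne = Σl-0 (upTo L) (λ {u} _ → pt u)
        where
        pt : ∀ u → (if ⌊ gcd u L ℕP.≟ e ⌋ then powK ζ u else 0#) ≈ 0#
        pt u with gcd u L ℕP.≟ e
        ... | yes refl = ⊥-elim (ne (GCD.gcd[m,n]∣n u L))
        ... | no _     = ≈-refl

      -- Möbius inversion as a downward recursion: the strata over the multiples of e have a sum
      -- depending on N only, and those over proper multiples agree already. The fuel bounds L - e.
      stratum-unique : ∀ {ζ ζ' N} → Order ζ N → Order ζ' N → N ∣ L → ∀ fuel e → L ∸ e < fuel → e ∣ L → stratum ζ e ≈ stratum ζ' e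
      stratum-unique {ζ} {ζ'} {N} o o' d (suc fuel) e lt e∣L = subst (λ b → (if b then stratum ζ e else 0#) ≈ (if b then stratum ζ' e else 0#) → stratum ζ e ≈ stratum ζ' e)
          (sym (T⇒≡ (fromWitness {a? = e ∣? e} ℕ∣.∣-refl))) id
          (Σl-isolate (UP.upTo⁺ (suc L)) {e} {λ e' → if ⌊ e ∣? e' ⌋ then stratum ζ e' else 0#} {λ e' → if ⌊ e ∣? e' ⌋ then stratum ζ' e' else 0#} (∈P.∈-upTo⁺ (s≤s e≤L)) (λ {e'} _ ne → other e' ne)
          (≈-trans (strata ζ e e∣L) (≈-trans (multiples o d e e∣L) (≈-trans (≈-sym (multiples o' d e e∣L)) (≈-sym (strata ζ' e e∣L))))))
        where
        e≤L : e ≤ L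
        e≤L = ℕ∣.∣⇒≤ {{ℕ.>-nonZero L≥1}} e∣L
        other : ∀ e' → e' ≢ e → (if ⌊ e ∣? e' ⌋ then stratum ζ e' else 0#) ≈ (if ⌊ e ∣? e' ⌋ then stratum ζ' e' else 0#)
        other e' ne with e ∣? e' | e' ∣? L
        ... | no _    | _        = ≈-refl
        ... | yes _   | no e'∤L  = ≈-trans (empty-stratum ζ e'∤L) (≈-sym (empty-stratum ζ' e'∤L))
        ... | yes e∣e' | yes e'∣L = stratum-unique o o' d fuel e' (ℕP.<-≤-trans (ℕP.∸-monoʳ-< e<e' (ℕ∣.∣⇒≤ {{ℕ.>-nonZero L≥1}} e'∣L)) (ℕP.≤-pred lt)) e'∣L
          where
          e'≥1 : ∀ e' → e' ∣ L → 1 ≤ e'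
          e'≥1 zero d = ⊥-elim (ℕP.<⇒≢ L≥1 (sym (ℕ∣.0∣⇒≡0 d)))
          e'≥1 (suc _) _ = s≤s z≤n
          e<e' : e < e'
          e<e' = ℕP.≤∧≢⇒< (ℕ∣.∣⇒≤ {{ℕ.>-nonZero (e'≥1 e' e'∣L)}} e∣e') (ne ∘ sym)

    units : List ℕ
    units = boolFilter (λ u → ⌊ gcd u L ℕP.≟ 1 ⌋) (upTo L)

    ∈-units⁻ : ∀ {u} → u ∈ units → gcd u L ≡ 1
    ∈-units⁻ m = toWitness (proj₂ (∈-boolFilter⁻ _ (upTo L) m))

    ramanujan : ∀ {ζ ζ' N} → Order ζ N → Order ζ' N → N ∣ L → Σl units (powK ζ) ≈ Σl units (powK ζ')
    ramanujan {ζ} {ζ'} o o' d = ≈-trans (Σl-filter _ (upTo L) (powK ζ)) (≈-trans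
      (stratum-unique o o' d (suc L) 1 (s≤s (ℕP.m∸n≤m L 1)) (ℕ∣.1∣ L)) (≈-sym (Σl-filter _ (upTo L) (powK ζ'))))

  module _ {L : ℕ} (L≥2 : 2 ≤ L) {{_ : NonZero L}} where

    private
      L≥1 : 1 ≤ L
      L≥1 = ℕP.≤-trans (s≤s z≤n) L≥2

      units≥1 : 1 ≤ length (units L≥1)
      units≥1 = ∈P.∈-length (∈-boolFilter⁺ _ (∈P.∈-upTo⁺ L≥2) (fromWitness (GCD.gcd-zeroˡ L)))

    scale : ∀ u → gcd u L ≡ 1 → ∀ f → Σ< L (λ j → f ((u *ℕ j) ℕD.% L)) ≈ Σ< L f
    scale u g f with coprime-inverse L≥2 {u} g
    ... | u' , e = Σl-bijection (UP.upTo⁺ L) (UP.upTo⁺ L) (λ j → (u *ℕ j) ℕD.% L) (λ j → (u' *ℕ j) ℕD.% L)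
      (λ {j} _ → ∈P.∈-upTo⁺ (ℕD.m%n<n (u *ℕ j) L)) (λ {j} _ → ∈P.∈-upTo⁺ (ℕD.m%n<n (u' *ℕ j) L))
      (λ {j} m → trans (inverse-mod u' u j L≥2 e) (ℕD.m<n⇒m%n≡m (∈P.∈-upTo⁻ m)))
      (λ {j} m → trans (inverse-mod u u' j L≥2 (trans (cong (ℕD._% L) (ℕP.*-comm u u')) e)) (ℕD.m<n⇒m%n≡m (∈P.∈-upTo⁻ m))) f

    -- v transforms contragrediently and w covariantly under j ↦ u j, so both sums
    -- are averages of Ramanujan sums of the same orders.
    galois : (v w : ℕ → Carrier) (b : ℕ → Bool) →
      (∀ j → T (b j) → ∃ λ N → N ∣ L × Order (v j) N × Order (w j) N) →
      (∀ u → gcd u L ≡ 1 → ∀ j → b ((u *ℕ j) ℕD.% L) ≡ b j) →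
      (∀ u → gcd u L ≡ 1 → ∀ j → powK (v ((u *ℕ j) ℕD.% L)) u ≈ v j) →
      (∀ u → gcd u L ≡ 1 → ∀ j → w ((u *ℕ j) ℕD.% L) ≈ powK (w j) u) →
      Σ< L (λ j → if b j then v j else 0#) ≈ Σ< L (λ j → if b j then w j else 0#)
    galois v w b ord hb hv hw = ι-cancel units≥1 (begin
        ι (length U) * Σ< L (λ j → if b j then v j else 0#)          ≈⟨ Σl-const U _ ⟨
        Σl U (λ _ → Σ< L (λ j → if b j then v j else 0#))            ≈⟨ Σl-cong U (λ {u} m → vside u (∈-units⁻ L≥1 m)) ⟩
        Σl U (λ u → Σ< L (λ j → if b j then powK (v j) u else 0#))   ≈⟨ Σl-swap U (upTo L) (λ u j → if b j then powK (v j) u else 0#) ⟩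
        Σ< L (λ j → Σl U (λ u → if b j then powK (v j) u else 0#))   ≈⟨ Σ<-cong L middle ⟩
        Σ< L (λ j → Σl U (λ u → if b j then powK (w j) u else 0#))   ≈⟨ Σl-swap U (upTo L) (λ u j → if b j then powK (w j) u else 0#) ⟨
        Σl U (λ u → Σ< L (λ j → if b j then powK (w j) u else 0#))   ≈⟨ Σl-cong U (λ {u} m → wside u (∈-units⁻ L≥1 m)) ⟨
        Σl U (λ _ → Σ< L (λ j → if b j then w j else 0#))            ≈⟨ Σl-const U _ ⟩
        ι (length U) * Σ< L (λ j → if b j then w j else 0#)          ∎)
      where
      U : List ℕ
      U = units L≥1
      if-cong : ∀ b {x y : Carrier} → x ≈ y → (if b then x else 0#) ≈ (if b then y else 0#)
      if-cong true  e = e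
      if-cong false e = ≈-refl
      vside : ∀ u → gcd u L ≡ 1 → Σ< L (λ j → if b j then v j else 0#) ≈ Σ< L (λ j → if b j then powK (v j) u else 0#)
      vside u g = ≈-trans (Σ<-cong L (λ j → ≈-trans (if-cong (b j) (≈-sym (hv u g j)))
          (≡⇒≈ (cong (λ t → if t then powK (v ((u *ℕ j) ℕD.% L)) u else 0#) (sym (hb u g j))))))
        (scale u g (λ j → if b j then powK (v j) u else 0#))
      wside : ∀ u → gcd u L ≡ 1 → Σ< L (λ j → if b j then w j else 0#) ≈ Σ< L (λ j → if b j then powK (w j) u else 0#)
      wside u g = ≈-trans (≈-sym (scale u g (λ j → if b j then w j else 0#))) (Σ<-cong L (λ j →
        ≈-trans (≡⇒≈ (cong (λ t → if t then w ((u *ℕ j) ℕD.% L) else 0#) (hb u g j))) (if-cong (b j) (hw u g j))))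
      middle : ∀ j → Σl U (λ u → if b j then powK (v j) u else 0#) ≈ Σl U (λ u → if b j then powK (w j) u else 0#)
      middle j with b j in eq
      ... | true  = let (N , d , o , o') = ord j (≡⇒T eq) in ramanujan L≥1 o o' d
      ... | false = Σl-cong U (λ _ → ≈-refl)

-- Values of the characters ω

module Characters {c ℓ} (K : CZField c ℓ) {n : ℕ} (n≥1 : 1 ≤ n) {ρ⁺ ρ⁻ : ℕ → CZField.Carrier K}
                  (faithful : Chars.FaithfulChoice K n ρ⁺ ρ⁻) {ω : SP n → SP n → CZField.Carrier K}
                  (family : Chars.OmegaFamily K n ρ⁺ ρ⁻ ω) where
  open CZField K renaming (refl to ≈-refl; sym to ≈-sym; trans to ≈-trans; zero to *-zero)
  open Chars K
  open Sums K
  open Roots K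
  open OmegaFamily family
  open import Relation.Binary.Reasoning.Setoid setoid

  ρ : SP n → Pt n → Carrier
  ρ x c = if isNegCls x c then ρ⁻ (cycLen x c) else ρ⁺ (cycLen x c)

  -- A class -1 cycle of length i is one orbit of 2i points, and ρ⁻ has order 2i; in class +1 the
  -- orbit has i points, and ρ⁺ has order i. The orbit length is thus the common form of both cases.
  ρ-Order : ∀ {x} → Bij x → ∀ c → Order (ρ x c) (orbLen x c)
  ρ-Order {x} B c with BP.T? (isNegCls x c)
  ... | yes t = subst₂ Order (sym (cong (λ b → if b then ρ⁻ (cycLen x c) else ρ⁺ (cycLen x c)) (T⇒≡ t))) (cycLen-neg B t)
      (PrimRoot⇒Order (ℕP.*-mono-≤ {1} {2} (s≤s z≤n) (cycLen≥1 B c)) (proj₂ (faithful (cycLen x c) (cycLen≥1 B c) (cycLen≤ B c))))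
  ... | no ¬t = subst₂ Order (sym (cong (λ b → if b then ρ⁻ (cycLen x c) else ρ⁺ (cycLen x c)) (¬T⇒≡ ¬t))) (cycLen-pos x ¬t)
      (PrimRoot⇒Order (cycLen≥1 B c) (proj₁ (faithful (cycLen x c) (cycLen≥1 B c) (cycLen≤ B c))))

  ρ-fix⇒1 : ∀ {x} → Bij x → ∀ c a → iterApp x a c ≡ c → powK (ρ x c) a ≈ 1#
  ρ-fix⇒1 B c a e = ∣⇒pow≈1 (ρ-Order B c) a (orbLen-divides B a e)

  ρ-1⇒fix : ∀ {x} → Bij x → ∀ c a → powK (ρ x c) a ≈ 1# → iterApp x a c ≡ c
  ρ-1⇒fix {x} B c a e = iter-multiple x (iter-orbLen B c) (pow≈1⇒∣ (ρ-Order B c) a e)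

  ω-mult : ∀ {x z w} → Bij x → Bij z → Comm x z → Bij w → Comm x w → ω x (compose z w) ≈ ω x z * ω x w
  ω-mult {x} {z} {w} Bx Bz cz Bw cw = mult x (isB Bx) z w (⇒InCent Bz cz) (⇒InCent Bw cw)

  -- `restrictCyc x c` and `restrict x (inCyc x c)` are equal by definition.
  ω-cycle : ∀ {x} → Bij x → ∀ c → ω x (restrict x (inCyc x c)) ≈ ρ x c
  ω-cycle {x} Bx c = onCycle x (isB Bx) c

  restrict-cyc-Bij : ∀ {x : SP n} → Bij x → ∀ c → Bij (restrict x (inCyc x c))
  restrict-cyc-Bij B c = restrict-Bij B (inCyc-neg B c) (inCyc-stable B c)

  restrict-cyc-Comm : ∀ {x : SP n} → Bij x → ∀ c → Comm x (restrict x (inCyc x c))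
  restrict-cyc-Comm B c = restrict-Comm (inCyc-neg B c) (inCyc-stable B c) Comm-self

  Comm-id : ∀ {x : SP n} → Comm x (idB n)
  Comm-id {x} = mkComm λ p → trans (cong (app x) (app-id p)) (sym (app-id (app x p)))

  -- Multiplicativity alone would allow the value 0. Comparison with a cycle, where the value is a
  -- root of unity, excludes it; the point defining that cycle exists by `n≥1`.
  ω-id : ∀ {x} → Bij x → ω x (idB n) ≈ 1#
  ω-id {x} Bx = unit-cancel {ρ x c₀} {powK (ρ x c₀) (orbLen x c₀ ∸ 1)}
      (≈-trans (≡⇒≈ (cong (powK (ρ x c₀)) (ℕP.m+[n∸m]≡n (orbLen≥1 Bx c₀)))) (ρ-fix⇒1 Bx c₀ (orbLen x c₀) (iter-orbLen Bx c₀))) (begin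
    ρ x c₀ * ω x (idB n)                 ≈⟨ *-comm _ _ ⟩
    ω x (idB n) * ρ x c₀                 ≈⟨ *-congˡ (ω-cycle Bx c₀) ⟨
    ω x (idB n) * ω x r                  ≈⟨ ω-mult Bx Bij-id Comm-id (restrict-cyc-Bij Bx c₀) (restrict-cyc-Comm Bx c₀) ⟨
    ω x (compose (idB n) r)              ≈⟨ ≡⇒≈ (cong (ω x) (app-ext λ p → trans (app-compose (idB n) r p) (app-id (app r p)))) ⟩
    ω x r                                ≈⟨ ω-cycle Bx c₀ ⟩
    ρ x c₀                               ≈⟨ *-identityʳ _ ⟨
    ρ x c₀ * 1#                          ∎)
    where
    c₀ : Pt n
    c₀ = F.fromℕ< n≥1 , false
    r : SP n
    r = restrict x (inCyc x c₀)

  ω-pow : ∀ {x z} → Bij x → Bij z → Comm x z → ∀ a → ω x (powN z a) ≈ powK (ω x z) a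
  ω-pow Bx Bz cz zero    = ω-id Bx
  ω-pow Bx Bz cz (suc a) = ≈-trans (ω-mult Bx Bz cz (Bij-powN Bz a) (Comm-powN cz a)) (*-congˡ (ω-pow Bx Bz cz a))

  ω-swap : ∀ {x z} (Bx : Bij x) (Bz : Bij z) (xz : Comm x z) c (aw : ¬ T (inCyc x c (app z c))) → ω x (Swap.swapEl Bx Bz xz c aw) ≈ 1#
  ω-swap {x} Bx Bz xz c aw = onComplement x (isB Bx) _ (Swap.swap-SwapInv Bx Bz xz c aw)

  -- An element commuting with a single cycle acts on it as ± x^t. A reduced sign -1 occurs in class
  -- +1 only, where `onSign` gives it the value 1.
  cycle-value : ∀ {x z} → Bij x → Comm x z → ∀ {c t s} → app z c ≡ flip s (iterApp x t c) → Reduced x c s →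
    (∀ p → ¬ T (inCyc x c p) → app z p ≡ p) → ω x z ≈ powK (ρ x c) t
  cycle-value {x} {z} Bx xz {c} {t} {s} e red out = go s red on
    where
    X : Pt n → Bool
    X = inCyc x c
    r : SP n
    r = restrict x X
    on : ∀ p → T (X p) → app z p ≡ iterApp x t (flip s p)
    on p h with inCyc⁻ x h
    ... | a , s' , e' = flip-inj s' (trans (sym (app-flip z s' p)) (trans (cong (app z) (sym e'))
           (trans (sym (iter-Comm₁ xz a c)) (trans (cong (iterApp x a) e) (trans (app-iter-flip x a s (iterApp x t c))
           (trans (cong (flip s) (trans (iter-comm x a t c) (trans (cong (iterApp x t) e') (app-iter-flip x t s' p))))
           (trans (flip-comm s s' (iterApp x t p)) (cong (flip s') (sym (app-iter-flip x t s p)))))))))) 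
    pow-out : ∀ p → ¬ T (X p) → app (powN r t) p ≡ p
    pow-out p h = trans (app-powN r t p) (iter-restrict-out {z = x} {X} (inCyc-neg Bx c) t h)
    pow-in : ∀ p → T (X p) → app (powN r t) p ≡ iterApp x t p
    pow-in p h = trans (app-powN r t p) (iter-restrict-in {z = x} {X} (inCyc-neg Bx c) (inCyc-stable Bx c) t h)
    pow-value : ω x (powN r t) ≈ powK (ρ x c) t
    pow-value = ≈-trans (ω-pow Bx (restrict-cyc-Bij Bx c) (restrict-cyc-Comm Bx c) t) (powK-cong (ω-cycle Bx c) t)
    go : ∀ s → Reduced x c s → (∀ p → T (X p) → app z p ≡ iterApp x t (flip s p)) → ω x z ≈ powK (ρ x c) t
    go false _ on = ≈-trans (≡⇒≈ (cong (ω x) (app-ext eq))) pow-value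
      where
      eq : ∀ p → app z p ≡ app (powN r t) p
      eq p with BP.T? (X p)
      ... | yes h = trans (on p h) (sym (pow-in p h))
      ... | no h  = trans (out p h) (sym (pow-out p h))
    go true red on = begin
      ω x z                                    ≈⟨ ≡⇒≈ (cong (ω x) (app-ext eq)) ⟩
      ω x (compose (powN r t) (negCyc x c))    ≈⟨ ω-mult Bx (Bij-powN (restrict-cyc-Bij Bx c) t) (Comm-powN (restrict-cyc-Comm Bx c) t) (negCyc-Bij Bx c) (negCyc-Comm Bx c) ⟩
      ω x (powN r t) * ω x (negCyc x c)        ≈⟨ *-cong pow-value (onSign x (isB Bx) c (≡⇒T (cong not (¬T⇒≡ (λ k → case red k of λ ()))))) ⟩
      powK (ρ x c) t * 1#                      ≈⟨ *-identityʳ _ ⟩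
      powK (ρ x c) t                           ∎
      where
      eq : ∀ p → app z p ≡ app (compose (powN r t) (negCyc x c)) p
      eq p with BP.T? (X p)
      ... | yes h = trans (on p h) (sym (trans (app-compose (powN r t) (negCyc x c) p)
              (trans (cong (app (powN r t)) (trans (app-negCyc Bx c p) (patch-in {Q = X} {f = neg} h))) (pow-in (neg p) (subst T (sym (inCyc-neg Bx c p)) h)))))
      ... | no h = trans (out p h) (sym (trans (app-compose (powN r t) (negCyc x c) p)
              (trans (cong (app (powN r t)) (trans (app-negCyc Bx c p) (patch-out {Q = X} {f = neg} h))) (pow-out p h))))

  -- Multiplying z by the swap of the cycles of c and z c removes the second one from the
  -- z-orbit of cycles, until z maps the cycle of c to itself.
  value : ∀ d {x z} → Bij x → Bij z → Comm x z → ∀ {c t s} → iterApp z (suc d) c ≡ flip s (iterApp x t c) → Reduced x c s →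
    (∀ l → 1 ≤ l → l ≤ d → ¬ T (inCyc x c (iterApp z l c))) →
    (∀ p → app z p ≡ p ⊎ (∃ λ l → l ≤ d × T (inCyc x (iterApp z l c) p))) →
    ω x z ≈ powK (ρ x c) t
  value zero {x} {z} Bx Bz xz {c} {t} {s} e red aw sup = cycle-value Bx xz {c} {t} {s} e red out
    where
    out : ∀ p → ¬ T (inCyc x c p) → app z p ≡ p
    out p h with sup p
    ... | inj₁ e = e
    ... | inj₂ (.0 , z≤n , k) = ⊥-elim (h k)
  value (suc d) {x} {z} Bx Bz xz {c} {t} {s} e red aw sup = begin
    ω x z                  ≈⟨ *-identityʳ _ ⟨
    ω x z * 1#             ≈⟨ *-congˡ (ω-swap Bx Bz xz c away) ⟨
    ω x z * ω x swapEl     ≈⟨ ω-mult Bx Bz xz swap-Bij swap-Comm ⟨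
    ω x z₁                 ≈⟨ value d Bx (Bij-compose Bz swap-Bij) (Comm-compose xz swap-Comm) {c} {t} {s}
                                (trans (iterates d ℕP.≤-refl) e) red
                                (λ { (suc l) _ l≤ h → aw (suc (suc l)) (s≤s z≤n) (s≤s l≤) (subst (T ∘ inCyc x c) (iterates l (ℕP.<⇒≤ l≤)) h) }) sup₁ ⟩
    powK (ρ x c) t         ∎
    where
    away : ¬ T (inCyc x c (app z c))
    away = aw 1 (s≤s z≤n) (s≤s z≤n)
    open Swap Bx Bz xz c away
    z₁ : SP n
    z₁ = compose z swapEl
    -- The swap already takes c to z c, so the first step of z₁ is two steps of z.
    iterates : ∀ l → l ≤ d → iterApp z₁ (suc l) c ≡ iterApp z (suc (suc l)) c
    iterates zero _ = trans (app-compose z swapEl c) (cong (app z) (swap-X (inCyc-refl Bx c)))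
    iterates (suc l) l< = trans (cong (app z₁) (iterates l (ℕP.<⇒≤ l<))) (trans (app-compose z swapEl (iterApp z (suc (suc l)) c))
      (cong (app z) (swap-out (aw (suc (suc l)) (s≤s z≤n) (s≤s l<))
        (λ h → aw (suc l) (s≤s z≤n) (ℕP.m≤n⇒m≤1+n l<) (subst T (X⇒Yz (iterApp z (suc l) c)) h)))))
    sup₁ : ∀ p → app z₁ p ≡ p ⊎ (∃ λ l → l ≤ d × T (inCyc x (iterApp z₁ l c) p))
    sup₁ p with BP.T? (X p) | BP.T? (Y p)
    ... | yes h | _ = inj₂ (0 , z≤n , h)
    ... | no _ | yes k = inj₁ (trans (app-compose z swapEl p) (trans (cong (app z) (swap-Y k)) (app-invʳ z Bz p)))
    ... | no h | no k with sup p
    ...   | inj₁ e' = inj₁ (trans (app-compose z swapEl p) (trans (cong (app z) (swap-out h k)) e'))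
    ...   | inj₂ (zero , _ , u) = ⊥-elim (h u)
    ...   | inj₂ (suc zero , _ , u) = ⊥-elim (k u)
    ...   | inj₂ (suc (suc l) , s≤s l≤ , u) = inj₂ (suc l , l≤ , subst (λ q → T (inCyc x q p)) (sym (iterates l (ℕP.<⇒≤ l≤))) u)

  -- Transport of ω between elements that correspond on a region

  module Transport {x x' g : SP n} (Bx : Bij x) (Bx' : Bij x') (Bg : Bij g)
                   {U : Pt n → Bool} (Un : NegInvariant U) (Us : Stable x U)
                   (int : ∀ p → T (U p) → app x' (app g p) ≡ app g (app x p)) where
    private
      tr : ∀ {p} → T (U p) → ∀ a → iterApp x' a (app g p) ≡ app g (iterApp x a p)
      tr h zero    = refl
      tr {p} h (suc a) = trans (cong (app x') (tr h a)) (int (iterApp x a p) (subst T (sym (stable-iter {x = x} {U} Us a p)) h))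

      ρ-transport : ∀ {p} → T (U p) → ρ x p ≡ ρ x' (app g p)
      ρ-transport {p} h = cong₂ (λ b l → if b then ρ⁻ l else ρ⁺ l) (isNegCls-transport {g = g} Bx Bx' Bg (tr h)) (cycLen-transport {g = g} Bx Bx' Bg (tr h))

    -- Induction on a list containing all indices moved by z. A fixed index is dropped. If z
    -- preserves the x-cycle of the index, that factor is split off and evaluated on both sides by
    -- `cycle-value`. Otherwise a swap, of value 1 on both sides, makes the index fixed. With `U`
    -- everything this is invariance under conjugation; with `g` the identity it says that x may be
    -- changed off the support of z.
    transport : ∀ (l : List (Fin n)) {z z'} → Bij z → Comm x z → Comm x' z' → Conj g z z' →
      (∀ p → ¬ T (U p) → app z p ≡ p) → (∀ i → app z (i , false) ≢ (i , false) → i ∈ l) → ω x z ≈ ω x' z'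
    transport [] {z} {z'} Bz xz xz' cj out nf = ≈-trans (≡⇒≈ (cong (ω x) (app-ext λ p → trans (fixed p) (sym (app-id p)))))
        (≈-trans (ω-id Bx) (≈-sym (≈-trans (≡⇒≈ (cong (ω x') (app-ext fixed'))) (ω-id Bx'))))
      where
      fixed⁺ : ∀ i → app z (i , false) ≡ (i , false)
      fixed⁺ i with app z (i , false) ≟ₚ (i , false)
      ... | yes e = e
      ... | no ne = case nf i ne of λ ()
      fixed : ∀ p → app z p ≡ p
      fixed (i , false) = fixed⁺ i
      fixed (i , true)  = trans (app-neg z (i , false)) (cong neg (fixed⁺ i))
      fixed' : ∀ p → app z' p ≡ app (idB n) p
      fixed' p = subst (λ q → app z' q ≡ app (idB n) q) (app-invʳ g Bg p)
        (trans (conj cj (app (inv g) p)) (trans (cong (app g) (fixed (app (inv g) p))) (sym (app-id (app g (app (inv g) p))))))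
    transport (i ∷ l) {z} {z'} Bz xz xz' cj out nf with app z (i , false) ≟ₚ (i , false) | BP.T? (inCyc x (i , false) (app z (i , false)))
    ... | yes e | _ = transport l Bz xz xz' cj out (λ j ne → skip (nf j ne) ne)
      where
      skip : ∀ {j} → j ∈ i ∷ l → app z (j , false) ≢ (j , false) → j ∈ l
      skip (here refl) ne = ⊥-elim (ne e)
      skip (there m) _ = m
    ... | no ne | yes h = main (inCyc-reduced Bx h)
      where
      c₀ c₀' : Pt n
      c₀  = i , false
      c₀' = app g c₀
      Uc : T (U c₀)
      Uc with BP.T? (U c₀)
      ... | yes u = u
      ... | no ¬u = ⊥-elim (ne (out c₀ ¬u))
      X X' : Pt n → Bool
      X  = inCyc x c₀
      X' = inCyc x' c₀'
      Xn : NegInvariant X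
      Xn = inCyc-neg Bx c₀
      Xn' : NegInvariant X'
      Xn' = inCyc-neg Bx' c₀'
      co : (Pt n → Bool) → Pt n → Bool
      co Q = not ∘ Q
      con : ∀ {Q} → NegInvariant Q → NegInvariant (co Q)
      con Qn p = cong not (Qn p)
      X≡ : ∀ p → X p ≡ X' (app g p)
      X≡ = inCyc-transport {g = g} Bx Bx' Bg (tr Uc)
      Bz' : Bij z'
      Bz' = Conj-Bij Bg Bz cj
      zX : Stable z X
      zX p = trans (inCyc-≡ Bx h (app z p)) (inCyc-Comm Bx Bz xz c₀ p)
      zX' : Stable z' X'
      zX' p = trans (inCyc-≡ Bx' h' (app z' p)) (inCyc-Comm Bx' Bz' xz' c₀' p)
        where
        h' : T (X' (app z' c₀'))
        h' = subst T (trans (X≡ (app z c₀)) (cong X' (sym (conj cj c₀)))) h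
      z₁ z₂ z₁' z₂' : SP n
      z₁  = restrict z X
      z₂  = restrict z (co X)
      z₁' = restrict z' X'
      z₂' = restrict z' (co X')
      B₂ : Bij z₂
      B₂ = restrict-Bij {z = z} {co X} Bz (con {X} Xn) (λ p → cong not (zX p))
      C₂ : Comm x z₂
      C₂ = restrict-Comm {z = z} {co X} (con {X} Xn) (λ p → cong not (inCyc-stable Bx c₀ p)) xz
      B₂' : Bij z₂'
      B₂' = restrict-Bij {z = z'} {co X'} Bz' (con {X'} Xn') (λ p → cong not (zX' p))
      C₂' : Comm x' z₂'
      C₂' = restrict-Comm {z = z'} {co X'} (con {X'} Xn') (λ p → cong not (inCyc-stable Bx' c₀' p)) xz'
      split : ∀ {w Q} → NegInvariant Q → Stable w Q → w ≡ compose (restrict w Q) (restrict w (co Q))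
      split {w} {Q} Qn Qs = app-ext λ p → sym (trans (app-compose (restrict w Q) (restrict w (co Q)) p) (go p))
        where
        go : ∀ p → app (restrict w Q) (app (restrict w (co Q)) p) ≡ app w p
        go p with BP.T? (Q p)
        ... | yes t = trans (cong (app (restrict w Q)) (restrict-out {z = w} {co Q} (con {Q} Qn) {p} (λ k → subst T (cong not (T⇒≡ t)) k))) (restrict-in {z = w} {Q} Qn {p} t)
        ... | no t  = trans (cong (app (restrict w Q)) (restrict-in {z = w} {co Q} (con {Q} Qn) {p} (≡⇒T (cong not (¬T⇒≡ t)))))
                            (restrict-out {z = w} {Q} Qn {app w p} (t ∘ subst T (Qs p)))
      cj₂ : Conj g z₂ z₂'
      cj₂ = patch-Conj {g = g} {Q = co X} {Q' = co X'} (con {X} Xn) (con {X'} Xn') (λ p → cong not (X≡ p)) {app z} {app z'} (app-neg z) (app-neg z') (λ p _ → conj cj p)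
      main : ∃₂ (λ t s → app z c₀ ≡ flip s (iterApp x t c₀) × Reduced x c₀ s) → ω x z ≈ ω x' z'
      main (t , s , e , red) = begin
          ω x z                          ≈⟨ ≡⇒≈ (cong (ω x) (split {z} {X} Xn zX)) ⟩
          ω x (compose z₁ z₂)            ≈⟨ ω-mult Bx (restrict-Bij {z = z} {X} Bz Xn zX) (restrict-Comm {z = z} {X} Xn (inCyc-stable Bx c₀) xz) B₂ C₂ ⟩
          ω x z₁ * ω x z₂                ≈⟨ *-cong first rest ⟩
          ω x' z₁' * ω x' z₂'            ≈⟨ ω-mult Bx' (restrict-Bij {z = z'} {X'} Bz' Xn' zX') (restrict-Comm {z = z'} {X'} Xn' (inCyc-stable Bx' c₀') xz') B₂' C₂' ⟨
          ω x' (compose z₁' z₂')         ≈⟨ ≡⇒≈ (cong (ω x') (split {z'} {X'} Xn' zX')) ⟨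
          ω x' z'                        ∎
        where
        e' : app z' c₀' ≡ flip s (iterApp x' t c₀')
        e' = trans (conj cj c₀) (trans (cong (app g) e) (trans (app-flip g s (iterApp x t c₀)) (cong (flip s) (sym (tr Uc t)))))
        first : ω x z₁ ≈ ω x' z₁'
        first = ≈-trans (cycle-value Bx (restrict-Comm {z = z} {X} Xn (inCyc-stable Bx c₀) xz) {c₀} {t} {s} (trans (restrict-in {z = z} {X} Xn (inCyc-refl Bx c₀)) e) red (λ p k → restrict-out {z = z} {X} Xn k))
          (≈-trans (≡⇒≈ (cong (λ r → powK r t) (ρ-transport Uc)))
          (≈-sym (cycle-value Bx' (restrict-Comm {z = z'} {X'} Xn' (inCyc-stable Bx' c₀') xz') {c₀'} {t} {s} (trans (restrict-in {z = z'} {X'} Xn' (inCyc-refl Bx' c₀')) e')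
            (λ k → red (subst T (sym (isNegCls-transport {g = g} Bx Bx' Bg (tr Uc))) k)) (λ p k → restrict-out {z = z'} {X'} Xn' k))))
        rest : ω x z₂ ≈ ω x' z₂'
        rest = transport l B₂ C₂ C₂' cj₂ out₂ (λ j ne₂ → skip (nf j (λ e₂ → ne₂ (keep (j , false) e₂))) ne₂)
          where
          keep : ∀ p → app z p ≡ p → app z₂ p ≡ p
          keep p e₂ with BP.T? (X p)
          ... | yes t = restrict-out {z = z} {co X} (con {X} Xn) {p} (λ k → subst T (cong not (T⇒≡ t)) k)
          ... | no t  = trans (restrict-in {z = z} {co X} (con {X} Xn) {p} (≡⇒T (cong not (¬T⇒≡ t)))) e₂
          out₂ : ∀ p → ¬ T (U p) → app z₂ p ≡ p
          out₂ p h = keep p (out p h)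
          skip : ∀ {j} → j ∈ i ∷ l → app z₂ (j , false) ≢ (j , false) → j ∈ l
          skip (here refl) ne₂ = ⊥-elim (ne₂ (restrict-out {z = z} {co X} (con {X} Xn) {c₀} (λ k → subst T (cong not (T⇒≡ (inCyc-refl Bx c₀))) k)))
          skip (there m) _ = m
    ... | no ne | no away = begin
        ω x z                       ≈⟨ *-identityˡ _ ⟨
        1# * ω x z                  ≈⟨ *-congʳ (ω-swap Bx Bz xz c₀ away) ⟨
        ω x S.swapEl * ω x z        ≈⟨ ω-mult Bx S.swap-Bij S.swap-Comm Bz xz ⟨
        ω x z₁                      ≈⟨ transport l (Bij-compose S.swap-Bij Bz) (Comm-compose S.swap-Comm xz) (Comm-compose S'.swap-Comm xz')
                                         (Conj-compose {z = S.swapEl} {z' = S'.swapEl} (mkConj cjS) cj) out₁ nf₁ ⟩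
        ω x' z₁'                    ≈⟨ ω-mult Bx' S'.swap-Bij S'.swap-Comm Bz' xz' ⟩
        ω x' S'.swapEl * ω x' z'    ≈⟨ *-congʳ (ω-swap Bx' Bz' xz' c₀' away') ⟩
        1# * ω x' z'                ≈⟨ *-identityˡ _ ⟩
        ω x' z'                     ∎
      where
      c₀ c₀' : Pt n
      c₀  = i , false
      c₀' = app g c₀
      moved⇒U : ∀ p → app z p ≢ p → T (U p)
      moved⇒U p ne with BP.T? (U p)
      ... | yes u = u
      ... | no ¬u = ⊥-elim (ne (out p ¬u))
      Uc : T (U c₀)
      Uc = moved⇒U c₀ ne
      Uzc : T (U (app z c₀))
      Uzc = moved⇒U (app z c₀) (λ e → ne (Bij⇒Inj Bz e))
      Bz' : Bij z'
      Bz' = Conj-Bij Bg Bz cj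
      X≡ : ∀ p → inCyc x c₀ p ≡ inCyc x' c₀' (app g p)
      X≡ = inCyc-transport {g = g} Bx Bx' Bg (tr Uc)
      Y≡ : ∀ p → inCyc x (app z c₀) p ≡ inCyc x' (app z' c₀') (app g p)
      Y≡ p = trans (inCyc-transport {g = g} Bx Bx' Bg (tr Uzc) p) (cong (λ q → inCyc x' q (app g p)) (sym (conj cj c₀)))
      away' : ¬ T (inCyc x' c₀' (app z' c₀'))
      away' k = away (subst T (sym (trans (X≡ (app z c₀)) (cong (inCyc x' c₀') (sym (conj cj c₀))))) k)
      module S  = Swap Bx Bz xz c₀ away
      module S' = Swap Bx' Bz' xz' c₀' away'
      -- Multiplied on the left, the swap takes z c₀ back to c₀, so that the index leaves the list.
      z₁ z₁' : SP n
      z₁  = compose S.swapEl z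
      z₁' = compose S'.swapEl z'
      cjS : ∀ p → app S'.swapEl (app g p) ≡ app g (app S.swapEl p)
      cjS p with BP.T? (S.X p) | BP.T? (S.Y p)
      ... | yes h | _ = trans (S'.swap-X (subst T (X≡ p) h)) (trans (conj cj p) (cong (app g) (sym (S.swap-X h))))
      ... | no _ | yes h = trans (S'.swap-Y (subst T (Y≡ p) h)) (trans (conj (Conj-inv Bz Bz' cj) p) (cong (app g) (sym (S.swap-Y h))))
      ... | no h | no k = trans (S'.swap-out (h ∘ subst T (sym (X≡ p))) (k ∘ subst T (sym (Y≡ p)))) (cong (app g) (sym (S.swap-out h k)))
      fixed-out : ∀ p → app z p ≡ p → app S.swapEl p ≡ p
      fixed-out p e = S.swap-out (λ h → S.disjoint h (subst T (sym (same e)) h)) (λ k → S.disjoint (subst T (same e) k) k)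
        where
        same : app z p ≡ p → S.Y p ≡ S.X p
        same e = trans (cong S.Y (sym e)) (S.X⇒Yz p)
      keep : ∀ p → app z p ≡ p → app z₁ p ≡ p
      keep p e = trans (app-compose S.swapEl z p) (trans (cong (app S.swapEl) e) (fixed-out p e))
      out₁ : ∀ p → ¬ T (U p) → app z₁ p ≡ p
      out₁ p h = keep p (out p h)
      nf₁ : ∀ j → app z₁ (j , false) ≢ (j , false) → j ∈ l
      nf₁ j ne₁ = skip (nf j (λ e → ne₁ (keep (j , false) e))) ne₁
        where
        skip : ∀ {j} → j ∈ i ∷ l → app z₁ (j , false) ≢ (j , false) → j ∈ l
        skip (here refl) ne₂ = ⊥-elim (ne₂ (trans (app-compose S.swapEl z c₀) (trans (S.swap-Y (inCyc-refl Bx (app z c₀))) (app-invˡ z Bz c₀))))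
        skip (there m) _ = m

  -- Sums of induced characters as sums over the whole group

  module Induced {y : SP n} (By : Bij y) where
    term : SP n → Carrier
    term x = ifK (inCentb x y) (ω x y)

    private
      module _ {r : SP n} (Br : Bij r) where

        term-conjugate : ∀ {g} → Bij g → (let z = compose (compose (inv g) y) g in ifK (inCentb r z) (ω r z)) ≈ term (conjugate g r)
        term-conjugate {g} Bg with BP.T? (inCentb r (compose (compose (inv g) y) g)) | BP.T? (inCentb (conjugate g r) y)
        ... | yes h | yes k = ifK-cong (trans (T⇒≡ h) (sym (T⇒≡ k))) λ _ →
             Transport.transport {g = g} Br (Conj-Bij Bg Br (conjugate-Conj r Bg)) Bg {λ _ → true} (λ _ → refl) (λ _ → refl)
               (λ p _ → conj (conjugate-Conj {g = g} r Bg) p) (allFin n) (proj₁ (InCent⇒ h)) (proj₂ (InCent⇒ h)) (proj₂ (InCent⇒ k)) zy (λ p f → ⊥-elim (f tt)) (λ i _ → ∈P.∈-allFin i)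
          where
          zy : Conj g (compose (compose (inv g) y) g) y
          zy = mkConj λ p → sym (trans (cong (app g) (trans (app-compose (compose (inv g) y) g p) (app-compose (inv g) y (app g p)))) (app-invʳ g Bg (app y (app g p))))
        ... | no h | no k = ≈-trans (ifK-false h) (≈-sym (ifK-false k))
        ... | yes h | no k = ⊥-elim (k (⇒InCent By (mkComm λ q → subst (λ q → app x (app y q) ≡ app y (app x q)) (app-invʳ g Bg q) (go (app (inv g) q)))))
          where
          x z : SP n
          x = conjugate g r
          z = compose (compose (inv g) y) g
          zy : ∀ p → app y (app g p) ≡ app g (app z p)
          zy p = sym (trans (cong (app g) (trans (app-compose (compose (inv g) y) g p) (app-compose (inv g) y (app g p)))) (app-invʳ g Bg (app y (app g p))))
          go : ∀ p → app x (app y (app g p)) ≡ app y (app x (app g p))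
          go p = trans (cong (app x) (zy p)) (trans (conj (conjugate-Conj r Bg) (app z p)) (trans (cong (app g) (comm (proj₂ (InCent⇒ h)) p))
            (trans (sym (zy (app r p))) (cong (app y) (sym (conj (conjugate-Conj r Bg) p))))))
        ... | no h | yes k = ⊥-elim (h (⇒InCent (Bij-compose (Bij-compose (Bij-inv g Bg) By) Bg) (mkComm λ p → Bij⇒Inj Bg
              (trans (sym (conj (conjugate-Conj r Bg) (app z p))) (trans (cong (app x) (sym (zy p))) (trans (comm (proj₂ (InCent⇒ k)) (app g p))
                (trans (cong (app y) (conj (conjugate-Conj r Bg) p)) (zy (app r p)))))))))
          where
          x z : SP n
          x = conjugate g r
          z = compose (compose (inv g) y) g
          zy : ∀ p → app y (app g p) ≡ app g (app z p)
          zy p = sym (trans (cong (app g) (trans (app-compose (compose (inv g) y) g p) (app-compose (inv g) y (app g p)))) (app-invʳ g Bg (app y (app g p))))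

        conjugators : SP n → List (SP n)
        conjugators x = boolFilter (λ g → eqSP (conjugate g r) x) (Bl n)

        centralizer : List (SP n)
        centralizer = boolFilter (inCentb r) (Bl n)

        conjb⁻ : ∀ {x} → T (conjb x r) → ∃ λ h → Bij h × Conj h x r
        conjb⁻ {x} t with any-elim (λ h → eqSP (compose h x) (compose r h)) (Bl n) t
        ... | h , m , e = h , Bl⇒Bij m , mkConj λ p → trans (sym (app-compose r h p)) (trans (cong (λ w → app w p) (sym (eqSP⇒≡ e))) (app-compose h x p))

        conjb⁺ : ∀ {x g} → Bij g → conjugate g r ≡ x → T (conjb x r)
        conjb⁺ {x} {g} Bg refl = any-intro _ (∈-Bl (Bij-inv g Bg)) (≡⇒eqSP (app-ext λ q → subst (λ q → app (compose (inv g) x) q ≡ app (compose r (inv g)) q) (app-invʳ g Bg q) (go (app (inv g) q))))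
          where
          go : ∀ p → app (compose (inv g) x) (app g p) ≡ app (compose r (inv g)) (app g p)
          go p = trans (app-compose (inv g) x (app g p)) (trans (cong (app (inv g)) (conj (conjugate-Conj r Bg) p)) (trans (app-invˡ g Bg (app r p))
            (trans (cong (app r) (sym (app-invˡ g Bg p))) (sym (app-compose r (inv g) (app g p))))))

        -- The g with g r g⁻¹ = x form the coset h⁻¹ Z(r) of the centralizer.
        conjugators-length : ∀ {x h} → Bij h → Conj h x r → length (conjugators x) ≡ length centralizer
        conjugators-length {x} {h} Bh cj = trans (↭P.↭-length (unique⇒↭ (boolFilter-unique _ (Bl-unique n)) (map-unique (compose k) (boolFilter-unique _ (Bl-unique n))
              (λ {z} {z'} _ _ e → app-ext λ p → Bij⇒Inj Bk (trans (sym (app-compose k z p)) (trans (cong (λ w → app w p) e) (app-compose k z' p)))))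
            to from)) (LP.length-map (compose k) centralizer)
          where
          k : SP n
          k = inv h
          Bk : Bij k
          Bk = Bij-inv h Bh
          kx : ∀ p → app x (app k p) ≡ app k (app r p)
          kx p = Bij⇒Inj Bh (trans (sym (conj cj (app k p))) (trans (cong (app r) (app-invʳ h Bh p)) (sym (app-invʳ h Bh (app r p)))))
          from : ∀ {g} → g ∈ L.map (compose k) centralizer → g ∈ conjugators x
          from m with ∈P.∈-map⁻ (compose k) m
          ... | z , m' , refl with InCent⇒ {x = r} {z} (proj₂ (∈-boolFilter⁻ (inCentb r) (Bl n) m'))
          ...   | Bz , cz = ∈-boolFilter⁺ _ (∈-Bl Bg) (≡⇒eqSP (Conj-unique Bg (conjugate-Conj r Bg) (mkConj λ p →
                  trans (cong (app x) (app-compose k z p)) (trans (kx (app z p)) (trans (cong (app k) (comm cz p)) (sym (app-compose k z (app r p))))))))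
            where
            Bg : Bij (compose k z)
            Bg = Bij-compose Bk Bz
          to : ∀ {g} → g ∈ conjugators x → g ∈ L.map (compose k) centralizer
          to {g} m with ∈-boolFilter⁻ _ (Bl n) m
          ... | m' , e = subst (_∈ L.map (compose k) centralizer) (app-ext λ p → trans (app-compose k z p) (trans (cong (app k) (app-compose h g p)) (app-invˡ h Bh (app g p))))
              (∈P.∈-map⁺ (compose k) (∈-boolFilter⁺ (inCentb r) (∈-Bl Bz) (⇒InCent Bz (mkComm λ p →
                trans (cong (app r) (app-compose h g p)) (trans (conj cj (app g p)) (trans (cong (app h) (gx p)) (sym (app-compose h g (app r p)))))))))
            where
            Bg : Bij g
            Bg = Bl⇒Bij m'
            z : SP n
            z = compose h g
            Bz : Bij z
            Bz = Bij-compose Bh Bg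
            gx : ∀ p → app x (app g p) ≡ app g (app r p)
            gx p = trans (cong (λ w → app w (app g p)) (sym (eqSP⇒≡ e))) (conj (conjugate-Conj r Bg) p)

        centralizer≥1 : 1 ≤ length centralizer
        centralizer≥1 = ∈P.∈-length (∈-boolFilter⁺ (inCentb r) (∈-Bl Br) (⇒InCent Br Comm-self))

        -- Transport along g replaces ω^r(g⁻¹ y g) by the value at y for the conjugate g r g⁻¹. Each
        -- conjugate arises from |Z(r)| elements g, which cancels the leading factor.
        ψ-class : ψ ω r y ≈ Σl (Bl n) (λ x → ifK (conjb x r) (term x))
        ψ-class = begin
            ψ ω r y                                                                        ≈⟨ *-congˡ (Σl-cong (Bl n) (λ m → term-conjugate (Bl⇒Bij m))) ⟩
            q * Σl (Bl n) (λ g → term (conjugate g r))                                     ≈⟨ *-congˡ (Σl-cong (Bl n) (λ {g} m → spread g (Bl⇒Bij m))) ⟩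
            q * Σl (Bl n) (λ g → Σl (Bl n) (λ x → ifK (eqSP (conjugate g r) x) (term x))) ≈⟨ *-congˡ (Σl-swap (Bl n) (Bl n) (λ g x → ifK (eqSP (conjugate g r) x) (term x))) ⟩
            q * Σl (Bl n) (λ x → Σl (Bl n) (λ g → ifK (eqSP (conjugate g r) x) (term x))) ≈⟨ *-congˡ (Σl-cong (Bl n) (λ {x} _ → collect x)) ⟩
            q * Σl (Bl n) (λ x → ι (length centralizer) * (ifK (conjb x r) (term x)))     ≈⟨ *-congˡ (Σl-*ˡ (Bl n) _ _) ⟩
            q * (ι (length centralizer) * Σl (Bl n) (λ x → ifK (conjb x r) (term x)))     ≈⟨ *-assoc _ _ _ ⟨
            (q * ι (length centralizer)) * Σl (Bl n) (λ x → ifK (conjb x r) (term x))     ≈⟨ *-congʳ (recip-inverse centralizer≥1) ⟩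
            1# * Σl (Bl n) (λ x → ifK (conjb x r) (term x))                               ≈⟨ *-identityˡ _ ⟩
            Σl (Bl n) (λ x → ifK (conjb x r) (term x))                                    ∎
          where
          q : Carrier
          q = recip (length centralizer)
          spread : ∀ g → Bij g → term (conjugate g r) ≈ Σl (Bl n) (λ x → ifK (eqSP (conjugate g r) x) (term x))
          spread g Bg = ≈-sym (≈-trans (Σl-single (Bl-unique n) {conjugate g r} (∈-Bl (Conj-Bij Bg Br (conjugate-Conj r Bg)))
            (λ {x} _ ne → ifK-false (λ e → ne (sym (eqSP⇒≡ e)))))
            (ifK-true {eqSP (conjugate g r) (conjugate g r)} (≡⇒eqSP {v = conjugate g r} refl)))
          collect : ∀ x → Σl (Bl n) (λ g → ifK (eqSP (conjugate g r) x) (term x)) ≈ ι (length centralizer) * (ifK (conjb x r) (term x))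
          collect x with BP.T? (conjb x r)
          ... | yes t = let (h , Bh , cj) = conjb⁻ t in begin
            Σl (Bl n) (λ g → ifK (eqSP (conjugate g r) x) (term x)) ≈⟨ Σl-filter (λ g → eqSP (conjugate g r) x) (Bl n) (λ _ → term x) ⟨
            Σl (conjugators x) (λ _ → term x)                               ≈⟨ Σl-const (conjugators x) (term x) ⟩
            ι (length (conjugators x)) * term x                             ≈⟨ *-cong (≡⇒≈ (cong ι (conjugators-length Bh cj))) (≈-sym (ifK-true t)) ⟩
            ι (length centralizer) * (ifK (conjb x r) (term x))     ∎
          ... | no t = ≈-trans (Σl-0 (Bl n) (λ {g} m → ifK-false (λ e → t (conjb⁺ (Bl⇒Bij m) (eqSP⇒≡ e)))))
              (≈-sym (≈-trans (*-congˡ (ifK-false t)) (zeroʳ _)))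

    -- Every x is conjugate to exactly one representative, and the condition is constant on classes,
    -- so the classes reassemble to the group.
    Σψ : ∀ {R} → ClassReps n R → (b : SP n → Bool) → (∀ {h x r} → Bij h → Bij x → Conj h x r → b x ≡ b r) →
         Σl (boolFilter b R) (λ r → ψ ω r y) ≈ Σl (Bl n) (λ x → ifK (b x) (term x))
    Σψ {R} (RB , reps) b inv-b = begin
        Σl (boolFilter b R) (λ r → ψ ω r y)                                                   ≈⟨ Σl-filter b R (λ r → ψ ω r y) ⟩
        Σl R (λ r → ifK (b r) (ψ ω r y))                                              ≈⟨ Σl-cong R (λ {r} m → expand r (bij (All.lookup RB m))) ⟩
        Σl R (λ r → Σl (Bl n) (λ x → ifK (conjb x r) (ifK (b x) (term x)))) ≈⟨ Σl-swap R (Bl n) (λ r x → ifK (conjb x r) (ifK (b x) (term x))) ⟩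
        Σl (Bl n) (λ x → Σl R (λ r → ifK (conjb x r) (ifK (b x) (term x)))) ≈⟨ Σl-cong (Bl n) (λ {x} m → collapse x (Bl⇒Bij m)) ⟩
        Σl (Bl n) (λ x → ifK (b x) (term x))                                          ∎
      where
      expand : ∀ r → Bij r → ifK (b r) (ψ ω r y) ≈ Σl (Bl n) (λ x → ifK (conjb x r) (ifK (b x) (term x)))
      expand r Br = begin
        ifK (b r) (ψ ω r y)                                            ≈⟨ ifK-cong refl (λ _ → ψ-class Br) ⟩
        ifK (b r) (Σl (Bl n) (λ x → ifK (conjb x r) (term x)))         ≈⟨ ifK-Σl (b r) (Bl n) _ ⟩
        Σl (Bl n) (λ x → ifK (b r) (ifK (conjb x r) (term x)))         ≈⟨ Σl-cong (Bl n) (λ {x} m → ≈-trans (ifK-swap (b r) (conjb x r) (term x))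
                                                                            (ifK-cong refl (λ t → let (h , Bh , cj) = conjb⁻ Br t in ifK-cong (sym (inv-b Bh (Bl⇒Bij m) cj)) (λ _ → ≈-refl)))) ⟩
        Σl (Bl n) (λ x → ifK (conjb x r) (ifK (b x) (term x)))         ∎
      collapse : ∀ x → Bij x → Σl R (λ r → ifK (conjb x r) (ifK (b x) (term x))) ≈ ifK (b x) (term x)
      collapse x Bx = begin
        Σl R (λ r → ifK (conjb x r) t)  ≈⟨ Σl-filter (conjb x) R (λ _ → t) ⟨
        Σl (boolFilter (conjb x) R) (λ _ → t)     ≈⟨ Σl-const (boolFilter (conjb x) R) t ⟩
        ι (length (boolFilter (conjb x) R)) * t   ≈⟨ *-congʳ (≈-trans (≡⇒≈ (cong ι (reps x (isB Bx)))) (+-identityʳ 1#)) ⟩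
        1# * t                                    ≈⟨ *-identityˡ t ⟩
        t                                         ∎
        where
        t : Carrier
        t = ifK (b x) (term x)

  -- The value of ω on a single block

  module BlockValue {y : SP n} (By : Bij y) (c : Pt n) where
    blockValue : SP n → Carrier
    blockValue x = ω x (restrict y (block x y c))

    ρ-cong : ∀ {x} → Bij x → ∀ {a b} → iterApp x a c ≡ iterApp x b c → powK (ρ x c) a ≈ powK (ρ x c) b
    ρ-cong {x} B {a} {b} e = begin
      powK r a                               ≈⟨ *-identityʳ _ ⟨
      powK r a * 1#                          ≈⟨ *-congˡ (ρ-fix⇒1 B c (b' +ℕ b) (trans (iter-+ x b' b c) (trans (cong (λ k → iterApp x k (iterApp x b c)) (ℕP.*-comm (M n ∸ 1) b)) (iter-back B b c)))) ⟨
      powK r a * powK r (b' +ℕ b)            ≈⟨ *-congˡ (powK-+ r b' b) ⟩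
      powK r a * (powK r b' * powK r b)      ≈⟨ *-assoc _ _ _ ⟨
      powK r a * powK r b' * powK r b        ≈⟨ *-congʳ (powK-+ r a b') ⟨
      powK r (a +ℕ b') * powK r b            ≈⟨ *-congʳ (ρ-fix⇒1 B c (a +ℕ b') (ratio B a b false e)) ⟩
      1# * powK r b                          ≈⟨ *-identityˡ _ ⟩
      powK r b                               ∎
      where
      r : Carrier
      r = ρ x c
      b' : ℕ
      b' = (M n ∸ 1) *ℕ b

    module _ {x : SP n} (Bx : Bij x) (xy : Comm x y) where

      -- On its block y permutes the d cycles of x cyclically, which is the situation of `value`;
      -- the return y^d c = ± x^t c supplies the exponent.
      blockValue≈ : ∀ {d t s} → FirstReturn x y c d → iterApp y d c ≡ flip s (iterApp x t c) → Reduced x c s → blockValue x ≈ powK (ρ x c) t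
      blockValue≈ {suc d} {t} {s} fr e red = value d Bx (restrict-Bij {z = y} {Q} By Qn Qy) (restrict-Comm {z = y} {Q} Qn Qx xy)
          {c} {t} {s} (trans (z-iter (suc d)) e) red
          (λ l l≥ l≤ h → proj₂ (proj₂ fr) l l≥ (s≤s l≤) (subst (T ∘ inCyc x c) (z-iter l) h))
          (λ p → support p (BP.T? (Q p)))
        where
        Q : Pt n → Bool
        Q = block x y c
        Qn : NegInvariant Q
        Qn = block-neg Bx By c
        Qx : Stable x Q
        Qx = block-stableˣ Bx By c
        Qy : Stable y Q
        Qy = block-stableʸ Bx By xy c
        z : SP n
        z = restrict y Q
        z-iter : ∀ l → iterApp z l c ≡ iterApp y l c
        z-iter l = iter-restrict-in {z = y} {Q} Qn Qy l (block-refl Bx By c)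
        step : ∀ l → l ≤ d → ∃ λ l' → l' ≤ d × T (inCyc x (iterApp y l' c) (iterApp y (suc l) c))
        step l l≤ with ℕP.m≤n⇒m<n∨m≡n l≤
        ... | inj₁ l< = suc l , l< , inCyc-refl Bx (iterApp y (suc l) c)
        ... | inj₂ refl = 0 , z≤n , proj₁ (proj₂ fr)
        reduce : ∀ b → ∃ λ l → l ≤ d × T (inCyc x (iterApp y l c) (iterApp y b c))
        reduce zero = 0 , z≤n , inCyc-refl Bx c
        reduce (suc b) = let (l , l≤ , h) = reduce b ; (l' , l'≤ , h') = step l l≤ in
          l' , l'≤ , inCyc-trans Bx h' (subst T (sym (inCyc-Comm Bx By xy (iterApp y l c) (iterApp y b c))) h)
        support : ∀ p → Dec (T (Q p)) → app z p ≡ p ⊎ (∃ λ l → l ≤ d × T (inCyc x (iterApp z l c) p))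
        support p (no h)  = inj₁ (restrict-out {z = y} {Q} Qn {p} h)
        support p (yes h) = let (b , k) = block⁻ Bx By {c} {p} h ; (l , l≤ , k') = reduce b in
          inj₂ (l , l≤ , subst (λ q → T (inCyc x q p)) (sym (z-iter l)) (inCyc-trans Bx k' k))

      -- The s-th power of the block value is 1 iff x^(st) c = c, that of θ^(-j) iff y^(sj) c = c;
      -- `order-transfer`, applied in both directions, makes these conditions equivalent.
      blockValue-order : ∀ {m j g} → FirstReturn y x c m → iterApp x m c ≡ flip g (iterApp y j c) → Reduced y c g →
        ∃ λ N → N ∣ M n × Order (blockValue x) N × Order (powK (ρ y c) ((M n ∸ 1) *ℕ j)) N
      blockValue-order {m} {j} {g} fr em red = N , N∣ (M n) fixM ,
          order (λ s h → N∣ s (v⇒fix s h)) (λ s h → fix⇒v s (∣N s h)) , order (λ s h → N∣ s (w⇒fix s h)) (λ s h → fix⇒w s (∣N s h))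
        where
        Fix : ℕ → Set
        Fix s = iterApp y (s *ℕ j) c ≡ c
        fixM : Fix (M n)
        fixM = trans (cong (λ a → iterApp y a c) (ℕP.*-comm (M n) j)) (iter-multiple y (iter-M By c) (divides j refl))
        found : ∃ (IsLeast Fix)
        found = leastPositive (λ s → iterApp y (s *ℕ j) c ≟ₚ c) (M n) (M≥1 n) fixM
        N : ℕ
        N = proj₁ found
        N∣ : ∀ s → Fix s → N ∣ s
        N∣ = least-divides (proj₂ found) λ a h → trans (sym (trans (cong (λ b → iterApp y b c) (trans (ℕP.*-distribʳ-+ j N a) (ℕP.+-comm (N *ℕ j) (a *ℕ j))))
          (trans (iter-+ y (a *ℕ j) (N *ℕ j) c) (cong (iterApp y (a *ℕ j)) (proj₁ (proj₂ (proj₂ found))))))) h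
        ∣N : ∀ s → N ∣ s → Fix s
        ∣N _ (divides q refl) = iter-multiple y (proj₁ (proj₂ (proj₂ found))) (divides q (ℕP.*-assoc q N j))
        ret : ∃ (FirstReturn x y c)
        ret = firstReturn Bx By c
        d : ℕ
        d = proj₁ ret
        rd : ∃₂ λ t s → iterApp y d c ≡ flip s (iterApp x t c) × Reduced x c s
        rd = inCyc-reduced Bx (proj₁ (proj₂ (proj₂ ret)))
        t : ℕ
        t = proj₁ rd
        v≈ : blockValue x ≈ powK (ρ x c) t
        v≈ = blockValue≈ {d} {t} {proj₁ (proj₂ rd)} (proj₂ ret) (proj₁ (proj₂ (proj₂ rd))) (proj₂ (proj₂ (proj₂ rd)))
        v⇒fix : ∀ s → powK (blockValue x) s ≈ 1# → Fix s
        v⇒fix s h = order-transfer Bx By xy {c} {d} {t} {proj₁ (proj₂ rd)} {m} {j} {g} (proj₂ ret) (proj₁ (proj₂ (proj₂ rd))) (proj₂ (proj₂ (proj₂ rd))) em red s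
          (ρ-1⇒fix Bx c (s *ℕ t) (≈-trans (powK-* (ρ x c) s t) (≈-trans (powK-cong (≈-sym v≈) s) h)))
        fix⇒v : ∀ s → Fix s → powK (blockValue x) s ≈ 1#
        fix⇒v s h = ≈-trans (powK-cong v≈ s) (≈-trans (≈-sym (powK-* (ρ x c) s t)) (ρ-fix⇒1 Bx c (s *ℕ t)
          (order-transfer By Bx (Comm-sym xy) {c} {m} {j} {g} {d} {t} {proj₁ (proj₂ rd)} fr em red (proj₁ (proj₂ (proj₂ rd))) (proj₂ (proj₂ (proj₂ rd))) s h)))
        w⇒fix : ∀ s → powK (powK (ρ y c) ((M n ∸ 1) *ℕ j)) s ≈ 1# → Fix s
        w⇒fix s h = trans (cong (iterApp y (s *ℕ j)) (sym eN))
            (trans (sym (iter-+ y (s *ℕ j) (s *ℕ ((M n ∸ 1) *ℕ j)) c)) (iter-multiple y (iter-M By c) (divides (s *ℕ j) eq)))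
          where
          eN : iterApp y (s *ℕ ((M n ∸ 1) *ℕ j)) c ≡ c
          eN = ρ-1⇒fix By c (s *ℕ ((M n ∸ 1) *ℕ j)) (≈-trans (powK-* (ρ y c) s ((M n ∸ 1) *ℕ j)) h)
          eq : s *ℕ j +ℕ s *ℕ ((M n ∸ 1) *ℕ j) ≡ s *ℕ j *ℕ M n
          eq = trans (sym (ℕP.*-distribˡ-+ s j ((M n ∸ 1) *ℕ j))) (trans (cong (s *ℕ_) (M*-suc n j)) (sym (ℕP.*-assoc s j (M n))))
        fix⇒w : ∀ s → Fix s → powK (powK (ρ y c) ((M n ∸ 1) *ℕ j)) s ≈ 1#
        fix⇒w s h = ≈-trans (≈-sym (powK-* (ρ y c) s ((M n ∸ 1) *ℕ j))) (ρ-fix⇒1 By c (s *ℕ ((M n ∸ 1) *ℕ j))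
          (iter-multiple y h (divides (M n ∸ 1) (trans (sym (ℕP.*-assoc s (M n ∸ 1) j)) (trans (cong (_*ℕ j) (ℕP.*-comm s (M n ∸ 1))) (ℕP.*-assoc (M n ∸ 1) s j))))))

    module _ {x : SP n} (Bx : Bij x) (xy : Comm x y) {m : ℕ} (fr : FirstReturn y x c m) {j₀ : ℕ} {f₀ : Bool} (em₀ : iterApp x m c ≡ flip f₀ (iterApp y j₀ c)) where
      open Twists Bx By xy c fr {j₀} {f₀} em₀

      -- Both twists have the same orbit through c, hence the same ρ and the same first return d of
      -- y. The exponent t₂ with y^d c = ± X₂^t₂ c is a multiple of m, because that point is on the
      -- y-cycle; so X₂^t₂ c = X₁^(u t₂) c, which has to be X₁^t₁ c.
      blockValue-galois : ∀ {j j' u u' g} → iterApp y j' c ≡ iterApp y (u *ℕ j) c → bmul u g ≡ g → iterApp y j c ≡ iterApp y (u' *ℕ j') c → bmul u' g ≡ g →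
        powK (blockValue (X j' g)) u ≈ blockValue (X j g)
      blockValue-galois {j} {j'} {u} {u'} {g} e eg e' eg' = begin
          powK (blockValue X₂) u        ≈⟨ powK-cong (blockValue≈ (X-Bij j' g) (X-Comm j' g) {d} {t₂} {s₂} fr₂ (proj₁ (proj₂ (proj₂ rd₂))) (proj₂ (proj₂ (proj₂ rd₂)))) u ⟩
          powK (powK (ρ X₂ c) t₂) u     ≈⟨ powK-* (ρ X₂ c) u t₂ ⟨
          powK (ρ X₂ c) (u *ℕ t₂)       ≈⟨ ≡⇒≈ (cong (λ r → powK r (u *ℕ t₂)) ρ≡) ⟩
          powK (ρ X₁ c) (u *ℕ t₂)       ≈⟨ ρ-cong (X-Bij j g) (same-sign (X-Bij j g) {u *ℕ t₂} {t₁} {s₂} {s₁} {c}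
                                              (λ h → proj₂ (proj₂ (proj₂ rd₂)) (subst T (sym neg≡) h)) (proj₂ (proj₂ (proj₂ rd₁)))
                                              (trans (cong (flip s₂) (sym scaled)) (trans (sym (proj₁ (proj₂ (proj₂ rd₂)))) (proj₁ (proj₂ (proj₂ rd₁)))))) ⟩
          powK (ρ X₁ c) t₁              ≈⟨ blockValue≈ (X-Bij j g) (X-Comm j g) {d} {t₁} {s₁} (proj₂ ret) (proj₁ (proj₂ (proj₂ rd₁))) (proj₂ (proj₂ (proj₂ rd₁))) ⟨
          blockValue X₁                 ∎
        where
        X₁ X₂ : SP n
        X₁ = X j g
        X₂ = X j' g
        orb≡ : ∀ p → inOrb X₂ c p ≡ inOrb X₁ c p
        orb≡ p = T-ext (orbit-scaled {j} {j'} {u} {g} e eg) (orbit-scaled {j'} {j} {u'} {g} e' eg')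
        cyc≡ : ∀ p → inCyc X₂ c p ≡ inCyc X₁ c p
        cyc≡ p = cong₂ _∨_ (orb≡ p) (orb≡ (neg p))
        neg≡ : isNegCls X₂ c ≡ isNegCls X₁ c
        neg≡ = orb≡ (neg c)
        ρ≡ : ρ X₂ c ≡ ρ X₁ c
        ρ≡ = cong₂ (λ b l → if b then ρ⁻ l else ρ⁺ l) neg≡
          (cong₂ (λ b l → if b then ⌊ l /2⌋ else l) neg≡ (cong length (boolFilter-cong orb≡ (allPt n))))
        ret : ∃ (FirstReturn X₁ y c)
        ret = firstReturn (X-Bij j g) By c
        d : ℕ
        d = proj₁ ret
        fr₂ : FirstReturn X₂ y c d
        fr₂ = let (l , h , mn) = proj₂ ret in l , subst T (sym (cyc≡ (iterApp y d c))) h , λ a a≥ a< k → mn a a≥ a< (subst T (cyc≡ (iterApp y a c)) k)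
        rd₁ : ∃₂ λ t s → iterApp y d c ≡ flip s (iterApp X₁ t c) × Reduced X₁ c s
        rd₁ = inCyc-reduced (X-Bij j g) (proj₁ (proj₂ (proj₂ ret)))
        rd₂ : ∃₂ λ t s → iterApp y d c ≡ flip s (iterApp X₂ t c) × Reduced X₂ c s
        rd₂ = inCyc-reduced (X-Bij j' g) (proj₁ (proj₂ fr₂))
        t₁ t₂ : ℕ
        t₁ = proj₁ rd₁
        t₂ = proj₁ rd₂
        s₁ s₂ : Bool
        s₁ = proj₁ (proj₂ rd₁)
        s₂ = proj₁ (proj₂ rd₂)
        m∣t₂ : m ∣ t₂
        m∣t₂ = firstReturn-divides By (Comm-sym (X-Comm j' g)) (X-first j' g) t₂
          (inCyc⁺ By d s₂ (proj₁ (proj₂ (proj₂ rd₂))))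
        scaled : iterApp X₂ t₂ c ≡ iterApp X₁ (u *ℕ t₂) c
        scaled = subst (λ t → iterApp X₂ t c ≡ iterApp X₁ (u *ℕ t) c) (sym (ℕ∣._∣_.equality m∣t₂))
          (trans (X-power-scaled {j} {j'} {u} {g} e eg q) (cong (λ a → iterApp X₁ a c) (trans (cong (_*ℕ m) (ℕP.*-comm q u)) (ℕP.*-assoc u q m))))
          where
          q : ℕ
          q = ℕ∣._∣_.quotient m∣t₂

  -- The identity on a single block

  module Local {y : SP n} (By : Bij y) (p₀ : Pt n) where
    open BlockValue By p₀

    -- -1 already acts on the y-cycle of p₀ as a power of y when the class of the cycle is -1
    signs : List Bool
    signs = if isNegCls y p₀ then false ∷ [] else false ∷ true ∷ []

    private
      L : ℕ
      L = M n
      θ : Carrier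
      θ = ρ y p₀
      N : ℕ
      N = orbLen y p₀
      oθ : Order θ N
      oθ = ρ-Order By p₀
      N∣M : N ∣ M n
      N∣M = orbLen-divides By (M n) (iter-M By p₀)

      -- The congruence k'l = 1 modulo the orbit length `N`, read off at `p₀`.
      hits : ℕ → ℕ → Bool
      hits k' l = eqPt (iterApp y (k' *ℕ l) p₀) (app y p₀)

      minus-one : ∀ {a} → a * a ≈ 1# → ¬ a ≈ 1# → a ≈ - 1#
      minus-one {a} sq ne = +-cancelʳ 1# (≈-trans (fixed⇒zero ne (begin
        a * (a + 1#)       ≈⟨ distribˡ a a 1# ⟩
        a * a + a * 1#     ≈⟨ +-cong sq (*-identityʳ a) ⟩
        1# + a             ≈⟨ +-comm 1# a ⟩
        a + 1#             ∎)) (≈-sym (-‿inverseˡ 1#)))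

      -- Fourier inversion in the two exponents j and l
      fourier : ∀ k' i h → iterApp y i p₀ ≡ flip h p₀ →
        Σ< L (λ j → ifK (eqPt (iterApp y (k' *ℕ j) p₀) (flip h p₀)) (powK θ ((L ∸ 1) *ℕ j))) ≈
        Σ< L (λ l → ifK (hits k' l) (powK θ (l *ℕ i)))
      fourier k' i h e = ι-cancel (M≥1 n) (begin
          ι L * Σ< L (λ j → ifK (P j) (w j))                                            ≈⟨ Σl-*ˡ (upTo L) (ι L) (λ j → ifK (P j) (w j)) ⟨
          Σ< L (λ j → ι L * ifK (P j) (w j))                                            ≈⟨ Σ<-cong L expand ⟩
          Σ< L (λ j → Σ< L (λ l → powK θ (l *ℕ i) * powK θ (j *ℕ (k' *ℕ l +ℕ (L ∸ 1)))))     ≈⟨ Σl-swap (upTo L) (upTo L) (λ j l → powK θ (l *ℕ i) * powK θ (j *ℕ (k' *ℕ l +ℕ (L ∸ 1)))) ⟩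
          Σ< L (λ l → Σ< L (λ j → powK θ (l *ℕ i) * powK θ (j *ℕ (k' *ℕ l +ℕ (L ∸ 1)))))     ≈⟨ Σ<-cong L collect ⟩
          Σ< L (λ l → ι L * ifK (Q l) (powK θ (l *ℕ i)))                                ≈⟨ Σl-*ˡ (upTo L) (ι L) (λ l → ifK (Q l) (powK θ (l *ℕ i))) ⟩
          ι L * Σ< L (λ l → ifK (Q l) (powK θ (l *ℕ i)))                                ∎)
        where
        P Q : ℕ → Bool
        P j = eqPt (iterApp y (k' *ℕ j) p₀) (flip h p₀)
        Q   = hits k'
        w : ℕ → Carrier
        w j = powK θ ((L ∸ 1) *ℕ j)
        -- y^i contributes the same sign h as the condition does, and the two cancel.
        P≡ : ∀ j → ⌊ N ∣? (k' *ℕ j +ℕ i) ⌋ ≡ P j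
        P≡ j = T-ext
          (λ t → ≡⇒eqPt (flip-inj h (trans (sym (trans (cong (iterApp y (k' *ℕ j)) e) (app-iter-flip y (k' *ℕ j) h p₀)))
            (trans (trans (sym (iter-+ y (k' *ℕ j) i p₀)) (iter-multiple y (iter-orbLen By p₀) (toWitness t))) (sym (flip-flip h p₀))))))
          (λ t → fromWitness (orbLen-divides By (k' *ℕ j +ℕ i) (trans (iter-+ y (k' *ℕ j) i p₀) (trans (cong (iterApp y (k' *ℕ j)) e)
            (trans (app-iter-flip y (k' *ℕ j) h p₀) (trans (cong (flip h) (eqPt⇒≡ t)) (flip-flip h p₀)))))))
        -- Modulo N the summand L - 1 is -1, as N divides L.
        Q≡ : ∀ l → ⌊ N ∣? (k' *ℕ l +ℕ (L ∸ 1)) ⌋ ≡ Q l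
        Q≡ l = T-ext
          (λ t → ≡⇒eqPt (iter-inj By (L ∸ 1) (trans (sym (iter-+ y (L ∸ 1) (k' *ℕ l) p₀)) (trans (cong (λ a → iterApp y a p₀) (ℕP.+-comm (L ∸ 1) (k' *ℕ l)))
            (trans (iter-multiple y (iter-orbLen By p₀) (toWitness t)) (sym back))))))
          (λ t → fromWitness (orbLen-divides By (k' *ℕ l +ℕ (L ∸ 1)) (trans (cong (λ a → iterApp y a p₀) (ℕP.+-comm (k' *ℕ l) (L ∸ 1))) (trans (iter-+ y (L ∸ 1) (k' *ℕ l) p₀)
            (trans (cong (iterApp y (L ∸ 1)) (eqPt⇒≡ t)) back)))))
          where
          back : iterApp y (L ∸ 1) (app y p₀) ≡ p₀
          back = trans (cong (λ a → iterApp y a (app y p₀)) (sym (ℕP.*-identityˡ (L ∸ 1)))) (iter-back By 1 p₀)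
        exponent : ∀ j l → l *ℕ (k' *ℕ j +ℕ i) +ℕ (L ∸ 1) *ℕ j ≡ l *ℕ i +ℕ j *ℕ (k' *ℕ l +ℕ (L ∸ 1))
        exponent j l = trans (cong (_+ℕ (L ∸ 1) *ℕ j) (trans (ℕP.*-distribˡ-+ l (k' *ℕ j) i) (ℕP.+-comm (l *ℕ (k' *ℕ j)) (l *ℕ i))))
          (trans (ℕP.+-assoc (l *ℕ i) (l *ℕ (k' *ℕ j)) ((L ∸ 1) *ℕ j)) (cong (l *ℕ i +ℕ_) (trans (cong₂ _+ℕ_ (trans (sym (ℕP.*-assoc l k' j)) (trans (cong (_*ℕ j) (ℕP.*-comm l k')) (ℕP.*-comm (k' *ℕ l) j))) (ℕP.*-comm (L ∸ 1) j))
            (sym (ℕP.*-distribˡ-+ j (k' *ℕ l) (L ∸ 1))))))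
        expand : ∀ j → ι L * ifK (P j) (w j) ≈ Σ< L (λ l → powK θ (l *ℕ i) * powK θ (j *ℕ (k' *ℕ l +ℕ (L ∸ 1))))
        expand j = begin
          ι L * ifK (P j) (w j)                                     ≈⟨ ifK-*ˡ (P j) (ι L) (w j) ⟩
          ifK (P j) (ι L * w j)                                     ≈⟨ ifK-cong refl (λ _ → *-comm (ι L) (w j)) ⟩
          ifK (P j) (w j * ι L)                                     ≈⟨ ifK-*ˡ (P j) (w j) (ι L) ⟨
          w j * ifK (P j) (ι L)                                     ≈⟨ *-congˡ (≡⇒≈ (cong (λ b → ifK b (ι L)) (P≡ j))) ⟨
          w j * ifK ⌊ N ∣? (k' *ℕ j +ℕ i) ⌋ (ι L)                   ≈⟨ *-congˡ (orthogonality oθ N∣M (k' *ℕ j +ℕ i)) ⟨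
          w j * Σ< L (λ l → powK θ (l *ℕ (k' *ℕ j +ℕ i)))           ≈⟨ Σl-*ˡ (upTo L) (w j) (λ l → powK θ (l *ℕ (k' *ℕ j +ℕ i))) ⟨
          Σ< L (λ l → w j * powK θ (l *ℕ (k' *ℕ j +ℕ i)))           ≈⟨ Σ<-cong L (λ l → ≈-trans (*-comm _ _) (≈-trans (≈-sym (powK-+ θ (l *ℕ (k' *ℕ j +ℕ i)) ((L ∸ 1) *ℕ j))) (≈-trans (≡⇒≈ (cong (powK θ) (exponent j l))) (powK-+ θ (l *ℕ i) _)))) ⟩
          Σ< L (λ l → powK θ (l *ℕ i) * powK θ (j *ℕ (k' *ℕ l +ℕ (L ∸ 1)))) ∎
        collect : ∀ l → Σ< L (λ j → powK θ (l *ℕ i) * powK θ (j *ℕ (k' *ℕ l +ℕ (L ∸ 1)))) ≈ ι L * ifK (Q l) (powK θ (l *ℕ i))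
        collect l = begin
          Σ< L (λ j → powK θ (l *ℕ i) * powK θ (j *ℕ (k' *ℕ l +ℕ (L ∸ 1)))) ≈⟨ Σl-*ˡ (upTo L) (powK θ (l *ℕ i)) (λ j → powK θ (j *ℕ (k' *ℕ l +ℕ (L ∸ 1)))) ⟩
          powK θ (l *ℕ i) * Σ< L (λ j → powK θ (j *ℕ (k' *ℕ l +ℕ (L ∸ 1)))) ≈⟨ *-congˡ (≈-trans (orthogonality oθ N∣M (k' *ℕ l +ℕ (L ∸ 1))) (≡⇒≈ (cong (λ b → ifK b (ι L)) (Q≡ l)))) ⟩
          powK θ (l *ℕ i) * ifK (Q l) (ι L)                                 ≈⟨ ifK-*ˡ (Q l) _ (ι L) ⟩
          ifK (Q l) (powK θ (l *ℕ i) * ι L)                                 ≈⟨ ifK-cong refl (λ _ → *-comm _ _) ⟩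
          ifK (Q l) (ι L * powK θ (l *ℕ i))                                 ≈⟨ ifK-*ˡ (Q l) (ι L) _ ⟨
          ι L * ifK (Q l) (powK θ (l *ℕ i))                                 ∎

    module _ {x : SP n} (Bx : Bij x) (xy : Comm x y) (k : ℕ) (b : Bool) where

      private
        ret : ∃ (FirstReturn y x p₀)
        ret = firstReturn By Bx p₀
        m : ℕ
        m = proj₁ ret
        rd : ∃₂ λ j s → iterApp x m p₀ ≡ flip s (iterApp y j p₀) × Reduced y p₀ s
        rd = inCyc-reduced By (proj₁ (proj₂ (proj₂ ret)))
        j₀ : ℕ
        j₀ = proj₁ rd
        f₀ : Bool
        f₀ = proj₁ (proj₂ rd)
        em₀ : iterApp x m p₀ ≡ flip f₀ (iterApp y j₀ p₀)
        em₀ = proj₁ (proj₂ (proj₂ rd))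
        open Twists Bx By xy p₀ (proj₂ ret) {j₀} {f₀} em₀

        Z : ℕ → Bool → SP n
        Z a e = compose x (twist y p₀ a e)

        lhs rhs : SP n → Carrier
        lhs x' = ifK (eqPt (iterApp x' k p₀) (flip b p₀)) (blockValue x')
        rhs x' = ifK (eqPt (iterApp x' k p₀) (app y p₀)) (sgn b (isNegCls x' p₀))

        Σlhs Σrhs : Bool → Carrier
        Σlhs g = Σ< L (λ j → lhs (X j g))
        Σrhs g = Σ< L (λ j → rhs (X j g))

        -- The exponent is shifted by J, harmless by periodicity, and the sign by f₀. The latter
        -- permutes the two signs, or is trivial by reducedness when only one is listed.
        reindex : ∀ (f : SP n → Carrier) → Σl signs (λ e → Σ< L (λ a → f (Z a e))) ≈ Σl signs (λ g → Σ< L (λ j → f (X j g)))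
        reindex f = ≈-sym (≈-trans (Σl-cong signs (λ {g} _ → ≈-trans (Σ<-cong L (λ j → ≡⇒≈ (cong f (X-twist j g)))) (Σ<-shift L (λ a → f (Z a (g xor f₀))) (λ a → ≡⇒≈ (cong (λ t → f (compose x t)) (twist-periodic By p₀ a (g xor f₀)))) J)))
            (permute (isNegCls y p₀) f₀ (proj₂ (proj₂ (proj₂ rd)))))
          where
          G : Bool → Carrier
          G e = Σ< L (λ a → f (Z a e))
          permute : ∀ s f → (T s → f ≡ false) → Σl (if s then false ∷ [] else false ∷ true ∷ []) (λ g → G (g xor f)) ≈ Σl (if s then false ∷ [] else false ∷ true ∷ []) G
          permute true  f     h = ≡⇒≈ (cong (λ s → G s + 0#) (h tt))
          permute false false _ = ≈-refl
          permute false true  _ = ≈-trans (+-congˡ (+-identityʳ _)) (≈-trans (+-comm _ _) (+-congˡ (≈-sym (+-identityʳ _))))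

        in-C⇒divides : ∀ j g a {q} → iterApp (X j g) a p₀ ≡ q → T (inCyc y p₀ q) → m ∣ a
        in-C⇒divides j g a e h = firstReturn-divides By (Comm-sym (X-Comm j g)) (X-first j g) a (subst (T ∘ inCyc y p₀) (sym e) h)

        C-flip : ∀ s → T (inCyc y p₀ (flip s p₀))
        C-flip s = inCyc-iter By 0 s p₀

        C-y : T (inCyc y p₀ (app y p₀))
        C-y = inCyc⁺ By 1 false refl

        -- X^k p₀ is then off the y-cycle of p₀, while both prescribed values lie on it.
        vanishing : ¬ (m ∣ k) → Σl signs Σlhs ≈ Σl signs Σrhs
        vanishing ne = Σl-cong signs λ {g} _ → Σ<-cong L λ j →
          ≈-trans (ifK-≢ (iterApp (X j g) k p₀) (flip b p₀) (blockValue (X j g)) (λ e → ne (in-C⇒divides j g k e (C-flip b))))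
            (≈-sym (ifK-≢ (iterApp (X j g) k p₀) (app y p₀) (sgn b (isNegCls (X j g) p₀)) (λ e → ne (in-C⇒divides j g k e C-y))))

        module _ (k' : ℕ) (k≡ : k ≡ k' *ℕ m) where

          kth : ∀ j g → iterApp (X j g) k p₀ ≡ flip (bmul k' g) (iterApp y (k' *ℕ j) p₀)
          kth j g = trans (cong (λ a → iterApp (X j g) a p₀) k≡) (X-power j g k')

          -- `galois` applies to the block values and the powers of θ. The exponent -j rather than j
          -- is chosen so that `fourier` ends in k'l = 1 and not in k'l = -1, which would belong to
          -- the inverse of y.
          to-θ : ∀ g → Reduced y p₀ g → Σlhs g ≈ Σ< L (λ j → ifK (eqPt (iterApp (X j g) k p₀) (flip b p₀)) (powK θ ((L ∸ 1) *ℕ j)))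
          to-θ g red = galois L≥2 (λ j → blockValue (X j g)) (λ j → powK θ ((L ∸ 1) *ℕ j)) cond
              (λ j _ → blockValue-order (X-Bij j g) (X-Comm j g) (X-first j g) (X-return j g) red)
              (λ u gc j → let (u' , e) = coprime-inverse L≥2 {u} gc in T-ext
                (λ t → condition {(u *ℕ j) ℕD.% L} {j} {u'} (back u' u j e) (bmul-unit {n} {u} {u'} (trans (cong (ℕD._% M n) (ℕP.*-comm u u')) e)) t)
                (condition {j} {(u *ℕ j) ℕD.% L} {u} (reduce (u *ℕ j)) (bmul-unit {n} {u'} {u} e)))
              (λ u gc j → let (u' , e) = coprime-inverse L≥2 {u} gc in
                blockValue-galois Bx xy (proj₂ ret) {j₀} {f₀} em₀ {j} {(u *ℕ j) ℕD.% L} {u} {u'} {g} (reduce (u *ℕ j)) (bmul-unit {n} {u'} {u} e g)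
                  (back u' u j e) (bmul-unit {n} {u} {u'} (trans (cong (ℕD._% M n) (ℕP.*-comm u u')) e) g))
              (λ u _ j → ≈-trans (ρ-cong By (exponents u j)) (powK-* θ u ((L ∸ 1) *ℕ j)))
            where
            instance
              nz : NonZero (M n)
              nz = M-nonZero n
            L≥2 : 2 ≤ M n
            L≥2 with M-even n | M≥1 n
            ... | zero , e  | h = ⊥-elim (ℕP.<⇒≢ h (sym e))
            ... | suc a , e | _ = subst (2 ≤_) (sym e) (s≤s (subst (1 ≤_) (sym (ℕP.+-suc a a)) (s≤s z≤n)))
            cond : ℕ → Bool
            cond j = eqPt (iterApp (X j g) k p₀) (flip b p₀)
            reduce : ∀ a → iterApp y (a ℕD.% L) p₀ ≡ iterApp y a p₀
            reduce a = iter-% {x = y} (M n) (iter-M By p₀) a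
            back : ∀ u' u j → (u' *ℕ u) ℕD.% L ≡ 1 → iterApp y j p₀ ≡ iterApp y (u' *ℕ ((u *ℕ j) ℕD.% L)) p₀
            back u' u j e = trans (sym (reduce j)) (trans (cong (λ a → iterApp y a p₀) (sym (inverse-mod u' u j L≥2 e))) (reduce (u' *ℕ ((u *ℕ j) ℕD.% L))))
            -- The condition on j says y^(k'j) p₀ = ± p₀ with a fixed sign; the u-th power preserves
            -- the sign because u is odd.
            condition : ∀ {j j' u} → iterApp y j' p₀ ≡ iterApp y (u *ℕ j) p₀ → (∀ s → bmul u s ≡ s) → T (cond j) → T (cond j')
            condition {j} {j'} {u} e eu t = ≡⇒eqPt (trans (kth j' g) (trans (cong (flip s) eq) (trans (flip-xor s (s xor b) p₀) (cong (λ s → flip s p₀) (xor-cancelˡ s b)))))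
              where
              s : Bool
              s = bmul k' g
              old : iterApp y (k' *ℕ j) p₀ ≡ flip (s xor b) p₀
              old = flip-cancel s b (trans (sym (kth j g)) (eqPt⇒≡ t))
              eq : iterApp y (k' *ℕ j') p₀ ≡ flip (s xor b) p₀
              eq = trans (iter-power Comm-self {j'} {u *ℕ j} {false} {p₀} e k') (trans (cong₂ (λ s a → flip s (iterApp y a p₀)) (bmul-false k')
                (trans (sym (ℕP.*-assoc k' u j)) (trans (cong (_*ℕ j) (ℕP.*-comm k' u)) (ℕP.*-assoc u k' j))))
                (trans (iter-flip-power {n} {y} {k' *ℕ j} {s xor b} {p₀} old u) (cong (λ s → flip s p₀) (eu (s xor b)))))
            exponents : ∀ u j → iterApp y ((L ∸ 1) *ℕ ((u *ℕ j) ℕD.% L)) p₀ ≡ iterApp y (u *ℕ ((L ∸ 1) *ℕ j)) p₀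
            exponents u j = trans (iter-power Comm-self {(u *ℕ j) ℕD.% L} {u *ℕ j} {false} {p₀} (reduce (u *ℕ j)) (L ∸ 1))
              (cong₂ (λ s a → flip s (iterApp y a p₀)) (bmul-false (L ∸ 1)) (trans (sym (ℕP.*-assoc (L ∸ 1) u j)) (trans (cong (_*ℕ j) (ℕP.*-comm (L ∸ 1) u)) (ℕP.*-assoc u (L ∸ 1) j))))

          -- The number of solutions of k'l = 1 below the common period. Each of the sums compared
          -- below is this number, its negative or 0.
          count : Carrier
          count = Σ< L (λ l → ifK (hits k' l) 1#)

          -- With matching signs the condition is y^(k'j) p₀ = p₀, and inversion with i = 0 has all
          -- weights equal to 1.
          lhs≈count : ∀ g → Reduced y p₀ g → bmul k' g ≡ b → Σlhs g ≈ count
          lhs≈count g red e = ≈-trans (to-θ g red) (≈-trans (Σ<-cong L (λ j → ≡⇒≈ (cong (λ t → ifK t (powK θ ((L ∸ 1) *ℕ j))) (cond≡ j))))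
              (≈-trans (fourier k' 0 false refl) (Σ<-cong L (λ l → ifK-cong refl (λ _ → ≡⇒≈ (cong (powK θ) (ℕP.*-zeroʳ l)))))))
            where
            cond≡ : ∀ j → eqPt (iterApp (X j g) k p₀) (flip b p₀) ≡ eqPt (iterApp y (k' *ℕ j) p₀) p₀
            cond≡ j = eqPt-⇔ (iterApp (X j g) k p₀) (flip b p₀) (iterApp y (k' *ℕ j) p₀) p₀
              (λ t → flip-inj b (trans (sym (trans (kth j g) (cong (λ s → flip s (iterApp y (k' *ℕ j) p₀)) e))) t))
              (λ t → trans (kth j g) (cong₂ flip e t))

          rhs≈count : ∀ g → bmul k' g ≡ false → (∀ j → T (hits k' j) → sgn b (isNegCls (X j g) p₀) ≈ 1#) → Σrhs g ≈ count
          rhs≈count g e h = Σ<-cong L (λ j → ifK-cong (cond≡ j) (λ t → h j (subst T (cond≡ j) t)))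
            where
            cond≡ : ∀ j → eqPt (iterApp (X j g) k p₀) (app y p₀) ≡ hits k' j
            cond≡ j = cong (λ q → eqPt q (app y p₀)) (trans (kth j g) (cong (λ s → flip s (iterApp y (k' *ℕ j) p₀)) e))

          rhs≈-count : ∀ g → bmul k' g ≡ false → (∀ j → T (hits k' j) → sgn b (isNegCls (X j g) p₀) ≈ - 1#) → Σrhs g ≈ - 1# * count
          rhs≈-count g e h = ≈-trans (Σ<-cong L (λ j → ≈-trans (ifK-cong (cond≡ j) (λ t → ≈-trans (h j (subst T (cond≡ j) t)) (≈-sym (*-identityʳ (- 1#))))) (≈-sym (ifK-*ˡ _ (- 1#) 1#))))
              (Σl-*ˡ (upTo L) (- 1#) (λ l → ifK (hits k' l) 1#))
            where
            cond≡ : ∀ j → eqPt (iterApp (X j g) k p₀) (app y p₀) ≡ hits k' j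
            cond≡ j = cong (λ q → eqPt q (app y p₀)) (trans (kth j g) (cong (λ s → flip s (iterApp y (k' *ℕ j) p₀)) e))

          module Positive (y⁺ : ¬ T (isNegCls y p₀)) where

            red : ∀ g → Reduced y p₀ g
            red g t = ⊥-elim (y⁺ t)

            no-neg : ∀ a → iterApp y a p₀ ≢ neg p₀
            no-neg a e = y⁺ (inOrb⁺ By a e)

            lhs≈0 : ∀ g → bmul k' g xor b ≡ true → Σlhs g ≈ 0#
            lhs≈0 g e = Σl-0 (upTo L) (λ {j} _ → ifK-≢ (iterApp (X j g) k p₀) (flip b p₀) (blockValue (X j g)) (λ t → no-neg (k' *ℕ j)
              (trans (flip-cancel (bmul k' g) b (trans (sym (kth j g)) t)) (cong (λ s → flip s p₀) e))))

            rhs≈0 : ∀ g → bmul k' g ≡ true → Σrhs g ≈ 0#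
            rhs≈0 g e = Σl-0 (upTo L) (λ {j} _ → ifK-≢ (iterApp (X j g) k p₀) (app y p₀) (sgn b (isNegCls (X j g) p₀)) (λ t → no-neg (k' *ℕ j +ℕ (L ∸ 1) *ℕ 1)
              (ratio By (k' *ℕ j) 1 true (flip-cancel true false (trans (sym (trans (kth j g) (cong (λ s → flip s (iterApp y (k' *ℕ j) p₀)) e))) t)))))

            -- A power of X taking p₀ to -p₀ would be a return to the y-cycle, and with trivial g
            -- returns are powers of y.
            class⁺ : ∀ j → ¬ T (isNegCls (X j false) p₀)
            class⁺ j t = go (isNegCls⁻ {x = X j false} {p₀} t)
              where
              go : (∃ λ a → iterApp (X j false) a p₀ ≡ neg p₀) → ⊥
              go (a , e) = at (in-C⇒divides j false a e (C-flip true))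
                where
                at : m ∣ a → ⊥
                at (divides q refl) = no-neg (q *ℕ j) (trans (sym (trans (X-power j false q) (cong (λ s → flip s (iterApp y (q *ℕ j) p₀)) (bmul-false q)))) e)

            -- Put q = k'j - 1, which is odd as k' is even. Then y^q fixes p₀, so X^(qm) p₀ = (-1)^q
            -- y^(qj) p₀ = -p₀.
            class⁻ : ∀ j → bmul k' true ≡ false → T (hits k' j) → T (isNegCls (X j true) p₀)
            class⁻ j e t = inOrb⁺ (X-Bij j true) (q *ℕ m) (trans (X-power j true q) (cong₂ flip odd (iter-multiple y fix (ℕ∣.m∣m*n j))))
              where
              q : ℕ
              q = k' *ℕ j +ℕ (L ∸ 1) *ℕ 1
              fix : iterApp y q p₀ ≡ p₀
              fix = ratio By (k' *ℕ j) 1 false (eqPt⇒≡ {p = iterApp y (k' *ℕ j) p₀} {app y p₀} t)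
              pred-odd : bmul ((L ∸ 1) *ℕ 1) true ≡ true
              pred-odd = trans (cong (λ a → bmul a true) (ℕP.*-identityʳ (L ∸ 1))) (trans (sym (xor-cancelˡ true (bmul (L ∸ 1) true)))
                (cong (true xor_) (trans (cong (λ a → bmul a true) (ℕP.m+[n∸m]≡n (M≥1 n))) (bmul-M n true))))
              odd : bmul q true ≡ true
              odd = trans (bmul-+ (k' *ℕ j) ((L ∸ 1) *ℕ 1) true) (cong₂ _xor_
                (trans (cong (λ a → bmul a true) (ℕP.*-comm k' j)) (trans (bmul-* j k' true) (trans (cong (bmul j) e) (bmul-false j)))) pred-odd)

            sgn⁺ : ∀ j → sgn b (isNegCls (X j false) p₀) ≈ 1#
            sgn⁺ j = ≡⇒≈ (cong (λ s → if s then - 1# else 1#) (trans (cong (b ∧_) (¬T⇒≡ {isNegCls (X j false) p₀} (class⁺ j))) (BP.∧-zeroʳ b)))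

            rhs-false : Σrhs false ≈ count
            rhs-false = rhs≈count false (bmul-false k') (λ j _ → sgn⁺ j)

            -- Here w is the parity of k'. For odd k' each side has exactly one contributing sign g,
            -- not the same one if b holds. For even k' both signs contribute on the right, equally
            -- if b fails and oppositely if it holds; on the left both or none contribute
            -- accordingly.
            positive : ∀ w s → bmul k' true ≡ w → b ≡ s →
              Σlhs false + Σlhs true ≈ Σrhs false + Σrhs true
            positive true false ew eb = +-cong (≈-trans (lhs≈count false (red false) (trans (bmul-false k') (sym eb))) (≈-sym rhs-false))
              (≈-trans (lhs≈0 true (cong₂ _xor_ ew eb)) (≈-sym (rhs≈0 true ew)))
            positive false false ew eb = +-cong (≈-trans (lhs≈count false (red false) (trans (bmul-false k') (sym eb))) (≈-sym rhs-false))
              (≈-trans (lhs≈count true (red true) (trans ew (sym eb))) (≈-sym (rhs≈count true ew (λ j _ → ≡⇒≈ (cong (λ s → if s ∧ isNegCls (X j true) p₀ then - 1# else 1#) eb)))))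
            positive true true ew eb = ≈-trans (+-cong (lhs≈0 false (cong₂ _xor_ (bmul-false k') eb)) (lhs≈count true (red true) (trans ew (sym eb))))
              (≈-trans (+-comm 0# count) (≈-sym (+-cong rhs-false (rhs≈0 true ew))))
            positive false true ew eb = ≈-trans (+-cong (lhs≈0 false (cong₂ _xor_ (bmul-false k') eb)) (lhs≈0 true (cong₂ _xor_ ew eb)))
              (≈-trans (+-identityˡ 0#) (≈-sym (begin
                Σrhs false + Σrhs true
                  ≈⟨ +-cong rhs-false (rhs≈-count true ew (λ j t → ≡⇒≈ (cong (λ s → if s then - 1# else 1#) (cong₂ _∧_ eb (T⇒≡ {isNegCls (X j true) p₀} (class⁻ j ew t)))))) ⟩
                count + - 1# * count          ≈⟨ +-congʳ (*-identityˡ count) ⟨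
                1# * count + - 1# * count     ≈⟨ distribʳ count 1# (- 1#) ⟨
                (1# + - 1#) * count           ≈⟨ *-congʳ (-‿inverseʳ 1#) ⟩
                0# * count                    ≈⟨ zeroˡ count ⟩
                0#                            ∎)))

          module Negative (y⁻ : T (isNegCls y p₀)) where

            i : ℕ
            i = proj₁ (isNegCls⁻ {x = y} {p₀} y⁻)

            ei : iterApp y i p₀ ≡ neg p₀
            ei = proj₂ (isNegCls⁻ {x = y} {p₀} y⁻)

            red : Reduced y p₀ false
            red _ = refl

            kth-false : ∀ j → iterApp (X j false) k p₀ ≡ iterApp y (k' *ℕ j) p₀
            kth-false j = trans (kth j false) (cong (λ s → flip s (iterApp y (k' *ℕ j) p₀)) (bmul-false k'))

            -- X^k p₀ = y p₀ makes y^i p₀ = -p₀ the point X^(ik) p₀.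
            class⁻ : ∀ j → T (hits k' j) → T (isNegCls (X j false) p₀)
            class⁻ j t = inOrb⁺ (X-Bij j false) (i *ℕ k) (trans (iter-power (Comm-sym (X-Comm j false)) {k} {1} {false} {p₀} (trans (kth-false j) (eqPt⇒≡ {p = iterApp y (k' *ℕ j) p₀} {app y p₀} t)) i)
              (trans (cong₂ (λ s a → flip s (iterApp y a p₀)) (bmul-false i) (ℕP.*-identityʳ i)) ei))

            -- Since k'l = 1, y^(i k'l) p₀ = y^i p₀ = -p₀, so k'l and hence l is odd. Thus y^(li) p₀
            -- = -p₀, and θ^(li) has square 1 without being 1.
            θ⁻ : ∀ l → T (hits k' l) → powK θ (l *ℕ i) ≈ - 1#
            θ⁻ l t = minus-one (≈-trans (≈-sym (powK-+ θ (l *ℕ i) (l *ℕ i))) (ρ-fix⇒1 By p₀ (l *ℕ i +ℕ l *ℕ i)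
                (trans (iter-+ y (l *ℕ i) (l *ℕ i) p₀) (trans (cong (iterApp y (l *ℕ i)) eli) (trans (app-iter-flip y (l *ℕ i) true p₀) (trans (cong neg eli) (flip-flip true p₀)))))))
              (λ h → flip≢ (trans (sym eli) (ρ-1⇒fix By p₀ (l *ℕ i) h)))
              where
              odd : bmul (k' *ℕ l) true ≡ true
              odd = flip-sign (trans (sym (iter-flip-power {n} {y} {i} {true} {p₀} ei (k' *ℕ l))) (trans (cong (λ a → iterApp y a p₀) (ℕP.*-comm (k' *ℕ l) i))
                (trans (iter-power Comm-self {k' *ℕ l} {1} {false} {p₀} (eqPt⇒≡ {p = iterApp y (k' *ℕ l) p₀} {app y p₀} t) i) (trans (cong₂ (λ s a → flip s (iterApp y a p₀)) (bmul-false i) (ℕP.*-identityʳ i)) ei))))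
                where
                flip-sign : ∀ {s} → flip s p₀ ≡ neg p₀ → s ≡ true
                flip-sign {true}  _ = refl
                flip-sign {false} e = ⊥-elim (flip≢ (sym e))
              odd-l : bmul l true ≡ true
              odd-l = BP.¬-not (λ e → case trans (sym odd) (trans (bmul-* k' l true) (trans (cong (bmul k') e) (bmul-false k'))) of λ ())
              eli : iterApp y (l *ℕ i) p₀ ≡ neg p₀
              eli = trans (iter-flip-power {n} {y} {i} {true} {p₀} ei l) (cong (λ s → flip s p₀) odd-l)

            -- For b = true the minus signs have different origins: on the left the weights θ^(li)
            -- left by inversion, on the right the class of the X-cycle.
            negative : ∀ s → b ≡ s → Σlhs false ≈ Σrhs false
            negative false eb = ≈-trans (lhs≈count false red (trans (bmul-false k') (sym eb)))
              (≈-sym (rhs≈count false (bmul-false k') (λ j _ → ≡⇒≈ (cong (λ s → if s ∧ isNegCls (X j false) p₀ then - 1# else 1#) eb))))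
            negative true eb = begin
              Σlhs false            ≈⟨ to-θ false red ⟩
              Σ< L (λ j → ifK (eqPt (iterApp (X j false) k p₀) (flip b p₀)) (powK θ ((L ∸ 1) *ℕ j)))  ≈⟨ Σ<-cong L (λ j → ≡⇒≈ (cong (λ t → ifK t (powK θ ((L ∸ 1) *ℕ j))) (cong₂ (λ q s → eqPt q (flip s p₀)) (kth-false j) eb))) ⟩
              Σ< L (λ j → ifK (eqPt (iterApp y (k' *ℕ j) p₀) (flip true p₀)) (powK θ ((L ∸ 1) *ℕ j))) ≈⟨ fourier k' i true ei ⟩
              Σ< L (λ l → ifK (hits k' l) (powK θ (l *ℕ i)))             ≈⟨ Σ<-cong L (λ l → ≈-trans (ifK-cong refl (λ t → ≈-trans (θ⁻ l t) (≈-sym (*-identityʳ _)))) (≈-sym (ifK-*ˡ (hits k' l) (- 1#) 1#))) ⟩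
              Σ< L (λ l → - 1# * ifK (hits k' l) 1#)                     ≈⟨ Σl-*ˡ (upTo L) (- 1#) (λ l → ifK (hits k' l) 1#) ⟩
              - 1# * count                                ≈⟨ rhs≈-count false (bmul-false k') (λ j t → ≡⇒≈ (cong (λ s → if s then - 1# else 1#) (cong₂ _∧_ eb (T⇒≡ {isNegCls (X j false) p₀} (class⁻ j t))))) ⟨
              Σrhs false            ∎

          dividing : Σl signs Σlhs ≈ Σl signs Σrhs
          dividing = go (BP.T? (isNegCls y p₀))
            where
            Goal : List Bool → Set ℓ
            Goal s = Σl s Σlhs ≈ Σl s Σrhs
            go : Dec (T (isNegCls y p₀)) → Goal signs
            go (yes t) = subst (λ s → Goal (if s then false ∷ [] else false ∷ true ∷ [])) (sym (T⇒≡ {isNegCls y p₀} t)) (+-congʳ (Negative.negative t b refl))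
            go (no ¬t) = subst (λ s → Goal (if s then false ∷ [] else false ∷ true ∷ [])) (sym (¬T⇒≡ {isNegCls y p₀} ¬t))
              (≈-trans (+-congˡ (+-identityʳ _)) (≈-trans (Positive.positive ¬t (bmul k' true) b refl refl) (≈-sym (+-congˡ (+-identityʳ _)))))

      local : Σl signs (λ e → Σ< L (λ a → ifK (eqPt (iterApp (compose x (twist y p₀ a e)) k p₀) (flip b p₀)) (blockValue (compose x (twist y p₀ a e))))) ≈
              Σl signs (λ e → Σ< L (λ a → ifK (eqPt (iterApp (compose x (twist y p₀ a e)) k p₀) (app y p₀)) (sgn b (isNegCls (compose x (twist y p₀ a e)) p₀))))
      local = ≈-trans (reindex lhs) (≈-trans (go (m ∣? k)) (≈-sym (reindex rhs)))
        where
        go : Dec (m ∣ k) → Σl signs Σlhs ≈ Σl signs Σrhs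
        go (no ne) = vanishing ne
        go (yes d) = dividing (ℕ∣._∣_.quotient d) (ℕ∣._∣_.equality d)

  -- Replacing x by h block by block

  module Hybrid {y : SP n} (By : Bij y) (k : ℕ) (b : Bool) where
    restrict-cong : ∀ {z z' : SP n} {Q Q'} → (∀ p → Q p ≡ Q' p) → (∀ p → T (Q p) → app z p ≡ app z' p) → restrict z Q ≡ restrict z' Q'
    restrict-cong {z} {z'} {Q} {Q'} h e = VP.tabulate-cong (λ i → go (i , false) (Q (i , false)) refl)
      where
      go : ∀ p q → Q p ≡ q → patch Q (app z) p ≡ patch Q' (app z') p
      go p true  eq = trans (patch-in {Q = Q} {f = app z} (≡⇒T eq)) (trans (e p (≡⇒T eq)) (sym (patch-in {Q = Q'} {f = app z'} (subst T (h p) (≡⇒T eq)))))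
      go p false eq = trans (patch-out {Q = Q} {f = app z} (λ t → subst T eq t)) (sym (patch-out {Q = Q'} {f = app z'} (λ t → subst T (trans (sym (h p)) eq) t)))

    processed : List (Fin n) → SP n → Pt n → Bool
    processed l x p = any (λ i → block x y (i , false) p) l

    target : List (Fin n) → SP n → Pt n → Pt n
    target l x p = if processed l x p then app y p else flip b p

    admissible : List (Fin n) → SP n → Bool
    admissible l x = inCentb x y ∧ all (λ p → eqPt (iterApp x k p) (target l x p)) (allPt n)

    -- Interpolates between ω^x(y), for the empty list, and `sgn b (parity x)`, for the full one.
    weight : List (Fin n) → SP n → Carrier
    weight l x = ω x (restrict y (not ∘ processed l x)) * sgn b (parity (restrict x (processed l x)))

    summand : List (Fin n) → SP n → Carrier
    summand l x = ifK (admissible l x) (weight l x)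

    summand-cong : ∀ l l' x → (∀ p → processed l x p ≡ processed l' x p) → summand l x ≈ summand l' x
    summand-cong l l' x h = ≡⇒≈ (cong₂ ifK
      (cong (inCentb x y ∧_) (cong (λ bs → foldr _∧_ true bs) (LP.map-cong (λ p → cong (λ q → eqPt (iterApp x k p) (if q then app y p else flip b p)) (h p)) (allPt n))))
      (cong₂ _*_ (cong (ω x) (restrict-cong {y} {y} (λ p → cong not (h p)) (λ _ _ → refl)))
        (cong (λ w → sgn b (parity w)) (restrict-cong {x} {x} h (λ _ _ → refl)))))

    sgn-xor : ∀ b s t → sgn b (s xor t) ≈ sgn b s * sgn b t
    sgn-xor false s     t     = ≈-sym (*-identityˡ 1#)
    sgn-xor true  false t     = ≈-sym (*-identityˡ _)
    sgn-xor true  true  false = ≈-sym (*-identityʳ _)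
    sgn-xor true  true  true  = ≈-sym (+-cancelʳ (- 1#) (begin
      - 1# * - 1# + - 1#           ≈⟨ +-congˡ (*-identityʳ (- 1#)) ⟨
      - 1# * - 1# + - 1# * 1#      ≈⟨ distribˡ (- 1#) (- 1#) 1# ⟨
      - 1# * (- 1# + 1#)           ≈⟨ *-congˡ (-‿inverseˡ 1#) ⟩
      - 1# * 0#                    ≈⟨ zeroʳ (- 1#) ⟩
      0#                           ≈⟨ -‿inverseʳ 1# ⟨
      1# + - 1#                    ∎))

    module Step (i₀ : Fin n) (l : List (Fin n)) where

      p₀ : Pt n
      p₀ = i₀ , false

      open BlockValue By p₀ using (blockValue)
      open Local By p₀ using (signs; local)

      Z : SP n → ℕ → Bool → SP n
      Z x a e = compose x (twist y p₀ a e)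

      module _ {x : SP n} (Bx : Bij x) (xy : Comm x y) where

        private
          U D : Pt n → Bool
          U = processed l x
          D = block x y p₀

          Dn : NegInvariant D
          Dn = block-neg Bx By p₀
          Dx : Stable x D
          Dx = block-stableˣ Bx By p₀
          Dy : Stable y D
          Dy = block-stableʸ Bx By xy p₀

          U⁻ : ∀ {p} → T (U p) → ∃ λ i → i ∈ l × T (block x y (i , false) p)
          U⁻ {p} h = any-elim (λ i → block x y (i , false) p) l h

          U⁺ : ∀ {p i} → i ∈ l → T (block x y (i , false) p) → T (U p)
          U⁺ {p} m h = any-intro (λ i → block x y (i , false) p) m h

          block-in : ∀ {q p p'} → T (block x y q p) → T (block x y p p') → T (block x y q p')
          block-in {q} {p} {p'} h h' = subst T (block-least Bx By {block x y q} (block-neg Bx By q) (block-stableˣ Bx By q) (block-stableʸ Bx By xy q) {p} {p'} h') h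

          U-block : ∀ {p p'} → T (U p) → T (block x y p p') → T (U p')
          U-block {p} {p'} h h' = let (i , m , k) = U⁻ {p} h in U⁺ {p'} m (block-in {i , false} {p} {p'} k h')

          U-invariant : ∀ {f : Pt n → Pt n} → (∀ q p → block x y q (f p) ≡ block x y q p) → ∀ p → U (f p) ≡ U p
          U-invariant {f} h p = T-ext (λ t → let (i , m , k) = U⁻ {f p} t in U⁺ {p} m (subst T (h (i , false) p) k))
                                      (λ t → let (i , m , k) = U⁻ {p} t in U⁺ {f p} m (subst T (sym (h (i , false) p)) k))

          Un : NegInvariant U
          Un = U-invariant (λ q → block-neg Bx By q)
          Ux : Stable x U
          Ux = U-invariant (λ q → block-stableˣ Bx By q)
          Uy : Stable y U
          Uy = U-invariant (λ q → block-stableʸ Bx By xy q)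

          processed-twist : ∀ a e p → processed l (Z x a e) p ≡ U p
          processed-twist a e p = cong or (LP.map-cong (λ i → block-twist By p₀ Bx xy a e (i , false) p) l)

        seen : T (U p₀) → ∀ a e → summand l (Z x a e) ≈ summand (i₀ ∷ l) (Z x a e)
        seen h a e = summand-cong l (i₀ ∷ l) (Z x a e) (λ p → sym (trans (cong₂ _∨_ (block-twist By p₀ Bx xy a e p₀ p) refl) (absorb p)))
          where
          U' : Pt n → Bool
          U' = processed l (Z x a e)
          absorb : ∀ p → D p ∨ U' p ≡ U' p
          absorb p = go (D p) refl
            where
            go : ∀ d → D p ≡ d → d ∨ U' p ≡ U' p
            go true  eq = sym (T⇒≡ (subst T (sym (processed-twist a e p)) (U-block {p₀} {p} h (≡⇒T eq))))
            go false _  = refl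

        module Unseen (unseen : ¬ T (U p₀)) where

          private
            V : Pt n → Bool
            V p = D p ∨ U p

            disjoint : ∀ p → T (D p) → ¬ T (U p)
            disjoint p h t = unseen (U-block {p} {p₀} t (block-sym Bx By xy h))

            Vn : NegInvariant V
            Vn p = cong₂ _∨_ (Dn p) (Un p)
            Vx : Stable x V
            Vx p = cong₂ _∨_ (Dx p) (Ux p)
            Vy : Stable y V
            Vy p = cong₂ _∨_ (Dy p) (Uy p)

            not-invariant : ∀ {Q : Pt n → Bool} {f : Pt n → Pt n} → (∀ p → Q (f p) ≡ Q p) → ∀ p → not (Q (f p)) ≡ not (Q p)
            not-invariant h p = cong not (h p)

            yV : SP n
            yV = restrict y (not ∘ V)

          rest : Bool
          rest = all (λ p → D p ∨ eqPt (iterApp x k p) (target l x p)) (allPt n)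

          -- The contribution from outside the block of `p₀`. It is expressed by x itself and
          -- therefore shared by all twists.
          common : Carrier
          common = ifK rest (ω x yV * sgn b (parity (restrict x U)))

          module _ (a : ℕ) (e : Bool) where

            private
              x' : SP n
              x' = Z x a e
              Bx' : Bij x'
              Bx' = twisted-Bij By p₀ Bx a e
              x'y : Comm x' y
              x'y = Comm-sym (twisted-Comm By p₀ Bx (Comm-sym xy) a e)
              U' D' : Pt n → Bool
              U' = processed l x'
              D' = block x' y p₀
              D≡ : ∀ p → D' p ≡ D p
              D≡ = block-twist By p₀ Bx xy a e p₀
              U≡ : ∀ p → U' p ≡ U p
              U≡ = processed-twist a e
              outside : ∀ p → ¬ T (D p) → app x' p ≡ app x p
              outside p h = trans (app-compose x (twist y p₀ a e) p) (cong (app x) (twist-out By p₀ a e (λ t → h (cyc⊆D t))))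
                where
                cyc⊆D : T (inCyc y p₀ p) → T (D p)
                cyc⊆D t = let (b , s , eb) = inCyc⁻ y {p₀} {p} t in block⁺ Bx By {p₀} {p} 0 b s eb
              outside-iter : ∀ p → ¬ T (D p) → ∀ d → iterApp x' d p ≡ iterApp x d p
              outside-iter p h zero    = refl
              outside-iter p h (suc d) = trans (cong (app x') (outside-iter p h d)) (outside (iterApp x d p) (λ t → h (subst T (stable-iter {x = x} {D} Dx d p) t)))
              -- Maps commuting with x', y and the signs agree on the whole block once they agree at
              -- p₀, as the block is the orbit of p₀.
              inside : (f g : Pt n → Pt n) → (∀ d p → f (iterApp x' d p) ≡ iterApp x' d (f p)) → (∀ d p → g (iterApp x' d p) ≡ iterApp x' d (g p)) →
                (∀ d p → f (iterApp y d p) ≡ iterApp y d (f p)) → (∀ d p → g (iterApp y d p) ≡ iterApp y d (g p)) →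
                (∀ s p → f (flip s p) ≡ flip s (f p)) → (∀ s p → g (flip s p) ≡ flip s (g p)) → f p₀ ≡ g p₀ → ∀ p → T (D p) → f p ≡ g p
              inside f g fx gx fy gy ff gf e₀ p h = at (block⁻ Bx' By {p₀} {p} (subst T (sym (D≡ p)) h))
                where
                at : (∃ λ d → T (inCyc x' (iterApp y d p₀) p)) → f p ≡ g p
                at (d , t) = let (d' , s , ed) = inCyc⁻ x' {iterApp y d p₀} {p} t in
                  flip-inj s (trans (sym (ff s p)) (trans (cong f (sym ed)) (trans (fx d' (iterApp y d p₀)) (trans (cong (iterApp x' d') (trans (fy d p₀) (trans (cong (iterApp y d) e₀) (sym (gy d p₀)))))
                    (trans (sym (gx d' (iterApp y d p₀))) (trans (cong g ed) (gf s p)))))))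
              inside-flip : iterApp x' k p₀ ≡ flip b p₀ → ∀ p → T (D p) → iterApp x' k p ≡ flip b p
              inside-flip = inside (iterApp x' k) (flip b) (λ d p → iter-comm x' k d p) (λ d p → sym (app-iter-flip x' d b p))
                (λ d p → iter-Comm x'y k d p) (λ d p → sym (app-iter-flip y d b p)) (λ s p → app-iter-flip x' k s p) (λ s p → flip-comm b s p)
              inside-y : iterApp x' k p₀ ≡ app y p₀ → ∀ p → T (D p) → iterApp x' k p ≡ app y p
              inside-y = inside (iterApp x' k) (app y) (λ d p → iter-comm x' k d p) (λ d p → sym (iter-Comm x'y d 1 p))
                (λ d p → iter-Comm x'y k d p) (λ d p → iter-comm y 1 d p) (λ s p → app-iter-flip x' k s p) (λ s p → app-flip y s p)

              conditions : ∀ l' q₀ → (∀ p → ¬ T (D p) → target l' x' p ≡ target l x p) → target l' x' p₀ ≡ q₀ →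
                (iterApp x' k p₀ ≡ q₀ → ∀ p → T (D p) → iterApp x' k p ≡ target l' x' p) → admissible l' x' ≡ rest ∧ eqPt (iterApp x' k p₀) q₀
              conditions l' q₀ off at₀ on = T-ext to from
                where
                to : T (admissible l' x') → T (rest ∧ eqPt (iterApp x' k p₀) q₀)
                to h = ∧-intro (all-intro (λ p → D p ∨ eqPt (iterApp x k p) (target l x p)) (allPt n) (λ p _ → at p (BP.T? (D p))))
                    (≡⇒eqPt {p = iterApp x' k p₀} {q₀} (trans (every p₀) at₀))
                  where
                  every : ∀ p → iterApp x' k p ≡ target l' x' p
                  every p = eqPt⇒≡ {p = iterApp x' k p} {target l' x' p} (all-elim (λ p → eqPt (iterApp x' k p) (target l' x' p)) (allPt n) (proj₂ (∧-elim {inCentb x' y} h)) (∈-allPt p))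
                  at : ∀ p → Dec (T (D p)) → T (D p ∨ eqPt (iterApp x k p) (target l x p))
                  at p (yes t) = Equivalence.from (BP.T-∨ {D p}) (inj₁ t)
                  at p (no t)  = Equivalence.from (BP.T-∨ {D p}) (inj₂ (≡⇒eqPt {p = iterApp x k p} {target l x p} (trans (sym (outside-iter p t k)) (trans (every p) (off p t)))))
                from : T (rest ∧ eqPt (iterApp x' k p₀) q₀) → T (admissible l' x')
                from h = ∧-intro (⇒InCent By x'y) (all-intro (λ p → eqPt (iterApp x' k p) (target l' x' p)) (allPt n) (λ p _ → ≡⇒eqPt {p = iterApp x' k p} {target l' x' p} (at p (BP.T? (D p)))))
                  where
                  h₁ : T rest
                  h₁ = proj₁ (∧-elim {rest} h)
                  h₂ : iterApp x' k p₀ ≡ q₀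
                  h₂ = eqPt⇒≡ {p = iterApp x' k p₀} {q₀} (proj₂ (∧-elim {rest} h))
                  at : ∀ p → Dec (T (D p)) → iterApp x' k p ≡ target l' x' p
                  at p (yes t) = on h₂ p t
                  at p (no t)  = trans (outside-iter p t k) (trans (off-D (Equivalence.to (BP.T-∨ {D p}) (all-elim (λ p → D p ∨ eqPt (iterApp x k p) (target l x p)) (allPt n) h₁ (∈-allPt p)))) (sym (off p t)))
                    where
                    off-D : T (D p) ⊎ T (eqPt (iterApp x k p) (target l x p)) → iterApp x k p ≡ target l x p
                    off-D (inj₁ t') = ⊥-elim (t t')
                    off-D (inj₂ t') = eqPt⇒≡ {p = iterApp x k p} {target l x p} t'

              choose : ∀ {q q'} → q ≡ q' → ∀ p → (if q then app y p else flip b p) ≡ (if q' then app y p else flip b p)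
              choose refl p = refl

              yV-Bij : Bij yV
              yV-Bij = restrict-Bij {z = y} {not ∘ V} By (not-invariant {V} {neg} Vn) (not-invariant {V} {app y} Vy)

              yV-Comm : Comm x yV
              yV-Comm = restrict-Comm {z = y} {not ∘ V} (not-invariant {V} {neg} Vn) (not-invariant {V} {app x} Vx) xy

              Vx' : Stable x' V
              Vx' p = cong₂ _∨_ (trans (sym (D≡ (app x' p))) (trans (block-stableˣ Bx' By p₀ p) (D≡ p)))
                (trans (sym (U≡ (app x' p))) (trans (T-ext
                  (λ t → let (i , m , k) = any-elim (λ i → block x' y (i , false) (app x' p)) l t in any-intro (λ i → block x' y (i , false) p) m (subst T (block-stableˣ Bx' By (i , false) p) k))
                  (λ t → let (i , m , k) = any-elim (λ i → block x' y (i , false) p) l t in any-intro (λ i → block x' y (i , false) (app x' p)) m (subst T (sym (block-stableˣ Bx' By (i , false) p)) k)))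
                  (U≡ p)))

              yV-Comm' : Comm x' yV
              yV-Comm' = restrict-Comm {z = y} {not ∘ V} (not-invariant {V} {neg} Vn) (not-invariant {V} {app x'} Vx') x'y

              -- x and x' agree off the block, where `yV` is supported; this is `transport` along
              -- the identity.
              ω-outside : ω x yV ≈ ω x' yV
              ω-outside = Transport.transport {x = x} {x'} {idB n} Bx Bx' Bij-id {not ∘ D} (not-invariant {D} {neg} Dn) (not-invariant {D} {app x} Dx)
                (λ p t → trans (cong (app x') (app-id p)) (trans (outside p (λ h → not⇒¬ (D p) t h)) (sym (app-id (app x p))))) (allFin n) {yV} {yV} yV-Bij yV-Comm yV-Comm'
                (mkConj λ p → trans (cong (app yV) (app-id p)) (sym (app-id (app yV p))))
                (λ p t → restrict-out {z = y} {not ∘ V} (not-invariant {V} {neg} Vn) {p} (λ h → t (V⇒D p h)))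
                (λ i _ → ∈P.∈-allFin i)
                where
                not⇒¬ : ∀ d → T (not d) → ¬ T d
                not⇒¬ false _ ()
                V⇒D : ∀ p → T (not (V p)) → T (not (D p))
                V⇒D p h = go (D p) (U p) h
                  where
                  go : ∀ d u → T (not (d ∨ u)) → T (not d)
                  go false _ _ = tt

              parity-U : ∀ {Q} → (∀ p → Q p ≡ U p) → parity (restrict x' Q) ≡ parity (restrict x U)
              parity-U {Q} h = cong parity (restrict-cong {x'} {x} h (λ p t → outside p (λ d → disjoint p d (subst T (h p) t))))

            unprocessed : summand l x' ≈ common * ifK (eqPt (iterApp x' k p₀) (flip b p₀)) (blockValue x')
            unprocessed = begin
                ifK (admissible l x') (weight l x')                    ≈⟨ ifK-cong cond (λ _ → split) ⟩
                ifK (rest ∧ eqPt (iterApp x' k p₀) (flip b p₀)) (ω x yV * sgn b (parity (restrict x U)) * blockValue x')   ≈⟨ ifK-∧ rest (eqPt (iterApp x' k p₀) (flip b p₀)) _ _ ⟩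
                common * ifK (eqPt (iterApp x' k p₀) (flip b p₀)) (blockValue x')                                          ∎
              where
              cond : admissible l x' ≡ rest ∧ eqPt (iterApp x' k p₀) (flip b p₀)
              cond = conditions l (flip b p₀) (λ p _ → choose (U≡ p) p) (choose (trans (U≡ p₀) (¬T⇒≡ unseen)) p₀)
                (λ e₀ p h → trans (inside-flip e₀ p h) (sym (choose (trans (U≡ p) (¬T⇒≡ (disjoint p h))) p)))
              yD : SP n
              yD = restrict y D'
              Dn' : NegInvariant D'
              Dn' = block-neg Bx' By p₀
              Dy' : Stable y D'
              Dy' = block-stableʸ Bx' By x'y p₀
              y-split : restrict y (not ∘ U') ≡ compose yV yD
              y-split = app-ext λ p → trans (app-restrict {z = y} {not ∘ U'} U'n p) (sym (trans (app-compose yV yD p) (go p (BP.T? (D p)))))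
                where
                U'n : NegInvariant (not ∘ U')
                U'n p = cong not (trans (U≡ (neg p)) (trans (Un p) (sym (U≡ p))))
                notVn : NegInvariant (not ∘ V)
                notVn = not-invariant {V} {neg} Vn
                go : ∀ p → Dec (T (D p)) → app yV (app yD p) ≡ patch (not ∘ U') (app y) p
                go p (yes d) = trans (cong (app yV) (restrict-in {z = y} {D'} Dn' {p} (subst T (sym (D≡ p)) d)))
                  (trans (restrict-out {z = y} {not ∘ V} notVn {app y p} (λ h → subst T (cong (λ t → not (t ∨ U (app y p))) (T⇒≡ {D (app y p)} (subst T (sym (Dy p)) d))) h))
                    (sym (patch-in {Q = not ∘ U'} {f = app y} (≡⇒T (cong not (trans (U≡ p) (¬T⇒≡ (disjoint p d))))))))
                go p (no d) = trans (cong (app yV) (restrict-out {z = y} {D'} Dn' {p} (λ h → d (subst T (D≡ p) h))))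
                  (trans (app-restrict {z = y} {not ∘ V} notVn p) (cong (λ t → if not t then app y p else p) (trans (cong (_∨ U p) (¬T⇒≡ d)) (sym (U≡ p)))))
              split : weight l x' ≈ ω x yV * sgn b (parity (restrict x U)) * blockValue x'
              split = begin
                ω x' (restrict y (not ∘ U')) * sgn b (parity (restrict x' U'))
                  ≈⟨ *-cong (≡⇒≈ (cong (ω x') y-split)) (≡⇒≈ (cong (sgn b) (parity-U U≡))) ⟩
                ω x' (compose yV yD) * sgn b (parity (restrict x U))
                  ≈⟨ *-congʳ (ω-mult Bx' yV-Bij yV-Comm' (restrict-Bij {z = y} {D'} By Dn' Dy') (restrict-Comm {z = y} {D'} Dn' (block-stableˣ Bx' By p₀) x'y)) ⟩
                ω x' yV * blockValue x' * sgn b (parity (restrict x U))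
                  ≈⟨ *-congʳ (*-congʳ ω-outside) ⟨
                ω x yV * blockValue x' * sgn b (parity (restrict x U))
                  ≈⟨ ≈-trans (*-assoc _ _ _) (≈-trans (*-congˡ (*-comm _ _)) (≈-sym (*-assoc _ _ _))) ⟩
                ω x yV * sgn b (parity (restrict x U)) * blockValue x'  ∎

            newly-processed : summand (i₀ ∷ l) x' ≈ common * ifK (eqPt (iterApp x' k p₀) (app y p₀)) (sgn b (isNegCls x' p₀))
            newly-processed = begin
                ifK (admissible (i₀ ∷ l) x') (weight (i₀ ∷ l) x')       ≈⟨ ifK-cong cond (λ t → split (eqPt⇒≡ {p = iterApp x' k p₀} {app y p₀} (proj₂ (∧-elim {rest} (subst T cond t))))) ⟩
                ifK (rest ∧ eqPt (iterApp x' k p₀) (app y p₀)) (ω x yV * sgn b (parity (restrict x U)) * sgn b (isNegCls x' p₀))  ≈⟨ ifK-∧ rest (eqPt (iterApp x' k p₀) (app y p₀)) _ _ ⟩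
                common * ifK (eqPt (iterApp x' k p₀) (app y p₀)) (sgn b (isNegCls x' p₀))                                         ∎
              where
              V≡ : ∀ p → processed (i₀ ∷ l) x' p ≡ V p
              V≡ p = cong₂ _∨_ (D≡ p) (U≡ p)
              cond : admissible (i₀ ∷ l) x' ≡ rest ∧ eqPt (iterApp x' k p₀) (app y p₀)
              cond = conditions (i₀ ∷ l) (app y p₀) (λ p h → choose (trans (V≡ p) (cong (_∨ U p) (¬T⇒≡ h))) p) (choose (trans (V≡ p₀) (cong (_∨ U p₀) (T⇒≡ (block-refl Bx By p₀)))) p₀)
                (λ e₀ p h → trans (inside-y e₀ p h) (sym (choose (trans (V≡ p) (cong (_∨ U p) (T⇒≡ h))) p)))
              split : iterApp x' k p₀ ≡ app y p₀ → weight (i₀ ∷ l) x' ≈ ω x yV * sgn b (parity (restrict x U)) * sgn b (isNegCls x' p₀)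
              split e₀ = begin
                ω x' (restrict y (not ∘ processed (i₀ ∷ l) x')) * sgn b (parity (restrict x' (processed (i₀ ∷ l) x')))
                  ≈⟨ *-cong (≈-trans (≡⇒≈ (cong (ω x') (restrict-cong {y} {y} (λ p → cong not (V≡ p)) (λ _ _ → refl)))) (≈-sym ω-outside))
                       (≡⇒≈ (cong (sgn b) (trans (cong parity (restrict-cong {x'} {x'} V≡ (λ _ _ → refl))) (parity-disjoint x' D U disjoint)))) ⟩
                ω x yV * sgn b (parity (restrict x' D) xor parity (restrict x' U))
                  ≈⟨ *-congˡ (≡⇒≈ (cong (sgn b) (cong₂ _xor_ (trans (cong parity (restrict-cong {x'} {x'} cyc≡ (λ _ _ → refl))) (parity-cycle Bx' p₀)) (parity-U (λ _ → refl))))) ⟩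
                ω x yV * sgn b (isNegCls x' p₀ xor parity (restrict x U))
                  ≈⟨ *-congˡ (≈-trans (sgn-xor b _ _) (*-comm _ _)) ⟩
                ω x yV * (sgn b (parity (restrict x U)) * sgn b (isNegCls x' p₀))
                  ≈⟨ *-assoc _ _ _ ⟨
                ω x yV * sgn b (parity (restrict x U)) * sgn b (isNegCls x' p₀)   ∎
                where
                y-power : ∀ d → iterApp y d p₀ ≡ iterApp x' (d *ℕ k) p₀
                y-power d = trans (cong (λ a → iterApp y a p₀) (sym (ℕP.*-identityʳ d))) (trans (iter-power x'y {1} {k} {false} {p₀} (sym e₀) d)
                  (cong (λ s → flip s (iterApp x' (d *ℕ k) p₀)) (bmul-false d)))
                -- As y = x'^k on the block, the block is a single cycle of x'; its parity is then
                -- the class, by `parity-cycle`.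
                cyc≡ : ∀ p → D p ≡ inCyc x' p₀ p
                cyc≡ p = T-ext (λ t → at (block⁻ Bx' By {p₀} {p} (subst T (sym (D≡ p)) t))) (λ t → subst T (D≡ p) (cyc⇒block Bx' By {p₀} {p} 0 t))
                  where
                  at : (∃ λ d → T (inCyc x' (iterApp y d p₀) p)) → T (inCyc x' p₀ p)
                  at (d , t) = inCyc-trans Bx' (subst (T ∘ inCyc x' p₀) (sym (y-power d)) (inCyc-iter Bx' (d *ℕ k) false p₀)) t

        twist-sum : Dec (T (U p₀)) → Σl signs (λ e → Σ< (M n) (λ a → summand l (Z x a e))) ≈ Σl signs (λ e → Σ< (M n) (λ a → summand (i₀ ∷ l) (Z x a e)))
        twist-sum (yes h) = Σl-cong signs (λ {e} _ → Σ<-cong (M n) (λ a → seen h a e))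
        twist-sum (no h) = begin
            Σl signs (λ e → Σ< (M n) (λ a → summand l (Z x a e)))            ≈⟨ Σl-cong signs (λ {e} _ → ≈-trans (Σ<-cong (M n) (λ a → unprocessed a e)) (Σl-*ˡ (upTo (M n)) common _)) ⟩
            Σl signs (λ e → common * Σ< (M n) (λ a → ifK (eqPt (iterApp (Z x a e) k p₀) (flip b p₀)) (blockValue (Z x a e))))              ≈⟨ Σl-*ˡ signs common _ ⟩
            common * Σl signs (λ e → Σ< (M n) (λ a → ifK (eqPt (iterApp (Z x a e) k p₀) (flip b p₀)) (blockValue (Z x a e))))              ≈⟨ *-congˡ (local Bx xy k b) ⟩
            common * Σl signs (λ e → Σ< (M n) (λ a → ifK (eqPt (iterApp (Z x a e) k p₀) (app y p₀)) (sgn b (isNegCls (Z x a e) p₀))))      ≈⟨ Σl-*ˡ signs common _ ⟨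
            Σl signs (λ e → common * Σ< (M n) (λ a → ifK (eqPt (iterApp (Z x a e) k p₀) (app y p₀)) (sgn b (isNegCls (Z x a e) p₀))))      ≈⟨ Σl-cong signs (λ {e} _ → ≈-trans (Σ<-cong (M n) (λ a → newly-processed a e)) (Σl-*ˡ (upTo (M n)) common _)) ⟨
            Σl signs (λ e → Σ< (M n) (λ a → summand (i₀ ∷ l) (Z x a e)))     ∎
          where open Unseen h

      not-central : ∀ l' {x} → Bij x → ¬ T (inCentb x y) → ∀ a e → summand l' (Z x a e) ≈ 0#
      not-central l' {x} Bx h a e = ifK-false (λ t → h (⇒InCent By (Comm-sym (untwisted-Comm By p₀ Bx a e (Comm-sym (proj₂ (InCent⇒ {x = Z x a e} {y} (proj₁ (∧-elim {inCentb (Z x a e) y} t)))))))))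

      -- A twist depends on y and p₀ only, so for fixed a and e right multiplication by it permutes
      -- B_n.
      average : ∀ (f : SP n → Carrier) → Σl (Bl n) (λ x → Σl signs (λ e → Σ< (M n) (λ a → f (Z x a e)))) ≈ ι (length signs *ℕ M n) * Σl (Bl n) f
      average f = begin
          Σl (Bl n) (λ x → Σl signs (λ e → Σ< (M n) (λ a → f (Z x a e))))      ≈⟨ Σl-swap (Bl n) signs (λ x e → Σ< (M n) (λ a → f (Z x a e))) ⟩
          Σl signs (λ e → Σl (Bl n) (λ x → Σ< (M n) (λ a → f (Z x a e))))      ≈⟨ Σl-cong signs (λ {e} _ → Σl-swap (Bl n) (upTo (M n)) (λ x a → f (Z x a e))) ⟩
          Σl signs (λ e → Σ< (M n) (λ a → Σl (Bl n) (λ x → f (Z x a e))))      ≈⟨ Σl-cong signs (λ {e} _ → Σ<-cong (M n) (λ a → translate a e)) ⟩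
          Σl signs (λ _ → Σ< (M n) (λ _ → Σl (Bl n) f))                        ≈⟨ Σl-cong signs (λ _ → ≈-trans (Σl-const (upTo (M n)) (Σl (Bl n) f)) (*-congʳ (≡⇒≈ (cong ι (LP.length-upTo (M n)))))) ⟩
          Σl signs (λ _ → ι (M n) * Σl (Bl n) f)                               ≈⟨ Σl-const signs _ ⟩
          ι (length signs) * (ι (M n) * Σl (Bl n) f)                           ≈⟨ *-assoc _ _ _ ⟨
          ι (length signs) * ι (M n) * Σl (Bl n) f                             ≈⟨ *-congʳ (ι-* (length signs) (M n)) ⟨
          ι (length signs *ℕ M n) * Σl (Bl n) f                                ∎
        where
        translate : ∀ a e → Σl (Bl n) (λ x → f (Z x a e)) ≈ Σl (Bl n) f
        translate a e = Σl-bijection (Bl-unique n) (Bl-unique n) (λ x → compose x t) (λ x → compose x (inv t))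
            (λ m → ∈-Bl (Bij-compose (Bl⇒Bij m) Bt)) (λ m → ∈-Bl (Bij-compose (Bl⇒Bij m) (Bij-inv t Bt)))
            (λ {x} _ → app-ext λ p → trans (app-compose (compose x t) (inv t) p) (trans (app-compose x t (app (inv t) p)) (cong (app x) (app-invʳ t Bt p))))
            (λ {x} _ → app-ext λ p → trans (app-compose (compose x (inv t)) t p) (trans (app-compose x (inv t) (app t p)) (cong (app x) (app-invˡ t Bt p)))) f
          where
          t : SP n
          t = twist y p₀ a e
          Bt : Bij t
          Bt = twist-Bij By p₀ a e

      -- Averaging multiplies both sums by the number of twists, which cancels in characteristic 0.
      -- What is left is a comparison for each x separately.
      step : Σl (Bl n) (summand l) ≈ Σl (Bl n) (summand (i₀ ∷ l))
      step = ι-cancel (ℕP.*-mono-≤ (length≥1 (isNegCls y p₀)) (M≥1 n)) (≈-trans (≈-sym (average (summand l)))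
          (≈-trans (Σl-cong (Bl n) (λ {x} m → pointwise x (Bl⇒Bij m) (BP.T? (inCentb x y)))) (average (summand (i₀ ∷ l)))))
        where
        length≥1 : ∀ s → 1 ≤ length (if s then false ∷ [] else false ∷ true ∷ [])
        length≥1 true  = s≤s z≤n
        length≥1 false = s≤s z≤n
        pointwise : ∀ x → Bij x → Dec (T (inCentb x y)) →
          Σl signs (λ e → Σ< (M n) (λ a → summand l (Z x a e))) ≈ Σl signs (λ e → Σ< (M n) (λ a → summand (i₀ ∷ l) (Z x a e)))
        pointwise x Bx (yes h) = twist-sum Bx (proj₂ (InCent⇒ {x = x} {y} h)) (BP.T? (processed l x p₀))
        pointwise x Bx (no h)  = Σl-cong signs (λ {e} _ → Σ<-cong (M n) (λ a → ≈-trans (not-central l Bx h a e) (≈-sym (not-central (i₀ ∷ l) Bx h a e))))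

    all-steps : ∀ l → Σl (Bl n) (summand []) ≈ Σl (Bl n) (summand l)
    all-steps []      = ≈-refl
    all-steps (i ∷ l) = ≈-trans (all-steps l) (Step.step i l)

  -- The stages with no block and with every block processed

  module Endpoints {y : SP n} (By : Bij y) (k : ℕ) (b : Bool) where
    open Induced By using (term)
    open Hybrid By k b

    central : SP n
    central = if b then w0 n else idB n

    app-central : ∀ p → app central p ≡ flip b p
    app-central p = go b
      where
      go : ∀ b → app (if b then w0 n else idB n) p ≡ flip b p
      go true  = app-w0 p
      go false = app-id p

    summand-first : ∀ x → summand [] x ≈ ifK (eqSP (powN x k) central) (term x)
    summand-first x = ≈-trans (≡⇒≈ (cong₂ ifK cond refl)) (≈-trans (ifK-cong refl (λ _ → value₀)) (nest (inCentb x y) (eqSP (powN x k) central)))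
      where
      cond : admissible [] x ≡ inCentb x y ∧ eqSP (powN x k) central
      cond = cong (inCentb x y ∧_) (T-ext
        (λ h → ≡⇒eqSP (app-ext λ p → trans (app-powN x k p) (trans (eqPt⇒≡ {p = iterApp x k p} {flip b p} (all-elim (λ p → eqPt (iterApp x k p) (flip b p)) (allPt n) h (∈-allPt p))) (sym (app-central p)))))
        (λ h → all-intro (λ p → eqPt (iterApp x k p) (flip b p)) (allPt n) (λ p _ → ≡⇒eqPt {p = iterApp x k p} {flip b p}
          (trans (sym (app-powN x k p)) (trans (cong (λ w → app w p) (eqSP⇒≡ {v = powN x k} {central} h)) (app-central p))))))
      value₀ : weight [] x ≈ ω x y
      value₀ = ≈-trans (*-cong (≡⇒≈ (cong (ω x) (app-ext λ p → restrict-in {z = y} {λ _ → true} (λ _ → refl) {p} tt)))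
        (≡⇒≈ (trans (cong (sgn b) (trans (parity-restrict x (λ _ → false)) (⊕-false (allFin n)))) (cong (λ s → if s then - 1# else 1#) (BP.∧-zeroʳ b))))) (*-identityʳ _)
      nest : ∀ i e → ifK (i ∧ e) (ω x y) ≈ ifK e (ifK i (ω x y))
      nest true  e     = ≈-refl
      nest false true  = ≈-refl
      nest false false = ≈-refl

    summand-last : ∀ {x} → Bij x → summand (allFin n) x ≈ ifK (eqSP (powN x k) y) (sgn b (parity x))
    summand-last {x} Bx = ifK-cong cond (λ _ → value₁)
      where
      done : ∀ p → processed (allFin n) x p ≡ true
      done (i , s) = T⇒≡ (any-intro (λ j → block x y (j , false) (i , s)) (∈P.∈-allFin i) (block⁺ Bx By {i , false} {i , s} 0 0 s (cong (i ,_) (sym (BP.xor-same s)))))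
      target≡ : ∀ p → target (allFin n) x p ≡ app y p
      target≡ p = cong (λ t → if t then app y p else flip b p) (done p)
      cond : admissible (allFin n) x ≡ eqSP (powN x k) y
      cond = T-ext
        (λ h → ≡⇒eqSP (app-ext λ p → trans (app-powN x k p) (trans (eqPt⇒≡ {p = iterApp x k p} {target (allFin n) x p}
          (all-elim (λ p → eqPt (iterApp x k p) (target (allFin n) x p)) (allPt n) (proj₂ (∧-elim {inCentb x y} h)) (∈-allPt p))) (target≡ p))))
        -- x^k = y already forces x to commute with y, so the centralizer condition disappears from
        -- the sum.
        (λ h → let e = eqSP⇒≡ {v = powN x k} {y} h ; at = λ p → trans (sym (app-powN x k p)) (cong (λ w → app w p) e) in
          ∧-intro (⇒InCent By (mkComm λ p → trans (cong (app x) (sym (at p))) (trans (iter-comm x 1 k p) (at (app x p)))))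
            (all-intro (λ p → eqPt (iterApp x k p) (target (allFin n) x p)) (allPt n) (λ p _ → ≡⇒eqPt {p = iterApp x k p} {target (allFin n) x p} (trans (at p) (sym (target≡ p))))))
      value₁ : weight (allFin n) x ≈ sgn b (parity x)
      value₁ = ≈-trans (*-cong
          (≈-trans (≡⇒≈ (cong (ω x) (app-ext λ p → trans (cong (λ w → app w p) (restrict-cong {y} {y} {not ∘ processed (allFin n) x} {λ _ → false} (λ p → cong not (done p)) (λ _ _ → refl)))
            (trans (restrict-out {z = y} {λ _ → false} (λ _ → refl) {p} (λ ())) (sym (app-id p)))))) (ω-id Bx))
          (≡⇒≈ (cong (sgn b ∘ parity) (trans (restrict-cong {x} {x} {processed (allFin n) x} {λ _ → true} done (λ _ _ → refl)) (app-ext {v = restrict x (λ _ → true)} {x} λ p → restrict-in {z = x} {λ _ → true} (λ _ → refl) {p} tt)))))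
        (*-identityˡ _)

    -- `central` is ± 1 and commutes with h. This gives the constancy on classes that `Σψ` asks for.
    powN-central : ∀ {h x r} → Bij h → Conj h x r → eqSP (powN x k) central ≡ eqSP (powN r k) central
    powN-central {h} {x} {r} Bh cj = T-ext
        (λ t → ≡⇒eqSP (app-ext λ q → subst (λ q → app (powN r k) q ≡ app central q) (app-invʳ h Bh q) (forth (eqSP⇒≡ {v = powN x k} {central} t) (app (inv h) q))))
        (λ t → ≡⇒eqSP (app-ext λ p → Bij⇒Inj Bh (back (eqSP⇒≡ {v = powN r k} {central} t) p)))
      where
      tr : ∀ a p → iterApp r a (app h p) ≡ app h (iterApp x a p)
      tr zero    p = refl
      tr (suc a) p = trans (cong (app r) (tr a p)) (conj cj (iterApp x a p))
      swapped : ∀ p → app h (app central p) ≡ app central (app h p)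
      swapped p = trans (cong (app h) (app-central p)) (trans (app-flip h b p) (sym (app-central (app h p))))
      forth : powN x k ≡ central → ∀ p → app (powN r k) (app h p) ≡ app central (app h p)
      forth e p = trans (app-powN r k (app h p)) (trans (tr k p) (trans (cong (app h) (trans (sym (app-powN x k p)) (cong (λ w → app w p) e))) (swapped p)))
      back : powN r k ≡ central → ∀ p → app h (app (powN x k) p) ≡ app h (app central p)
      back e p = trans (cong (app h) (app-powN x k p)) (trans (sym (tr k p)) (trans (sym (app-powN r k (app h p))) (trans (cong (λ w → app w (app h p)) e) (sym (swapped p)))))

  -- From signed sums over B_n to roots in D_n

  module _ {y : SP n} (By : Bij y) (k : ℤ) where
    private
      k⁺ : ℕ
      k⁺ = natural {n} k

    Σψ-roots : ∀ {R} → ClassReps n R → ∀ b → Σl (boolFilter (λ x → eqSP (powZ x k) (if b then w0 n else idB n)) R) (λ x → ψ ω x y) ≈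
               Σl (Bl n) (λ x → ifK (eqSP (powN x k⁺) y) (sgn b (parity x)))
    Σψ-roots {R} reps b = begin
        Σl (boolFilter (λ x → eqSP (powZ x k) E.central) R) (λ x → ψ ω x y)
          ≈⟨ I.Σψ reps (λ x → eqSP (powZ x k) E.central) (λ {h} {x} {r} Bh Bx cj → trans (cong (λ w → eqSP w E.central) (powZ≡powN Bx k))
               (trans (E.powN-central Bh cj) (cong (λ w → eqSP w E.central) (sym (powZ≡powN (Conj-Bij Bh Bx cj) k))))) ⟩
        Σl (Bl n) (λ x → ifK (eqSP (powZ x k) E.central) (I.term x))
          ≈⟨ Σl-cong (Bl n) (λ {x} m → ≈-trans (≡⇒≈ (cong (λ w → ifK (eqSP w E.central) (I.term x)) (powZ≡powN (Bl⇒Bij m) k))) (≈-sym (E.summand-first x))) ⟩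
        Σl (Bl n) (H.summand [])            ≈⟨ H.all-steps (allFin n) ⟩
        Σl (Bl n) (H.summand (allFin n))    ≈⟨ Σl-cong (Bl n) (λ m → E.summand-last (Bl⇒Bij m)) ⟩
        Σl (Bl n) (λ x → ifK (eqSP (powN x k⁺) y) (sgn b (parity x))) ∎
      where
      module I = Induced By
      module H = Hybrid By k⁺ b
      module E = Endpoints By k⁺ b

    signed-roots : Σl (Bl n) (λ x → ifK (eqSP (powN x k⁺) y) (sgn false (parity x))) + Σl (Bl n) (λ x → ifK (eqSP (powN x k⁺) y) (sgn true (parity x))) ≈
                   (if isDb y then ι (2 *ℕ rootsD n k y) else 0#)
    signed-roots = ≈-trans (≈-sym (Σl-+ (Bl n) _ _)) (go (isDb y) refl)
      where
      isDb≡ : ∀ {x} → Bij x → isDb x ≡ not (parity x)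
      isDb≡ {x} Bx = trans (cong (_∧ evenb (negCount x)) (T⇒≡ (isB Bx))) (evenb-negCount x)
      two-or-none : ∀ e s → ifK e (sgn false s) + ifK e (sgn true s) ≈ ι 2 * (if not s then (if e then 1# else 0#) else 0#)
      two-or-none true  true  = ≈-trans (-‿inverseʳ 1#) (≈-sym (zeroʳ _))
      two-or-none true  false = ≈-trans (+-congˡ (≈-sym (+-identityʳ 1#))) (≈-sym (*-identityʳ _))
      two-or-none false true  = ≈-trans (+-identityʳ 0#) (≈-sym (zeroʳ _))
      two-or-none false false = ≈-trans (+-identityʳ 0#) (≈-sym (zeroʳ _))
      go : ∀ d → isDb y ≡ d → Σl (Bl n) (λ x → ifK (eqSP (powN x k⁺) y) (sgn false (parity x)) + ifK (eqSP (powN x k⁺) y) (sgn true (parity x))) ≈ (if d then ι (2 *ℕ rootsD n k y) else 0#)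
      go true _ = begin
        Σl (Bl n) (λ x → ifK (eqSP (powN x k⁺) y) (sgn false (parity x)) + ifK (eqSP (powN x k⁺) y) (sgn true (parity x)))
          ≈⟨ Σl-cong (Bl n) (λ {x} m → ≈-trans (two-or-none (eqSP (powN x k⁺) y) (parity x)) (*-congˡ (≡⇒≈ (cong₂ (λ d w → if d then (if eqSP w y then 1# else 0#) else 0#) (sym (isDb≡ (Bl⇒Bij m))) (sym (powZ≡powN (Bl⇒Bij m) k)))))) ⟩
        Σl (Bl n) (λ x → ι 2 * (if isDb x then (if eqSP (powZ x k) y then 1# else 0#) else 0#))   ≈⟨ Σl-*ˡ (Bl n) (ι 2) _ ⟩
        ι 2 * Σl (Bl n) (λ x → if isDb x then (if eqSP (powZ x k) y then 1# else 0#) else 0#)     ≈⟨ *-congˡ (Σl-filter isDb (Bl n) _) ⟨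
        ι 2 * Σl (Dl n) (λ x → if eqSP (powZ x k) y then 1# else 0#)                              ≈⟨ *-congˡ (Σl-count (λ x → eqSP (powZ x k) y) (Dl n)) ⟩
        ι 2 * ι (rootsD n k y)                                                                    ≈⟨ ι-* 2 (rootsD n k y) ⟨
        ι (2 *ℕ rootsD n k y)                                                                     ∎
      go false ne = Σl-0 (Bl n) (λ {x} m → ≈-trans (two-or-none (eqSP (powN x k⁺) y) (parity x)) (≈-trans (*-congˡ (none x (Bl⇒Bij m) (parity x) refl (BP.T? (eqSP (powN x k⁺) y)))) (zeroʳ _)))
        where
        -- Powers of elements of D_n stay in D_n, so a y outside has no roots there.
        none : ∀ x → Bij x → ∀ s → parity x ≡ s → Dec (T (eqSP (powN x k⁺) y)) → (if not s then (if eqSP (powN x k⁺) y then 1# else 0#) else 0#) ≈ 0#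
        none x Bx true  e _ = ≈-refl
        none x Bx false e (no h) = ifK-false h
        none x Bx false e (yes t) = case trans (sym ne) (trans (isDb≡ By) (cong not (trans (cong parity (sym (eqSP⇒≡ {v = powN x k⁺} {y} t))) (trans (parity-powN Bx k⁺) (trans (cong (bmul k⁺) e) (bmul-false k⁺)))))) of λ ()

theorem1p6 : ∀ {c ℓ : Level} (F : CZField c ℓ) → let open CZField F in let open Chars F in
    (k : ℤ) (n : ℕ) → 1 ≤ n →
    (R : List (SP n)) → ClassReps n R →
    (ρ⁺ ρ⁻ : ℕ → Carrier) → FaithfulChoice n ρ⁺ ρ⁻ →
    (ω : SP n → SP n → Carrier) → OmegaFamily n ρ⁺ ρ⁻ ω →
    (y : SP n) → IsB y →
    Σl (boolFilter (λ x → eqSP (powZ x k) (idB n)) R) (λ x → ψ ω x y)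
    + Σl (boolFilter (λ x → eqSP (powZ x k) (w0 n)) R) (λ x → ψ ω x y)
    ≈ (if isDb y then ι (2 *ℕ rootsD n k y) else 0#)
theorem1p6 F k n n≥1 R reps ρ⁺ ρ⁻ faithful ω family y By = CZField.trans F
  (CZField.+-cong F (Σψ-roots (bij By) k reps false) (Σψ-roots (bij By) k reps true)) (signed-roots (bij By) k)
  where open Characters F n≥1 faithful family
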